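{- Let $n,k,\ell$ be positive integers with $k\ge 2$, $\ell\ge 2$ and $n\ge 3.38\max\{k,\ell\}$. If $\mathcal{A}\subseteq\binom{[n]}{k}$ and $\mathcal{B}\subseteq\binom{[n]}{\ell}$ are cross-$2$-intersecting, then $$|\mathcal A||\mathcal B|\le \binom{n-2}{k-2}\binom{n-2}{\ell-2}.$$ Moreover, equality holds if and only if there is a $2$-subset $T$ of $[n]$ such that $\mathcal A=\{A\in\binom{[n]}{k}: T\subset A\}$ and $\mathcal B=\{B\in\binom{[n]}{\ell}: T\subset B\}$.
   Context: $[n]=\{1,\dots,n\}$ and $\binom{[n]}{k}$ denotes the family of all $k$-element subsets of $[n]$. Two families $\mathcal A,\mathcal B$ of subsets of $[n]$ are cross-$2$-intersecting if $|A\cap B|\ge 2$ for all $A\in\mathcal A$, $B\in\mathcal B$. -}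

module Defs where

open import Data.Nat using (ℕ; _≤_)
open import Data.Fin.Subset using (Subset; _∩_; _⊆_; ∣_∣)
open import Data.List using (List)
open import Data.List.Membership.Propositional using (_∈_)
open import Data.List.Relation.Unary.All using (All)
open import Data.List.Relation.Unary.Unique.Propositional using (Unique)
open import Data.Product using (_×_)
open import Function.Bundles using (_⇔_)
open import Relation.Binary.PropositionalEquality using (_≡_)

-- A family of subsets of [n] is a duplicate-free list of subsets of Fin n;
-- its cardinality is the length of the list.

IsKFamily : ∀ {n} → ℕ → List (Subset n) → Set
IsKFamily k 𝒜 = Unique 𝒜 × All (λ A → ∣ A ∣ ≡ k) 𝒜

CrossIntersecting : ∀ {n} → ℕ → List (Subset n) → List (Subset n) → Set
CrossIntersecting t 𝒜 ℬ = ∀ {A B} → A ∈ 𝒜 → B ∈ ℬ → t ≤ ∣ A ∩ B ∣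

IsFullStar : ∀ {n} → ℕ → Subset n → List (Subset n) → Set
IsFullStar k T 𝒜 = ∀ X → (X ∈ 𝒜) ⇔ (∣ X ∣ ≡ k × T ⊆ X)

{-# OPTIONS --safe #-}
-- Upsets U, V of subsets of a prefix [m] of the ground set are weighted by the number of their
-- extensions to k- and ℓ-sets, and the pair is reduced to [m - 1] without decreasing the product.
-- After shifting, two sets x, y of [m - 1] that enter U and V only together with m can violate the
-- intersection condition only if they cover [m - 1] and meet in one point, so ∣ x ∣ + ∣ y ∣ = m.
-- Hence for i + j = m one may drop m from the i-level boundary of U if one deletes the j-level boundary
-- of V, or conversely. If neither change increased the product, both boundaries would be large, while
-- the local LYM inequality bounds one of them by its shadow; for 3 n ≥ 10 max (k, ℓ) this leaves
-- only a few cases with m ≤ 6. Equality is carried back through the shifts by the connectivity of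
-- Kneser graphs.
module Submission where

open import Defs
open import Data.Bool using (Bool; true; false; _∧_; _∨_; not) renaming (_≟_ to _≟ᵇ_)
open import Data.Bool.Properties using (∨-identityʳ; ∧-identityʳ)
open import Data.Empty using (⊥-elim)
open import Data.Fin using (Fin; zero; suc)
import Data.Fin.Properties as Fin
open import Data.Fin.Subset using (Subset; ∣_∣; _∩_; _∪_; _⊆_; ∁; ⊤; ⊥)
open import Data.Fin.Subset.Properties using (p⊆q⇒∣p∣≤∣q∣; drop-∷-⊆; s⊆s; out⊆; ∣p∣≤n; ⊆-refl; ⊆-trans; ⊆⊤; ⊥⊆; ∣p∩q∣≤∣p∣; ∣p∩q∣≤∣q∣; ∣p∣≡n⇒p≡⊤; ∣⊤∣≡n; ∣⊥∣≡0; x∈p∪q⁻; p⊆p∪q; x∈p∩q⁻; x∈p∩q⁺; ∩-comm)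
open import Data.List using (List; []; _∷_; length; allFin)
import Data.List.Membership.DecPropositional as DecMembership
open import Data.List.Membership.Propositional using () renaming (_∈_ to _∈ₗ_)
open import Data.List.Membership.Propositional.Properties using (∈-allFin)
open import Data.List.Relation.Unary.All as All using (_∷_)
open import Data.List.Relation.Unary.All.Properties using (¬Any⇒All¬)
open import Data.List.Relation.Unary.AllPairs using (_∷_)
import Data.List.Relation.Unary.Any as Any
open import Data.List.Relation.Unary.Unique.Propositional using (Unique)
open import Data.Nat using (ℕ; zero; suc; _+_; _*_; _∸_; _⊔_; _≤_; _<_; z≤n; s≤s; _≡ᵇ_; _≤ᵇ_; _≟_; _≤?_; >-nonZero)
open import Data.Nat.Combinatorics using (_C_; nCk+nC[k+1]≡[n+1]C[k+1]; nC1≡n)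
open import Data.Nat.Properties hiding (_≟_; _≤?_)
open import Data.Nat.Tactic.RingSolver using (solve-∀)
open import Data.Product using (_×_; _,_; proj₁; proj₂; ∃-syntax)
open import Data.Sum using (_⊎_; inj₁; inj₂; [_,_]′)
open import Data.Vec using ([]; _∷_; lookup; updateAt; here; there; _[_]≔_)
open import Data.Vec.Properties using ([]=⇒lookup; lookup⇒[]=; []≔-idempotent; []≔-lookup; lookup∘update; lookup∘update′; ≡-dec)
open import Function using (_∘_; id)
open import Function.Bundles using (_⇔_; mk⇔; Equivalence)
open import Relation.Nullary using (¬_; yes; no; contradiction)
open import Relation.Binary.PropositionalEquality

-- The exchange of levels works because of a conversion rate. A boundary set of size i counts
-- `w N k (suc i)` while it needs the last element and `w (suc N) k i` once it does not; these are
-- in the ratio (k - i) : (N + 1). Writing a, b for what survives deletion, α′, β′ for the actual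
-- and α, β for the saturated contributions, the old product (a + α′)(b + β′) competes with (a + α)
-- b and a (b + β). If α′ is small against a, one of these is at least as large, so only one of the
-- two boundaries has to be controlled. It is taken on the smaller level i: an i-set of the m - 1
-- remaining points has j - 1 upward neighbours, so its shadow is comparatively large. Two obstacles
-- shape the equality case. Traces of weight zero have no extension and are invisible to the
-- product, so extremal statements speak only of traces of positive weight. And a shift can merge
-- two different stars: a set of the shifted star may be an original or a moved one. Two opposite
-- choices with disjoint remainders would meet in one point, so along disjoint pairs all choices
-- agree, and connectivity makes the choice global.

Family : ℕ → Set
Family m = Subset m → Bool

-- Indicators, finite sums and coordinate flips.

χ : Bool → ℕ
χ true  = 1
χ false = 0

∑ : ∀ {m} → (Subset m → ℕ) → ℕ
∑ {zero}  f = f []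
∑ {suc m} f = ∑ (λ x → f (false ∷ x)) + ∑ (λ x → f (true ∷ x))

∑-cong : ∀ {m} {f g : Subset m → ℕ} → (∀ x → f x ≡ g x) → ∑ f ≡ ∑ g
∑-cong {zero}  h = h []
∑-cong {suc m} h = cong₂ _+_ (∑-cong (λ x → h (false ∷ x))) (∑-cong (λ x → h (true ∷ x)))

∑-mono-≤ : ∀ {m} {f g : Subset m → ℕ} → (∀ x → f x ≤ g x) → ∑ f ≤ ∑ g
∑-mono-≤ {zero}  h = h []
∑-mono-≤ {suc m} h = +-mono-≤ (∑-mono-≤ (λ x → h (false ∷ x))) (∑-mono-≤ (λ x → h (true ∷ x)))

∑-mono-< : ∀ {m} {f g : Subset m → ℕ} → (∀ x → f x ≤ g x) → ∀ y → f y < g y → ∑ f < ∑ g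
∑-mono-< h [] lt = lt
∑-mono-< h (false ∷ y) lt =
  +-mono-<-≤ (∑-mono-< (λ x → h (false ∷ x)) y lt) (∑-mono-≤ (λ x → h (true ∷ x)))
∑-mono-< h (true ∷ y) lt =
  +-mono-≤-< (∑-mono-≤ (λ x → h (false ∷ x))) (∑-mono-< (λ x → h (true ∷ x)) y lt)

∑-zero : ∀ {m} → ∑ {m} (λ _ → 0) ≡ 0
∑-zero {zero}  = refl
∑-zero {suc m} = cong₂ _+_ (∑-zero {m}) (∑-zero {m})

∑-+ : ∀ {m} (f g : Subset m → ℕ) → ∑ (λ x → f x + g x) ≡ ∑ f + ∑ g
∑-+ {zero}  f g = refl
∑-+ {suc m} f g = trans
  (cong₂ _+_ (∑-+ (λ x → f (false ∷ x)) (λ x → g (false ∷ x)))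
             (∑-+ (λ x → f (true ∷ x)) (λ x → g (true ∷ x))))
  (lemma (∑ (λ x → f (false ∷ x))) _ _ _)
  where
  lemma : ∀ a b c d → (a + b) + (c + d) ≡ (a + c) + (b + d)
  lemma = solve-∀

∑-*ʳ : ∀ {m} (f : Subset m → ℕ) c → ∑ (λ x → f x * c) ≡ ∑ f * c
∑-*ʳ {zero}  f c = refl
∑-*ʳ {suc m} f c = trans
  (cong₂ _+_ (∑-*ʳ (λ x → f (false ∷ x)) c) (∑-*ʳ (λ x → f (true ∷ x)) c))
  (sym (*-distribʳ-+ c (∑ (λ x → f (false ∷ x))) _))

term≤∑ : ∀ {m} (f : Subset m → ℕ) y → f y ≤ ∑ f
term≤∑ f []          = ≤-refl
term≤∑ f (false ∷ y) = ≤-trans (term≤∑ _ y) (m≤m+n _ _)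
term≤∑ f (true ∷ y)  = ≤-trans (term≤∑ _ y) (m≤n+m _ _)

flip : ∀ {m} → Fin m → Subset m → Subset m
flip z x = updateAt x z not

∑-flip : ∀ {m} (z : Fin m) (f : Subset m → ℕ) → ∑ (λ x → f (flip z x)) ≡ ∑ f
∑-flip zero    f = +-comm (∑ (λ x → f (true ∷ x))) _
∑-flip (suc z) f = cong₂ _+_ (∑-flip z (λ x → f (false ∷ x))) (∑-flip z (λ x → f (true ∷ x)))

∑ᶠ : ∀ {m} → (Fin m → ℕ) → ℕ
∑ᶠ {zero}  f = 0
∑ᶠ {suc m} f = f zero + ∑ᶠ (λ z → f (suc z))

∑ᶠ-cong : ∀ {m} {f g : Fin m → ℕ} → (∀ z → f z ≡ g z) → ∑ᶠ f ≡ ∑ᶠ g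
∑ᶠ-cong {zero}  h = refl
∑ᶠ-cong {suc m} h = cong₂ _+_ (h zero) (∑ᶠ-cong (λ z → h (suc z)))

∑ᶠ-mono-≤ : ∀ {m} {f g : Fin m → ℕ} → (∀ z → f z ≤ g z) → ∑ᶠ f ≤ ∑ᶠ g
∑ᶠ-mono-≤ {zero}  h = z≤n
∑ᶠ-mono-≤ {suc m} h = +-mono-≤ (h zero) (∑ᶠ-mono-≤ (λ z → h (suc z)))

∑ᶠ-*ˡ : ∀ {m} c (f : Fin m → ℕ) → ∑ᶠ (λ z → c * f z) ≡ c * ∑ᶠ f
∑ᶠ-*ˡ {zero}  c f = sym (*-zeroʳ c)
∑ᶠ-*ˡ {suc m} c f = trans (cong (c * f zero +_) (∑ᶠ-*ˡ c (λ z → f (suc z))))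
                          (sym (*-distribˡ-+ c (f zero) _))

∑-∑ᶠ-swap : ∀ {m r} (f : Subset m → Fin r → ℕ) →
  ∑ (λ x → ∑ᶠ (f x)) ≡ ∑ᶠ (λ z → ∑ (λ x → f x z))
∑-∑ᶠ-swap {m} {zero}  f = ∑-zero {m}
∑-∑ᶠ-swap {m} {suc r} f = trans (∑-+ (λ x → f x zero) (λ x → ∑ᶠ (λ z → f x (suc z))))
  (cong (∑ (λ x → f x zero) +_) (∑-∑ᶠ-swap (λ x z → f x (suc z))))

card-as-sum : ∀ {m} (x : Subset m) → ∑ᶠ (λ z → χ (lookup x z)) ≡ ∣ x ∣
card-as-sum []          = refl
card-as-sum (false ∷ x) = card-as-sum x
card-as-sum (true ∷ x)  = cong suc (card-as-sum x)

cocard-as-sum : ∀ {m} (x : Subset m) → ∑ᶠ (λ z → χ (not (lookup x z))) + ∣ x ∣ ≡ m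
cocard-as-sum []          = refl
cocard-as-sum (false ∷ x) = cong suc (cocard-as-sum x)
cocard-as-sum (true ∷ x)  = trans (+-suc _ ∣ x ∣) (cong suc (cocard-as-sum x))

flip-lookup : ∀ {m} (z : Fin m) x → lookup (flip z x) z ≡ not (lookup x z)
flip-lookup zero    (b ∷ x) = refl
flip-lookup (suc z) (b ∷ x) = flip-lookup z x

flip-lookup-≢ : ∀ {m} (z z′ : Fin m) x → z′ ≢ z → lookup (flip z x) z′ ≡ lookup x z′
flip-lookup-≢ zero    zero     x       ne = contradiction refl ne
flip-lookup-≢ zero    (suc z′) (b ∷ x) ne = refl
flip-lookup-≢ (suc z) zero     (b ∷ x) ne = refl
flip-lookup-≢ (suc z) (suc z′) (b ∷ x) ne = flip-lookup-≢ z z′ x (ne ∘ cong suc)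

flip-involutive : ∀ {m} (z : Fin m) x → flip z (flip z x) ≡ x
flip-involutive zero    (true ∷ x)  = refl
flip-involutive zero    (false ∷ x) = refl
flip-involutive (suc z) (b ∷ x)     = cong (b ∷_) (flip-involutive z x)

∣flip∣-out : ∀ {m} (z : Fin m) x → lookup x z ≡ false → ∣ flip z x ∣ ≡ suc ∣ x ∣
∣flip∣-out zero    (false ∷ x) _ = refl
∣flip∣-out (suc z) (false ∷ x) h = ∣flip∣-out z x h
∣flip∣-out (suc z) (true ∷ x)  h = cong suc (∣flip∣-out z x h)

∣flip∣-in : ∀ {m} (z : Fin m) x → lookup x z ≡ true → suc ∣ flip z x ∣ ≡ ∣ x ∣
∣flip∣-in zero    (true ∷ x)  _ = refl
∣flip∣-in (suc z) (false ∷ x) h = ∣flip∣-in z x h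
∣flip∣-in (suc z) (true ∷ x)  h = cong suc (∣flip∣-in z x h)

flip-∩-out : ∀ {m} (z : Fin m) x y → lookup y z ≡ false → flip z x ∩ y ≡ x ∩ y
flip-∩-out zero    (true ∷ x)  (false ∷ y) _ = refl
flip-∩-out zero    (false ∷ x) (false ∷ y) _ = refl
flip-∩-out (suc z) (b ∷ x)     (c ∷ y)     h = cong (_ ∷_) (flip-∩-out z x y h)

flip-∩-in : ∀ {m} (z : Fin m) x y → lookup x z ≡ true → lookup y z ≡ true →
  suc ∣ flip z x ∩ y ∣ ≡ ∣ x ∩ y ∣
flip-∩-in zero    (true ∷ x)  (true ∷ y)  _ _ = refl
flip-∩-in (suc z) (true ∷ x)  (true ∷ y)  h h′ = cong suc (flip-∩-in z x y h h′)
flip-∩-in (suc z) (true ∷ x)  (false ∷ y) h h′ = flip-∩-in z x y h h′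
flip-∩-in (suc z) (false ∷ x) (c ∷ y)     h h′ = flip-∩-in z x y h h′

-- Upper-shadow form of the local LYM inequality, by counting incident pairs.
shadow : ∀ {m} i r (D G : Family m) → i + r ≡ m →
  (∀ x → D x ≡ true → ∣ x ∣ ≡ i) → (∀ x → G x ≡ true → ∣ x ∣ ≡ suc i) →
  (∀ x z → D x ≡ true → lookup x z ≡ false → G (flip z x) ≡ true) →
  ∑ (λ x → χ (D x)) * r ≤ ∑ (λ x → χ (G x)) * suc i
shadow {m} i r D G i+r≡m sizeD sizeG up = begin
  ∑ (λ x → χ (D x)) * r
    ≡⟨ ∑-*ʳ (λ x → χ (D x)) r ⟨
  ∑ (λ x → χ (D x) * r)
    ≡⟨ ∑-cong countD ⟩
  ∑ (λ x → ∑ᶠ (λ z → χ (D x) * χ (not (lookup x z))))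
    ≡⟨ ∑-∑ᶠ-swap (λ x z → χ (D x) * χ (not (lookup x z))) ⟩
  ∑ᶠ (λ z → ∑ (λ x → χ (D x) * χ (not (lookup x z))))
    ≤⟨ ∑ᶠ-mono-≤ (λ z → ∑-mono-≤ (incidence z)) ⟩
  ∑ᶠ (λ z → ∑ (λ x → χ (G (flip z x)) * χ (lookup (flip z x) z)))
    ≡⟨ ∑ᶠ-cong (λ z → ∑-flip z (λ x → χ (G x) * χ (lookup x z))) ⟩
  ∑ᶠ (λ z → ∑ (λ x → χ (G x) * χ (lookup x z)))
    ≡⟨ ∑-∑ᶠ-swap (λ x z → χ (G x) * χ (lookup x z)) ⟨
  ∑ (λ x → ∑ᶠ (λ z → χ (G x) * χ (lookup x z)))
    ≡⟨ ∑-cong countG ⟩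
  ∑ (λ x → χ (G x) * suc i)
    ≡⟨ ∑-*ʳ (λ x → χ (G x)) (suc i) ⟩
  ∑ (λ x → χ (G x)) * suc i ∎
  where
  open ≤-Reasoning
  countD : ∀ x → χ (D x) * r ≡ ∑ᶠ (λ z → χ (D x) * χ (not (lookup x z)))
  countD x with D x in eq
  ... | false = sym (∑ᶠ-*ˡ 0 (λ z → χ (not (lookup x z))))
  ... | true  = trans (cong (1 *_) (+-cancelʳ-≡ ∣ x ∣ r _
                  (trans (trans (cong (r +_) (sizeD x eq)) (trans (+-comm r i) i+r≡m))
                         (sym (cocard-as-sum x)))))
                  (sym (∑ᶠ-*ˡ 1 (λ z → χ (not (lookup x z)))))
  countG : ∀ x → ∑ᶠ (λ z → χ (G x) * χ (lookup x z)) ≡ χ (G x) * suc i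
  countG x with G x in eq
  ... | false = ∑ᶠ-*ˡ 0 (λ z → χ (lookup x z))
  ... | true  = trans (∑ᶠ-*ˡ 1 (λ z → χ (lookup x z)))
                  (cong (1 *_) (trans (card-as-sum x) (sizeG x eq)))
  incidence : ∀ z x → χ (D x) * χ (not (lookup x z)) ≤ χ (G (flip z x)) * χ (lookup (flip z x) z)
  incidence z x with D x in eq | lookup x z in eq′
  ... | false | _     = z≤n
  ... | true  | true  = z≤n
  ... | true  | false rewrite up x z eq eq′ | flip-lookup z x | eq′ = ≤-refl

-- The binomial coefficient of N over k - e: the extensions of an e-set to a k-set by N free
-- elements. Recursion on both arguments gives 0 for e > k, where truncated subtraction would give
-- 1.
w : ℕ → ℕ → ℕ → ℕ
w N k       zero    = N C k
w N zero    (suc e) = 0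
w N (suc k) (suc e) = w N k e

-- Binomial identities and their form for extension counts.

Pascal : ∀ n k → suc n C suc k ≡ n C k + n C suc k
Pascal n k = sym (nCk+nC[k+1]≡[n+1]C[k+1] n k)

absorption : ∀ n k → suc k * (suc n C suc k) ≡ suc n * (n C k)
absorption zero    zero    = refl
absorption zero    (suc k) = *-zeroʳ (suc (suc k))
absorption (suc n) zero    = trans (*-identityˡ _) (trans (nC1≡n (2 + n)) (sym (*-identityʳ _)))
absorption (suc n) (suc k) = begin
  suc (suc k) * (suc (suc n) C suc (suc k))
    ≡⟨ cong (suc (suc k) *_) (Pascal (suc n) (suc k)) ⟩
  suc (suc k) * (suc n C suc k + suc n C suc (suc k))
    ≡⟨ expand (suc k) (suc n C suc k) (suc n C suc (suc k)) ⟩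
  suc n C suc k + (suc k * (suc n C suc k) + suc (suc k) * (suc n C suc (suc k)))
    ≡⟨ cong (suc n C suc k +_) (cong₂ _+_ (absorption n k) (absorption n (suc k))) ⟩
  suc n C suc k + (suc n * (n C k) + suc n * (n C suc k))
    ≡⟨ cong (suc n C suc k +_) (trans (sym (*-distribˡ-+ (suc n) (n C k) (n C suc k))) (cong (suc n *_) (sym (Pascal n k)))) ⟩
  suc (suc n) * (suc n C suc k) ∎
  where
  open ≡-Reasoning
  expand : ∀ c a b → suc c * (a + b) ≡ a + (c * a + suc c * b)
  expand = solve-∀

absorption′ : ∀ n k → suc k * (n C suc k) + suc k * (n C k) ≡ suc n * (n C k)
absorption′ n k = trans (sym (*-distribˡ-+ (suc k) (n C suc k) (n C k)))
  (trans (cong (suc k *_) (trans (+-comm (n C suc k) (n C k)) (sym (Pascal n k)))) (absorption n k))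

C-pos : ∀ n k → k ≤ n → 0 < n C k
C-pos n zero _ = s≤s z≤n
C-pos (suc n) (suc k) (s≤s h) = <-≤-trans (C-pos n k h) (≤-trans (m≤m+n _ _) (≤-reflexive (sym (Pascal n k))))

C-pos⁻¹ : ∀ n k → 0 < n C k → k ≤ n
C-pos⁻¹ n       zero    _ = z≤n
C-pos⁻¹ zero    (suc k) ()
C-pos⁻¹ (suc n) (suc k) h with n C k in eq | n C suc k in eq′
... | suc c | _     = s≤s (C-pos⁻¹ n k (subst (0 <_) (sym eq) (s≤s z≤n)))
... | zero  | suc c = m≤n⇒m≤1+n (C-pos⁻¹ n (suc k) (subst (0 <_) (sym eq′) (s≤s z≤n)))
... | zero  | zero  = contradiction (subst (0 <_) (trans (Pascal n k) (cong₂ _+_ eq eq′)) h) λ ()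

w-Pascal : ∀ N k e → w (suc N) k e ≡ w N k e + w N k (suc e)
w-Pascal N zero    zero    = refl
w-Pascal N (suc k) zero    = trans (Pascal N k) (+-comm (N C k) _)
w-Pascal N zero    (suc e) = refl
w-Pascal N (suc k) (suc e) = w-Pascal N k e

w-pos : ∀ N k e → e ≤ k → k ≤ N + e → 0 < w N k e
w-pos N k       zero    _       h = C-pos N k (subst (k ≤_) (+-identityʳ N) h)
w-pos N (suc k) (suc e) (s≤s g) h = w-pos N k e g (≤-pred (subst (suc k ≤_) (+-suc N e) h))

w-pos⇒≤ : ∀ N k e → 0 < w N k e → k ≤ N + e
w-pos⇒≤ N k       zero    h = subst (k ≤_) (sym (+-identityʳ N)) (C-pos⁻¹ N k h)
w-pos⇒≤ N (suc k) (suc e) h = subst (suc k ≤_) (sym (+-suc N e)) (s≤s (w-pos⇒≤ N k e h))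

w-zero : ∀ N k e → k < e → w N k e ≡ 0
w-zero N zero    (suc e) _       = refl
w-zero N (suc k) (suc e) (s≤s h) = w-zero N k e h

-- The number of k-subsets of a ground set of m + N elements whose trace on the prefix of size m
-- belongs to `U`.
weight : ∀ {m} → ℕ → ℕ → Family m → ℕ
weight N k U = ∑ (λ x → χ (U x) * w N k ∣ x ∣)

-- Boolean families, inclusion, and the weight of a star.

∧-true : ∀ {a b} → a ∧ b ≡ true → a ≡ true × b ≡ true
∧-true {true} {true} _ = refl , refl

∧-intro : ∀ {a b} → a ≡ true → b ≡ true → a ∧ b ≡ true
∧-intro refl refl = refl

∨-true : ∀ {a b} → a ∨ b ≡ true → a ≡ true ⊎ b ≡ true
∨-true {true}  _ = inj₁ refl
∨-true {false} h = inj₂ h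

∨-introˡ : ∀ {a b} → a ≡ true → a ∨ b ≡ true
∨-introˡ refl = refl

∨-introʳ : ∀ {a b} → b ≡ true → a ∨ b ≡ true
∨-introʳ {true}  _ = refl
∨-introʳ {false} h = h

true≢false : ∀ {a} {A : Set a} {b} → b ≡ true → b ≡ false → A
true≢false refl ()

lookup⇒⊆ : ∀ {m} {x y : Subset m} → (∀ z → lookup x z ≡ true → lookup y z ≡ true) → x ⊆ y
lookup⇒⊆ {y = y} h {z} z∈x = lookup⇒[]= z y (h z ([]=⇒lookup z∈x))

⊆⇒lookup : ∀ {m} {x y : Subset m} → x ⊆ y → ∀ z → lookup x z ≡ true → lookup y z ≡ true
⊆⇒lookup {x = x} s z h = []=⇒lookup (s (lookup⇒[]= z x h))

∷-⊆ : ∀ {m} {b} {x y : Subset m} → x ⊆ y → b ∷ x ⊆ true ∷ y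
∷-⊆ s here       = here
∷-⊆ s (there z∈) = there (s z∈)

flip-⊇ : ∀ {m} (z : Fin m) x → lookup x z ≡ false → x ⊆ flip z x
flip-⊇ zero    (false ∷ x) _ = out⊆ ⊆-refl
flip-⊇ (suc z) (b ∷ x)     h = s⊆s (flip-⊇ z x h)

flip-⊆ : ∀ {m} (z : Fin m) x → lookup x z ≡ true → flip z x ⊆ x
flip-⊆ zero    (true ∷ x) _ = out⊆ ⊆-refl
flip-⊆ (suc z) (b ∷ x)    h = s⊆s (flip-⊆ z x h)

flip-mono : ∀ {m} (z : Fin m) {x y : Subset m} → lookup x z ≡ lookup y z → x ⊆ y → flip z x ⊆ flip z y
flip-mono z {x} {y} e s = lookup⇒⊆ go
  where
  go : ∀ z′ → lookup (flip z x) z′ ≡ true → lookup (flip z y) z′ ≡ true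
  go z′ h with z′ Fin.≟ z
  ... | yes refl = trans (flip-lookup z y) (trans (cong not (sym e)) (trans (sym (flip-lookup z x)) h))
  ... | no ne = trans (flip-lookup-≢ z z′ y ne)
                  (⊆⇒lookup s z′ (trans (sym (flip-lookup-≢ z z′ x ne)) h))

_⊆ᵇ_ : ∀ {m} → Subset m → Subset m → Bool
[]          ⊆ᵇ []      = true
(false ∷ t) ⊆ᵇ (b ∷ x) = t ⊆ᵇ x
(true ∷ t)  ⊆ᵇ (b ∷ x) = b ∧ (t ⊆ᵇ x)

⊆ᵇ⇒⊆ : ∀ {m} (t x : Subset m) → (t ⊆ᵇ x) ≡ true → t ⊆ x
⊆ᵇ⇒⊆ (false ∷ t) (b ∷ x)    h = out⊆ (⊆ᵇ⇒⊆ t x h)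
⊆ᵇ⇒⊆ (true ∷ t)  (true ∷ x) h = ∷-⊆ (⊆ᵇ⇒⊆ t x h)
⊆ᵇ⇒⊆ []          []         h = λ ()

⊆⇒⊆ᵇ : ∀ {m} (t x : Subset m) → t ⊆ x → (t ⊆ᵇ x) ≡ true
⊆⇒⊆ᵇ []          []      s = refl
⊆⇒⊆ᵇ (false ∷ t) (b ∷ x) s = ⊆⇒⊆ᵇ t x (drop-∷-⊆ s)
⊆⇒⊆ᵇ (true ∷ t)  (b ∷ x) s with s here
... | here = ⊆⇒⊆ᵇ t x (drop-∷-⊆ s)

-- The offset `s` counts the elements of the centre already passed, which lets the induction cross a
-- coordinate of `t`. A coordinate outside `t` joins the free elements by Pascal's rule.
star-weight : ∀ {m} N k s (t : Subset m) →
  ∑ (λ x → χ (t ⊆ᵇ x) * w N k (s + ∣ x ∣)) ≡ w (N + ∣ ∁ t ∣) k (s + ∣ t ∣)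
star-weight N k s [] = trans (+-identityʳ _) (cong (λ M → w M k (s + 0)) (sym (+-identityʳ N)))
star-weight N k s (false ∷ t) = begin
  ∑ (λ x → χ (t ⊆ᵇ x) * w N k (s + ∣ x ∣)) + ∑ (λ x → χ (t ⊆ᵇ x) * w N k (s + suc ∣ x ∣))
    ≡⟨ ∑-+ (λ x → χ (t ⊆ᵇ x) * w N k (s + ∣ x ∣)) (λ x → χ (t ⊆ᵇ x) * w N k (s + suc ∣ x ∣)) ⟨
  ∑ (λ x → χ (t ⊆ᵇ x) * w N k (s + ∣ x ∣) + χ (t ⊆ᵇ x) * w N k (s + suc ∣ x ∣))
    ≡⟨ ∑-cong merge ⟩
  ∑ (λ x → χ (t ⊆ᵇ x) * w (suc N) k (s + ∣ x ∣))
    ≡⟨ star-weight (suc N) k s t ⟩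
  w (suc N + ∣ ∁ t ∣) k (s + ∣ t ∣)
    ≡⟨ cong (λ M → w M k (s + ∣ t ∣)) (sym (+-suc N _)) ⟩
  w (N + suc ∣ ∁ t ∣) k (s + ∣ t ∣) ∎
  where
  open ≡-Reasoning
  merge : ∀ x → χ (t ⊆ᵇ x) * w N k (s + ∣ x ∣) + χ (t ⊆ᵇ x) * w N k (s + suc ∣ x ∣)
              ≡ χ (t ⊆ᵇ x) * w (suc N) k (s + ∣ x ∣)
  merge x = trans (sym (*-distribˡ-+ (χ (t ⊆ᵇ x)) (w N k (s + ∣ x ∣)) (w N k (s + suc ∣ x ∣))))
    (cong (χ (t ⊆ᵇ x) *_) (trans (cong (λ e → w N k (s + ∣ x ∣) + w N k e) (+-suc s ∣ x ∣))
                                  (sym (w-Pascal N k (s + ∣ x ∣)))))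
star-weight {suc m} N k s (true ∷ t) = begin
  ∑ {m} (λ x → 0) + ∑ (λ x → χ (t ⊆ᵇ x) * w N k (s + suc ∣ x ∣))
    ≡⟨ cong₂ _+_ (∑-zero {m}) (∑-cong (λ x → cong (λ e → χ (t ⊆ᵇ x) * w N k e) (+-suc s ∣ x ∣))) ⟩
  ∑ (λ x → χ (t ⊆ᵇ x) * w N k (suc s + ∣ x ∣))
    ≡⟨ star-weight N k (suc s) t ⟩
  w (N + ∣ ∁ t ∣) k (suc s + ∣ t ∣)
    ≡⟨ cong (w (N + ∣ ∁ t ∣) k) (sym (+-suc s ∣ t ∣)) ⟩
  w (N + ∣ ∁ t ∣) k (s + suc ∣ t ∣) ∎
  where open ≡-Reasoning

-- Cross-2-intersecting upsets and the shift.

Upset : ∀ {m} → Family m → Set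
Upset U = ∀ {x y} → x ⊆ y → U x ≡ true → U y ≡ true

Cross : ∀ {m} → Family m → Family m → Set
Cross U V = ∀ x y → U x ≡ true → V y ≡ true → 2 ≤ ∣ x ∩ y ∣

Cross-sym : ∀ {m} {U V : Family m} → Cross U V → Cross V U
Cross-sym c x y v u = subst (λ s → 2 ≤ ∣ s ∣) (∩-comm y x) (c y x u v)

-- The shift that trades the head coordinate, which plays the role of the last element, for z.
compress : ∀ {m} → Fin m → Family (suc m) → Family (suc m)
compress z U (true ∷ x)  = U (true ∷ x) ∧ (lookup x z ∨ U (false ∷ flip z x))
compress z U (false ∷ x) = U (false ∷ x) ∨ (lookup x z ∧ U (true ∷ flip z x))

Compressed : ∀ {m} → Fin m → Family (suc m) → Set
Compressed z U = ∀ x → lookup x z ≡ false → U (true ∷ x) ≡ true → U (false ∷ flip z x) ≡ true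

-- Pair `true ∷ x` with `false ∷ flip z x`. If z is not in x, the two have equal size and the shift
-- replaces their memberships by "and" and "or"; if z is in x, neither changes.
compress-weight : ∀ {m} N k (z : Fin m) (U : Family (suc m)) →
  weight N k (compress z U) ≡ weight N k U
compress-weight {m} N k z U = begin
  ∑ (f (compress z U)) + ∑ (g (compress z U))
    ≡⟨ cong (_+ ∑ (g (compress z U))) (∑-flip z (f (compress z U))) ⟨
  ∑ (λ x → f (compress z U) (flip z x)) + ∑ (g (compress z U))
    ≡⟨ ∑-+ (λ x → f (compress z U) (flip z x)) (g (compress z U)) ⟨
  ∑ (λ x → f (compress z U) (flip z x) + g (compress z U) x)
    ≡⟨ ∑-cong pair ⟩
  ∑ (λ x → f U (flip z x) + g U x)
    ≡⟨ ∑-+ (λ x → f U (flip z x)) (g U) ⟩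
  ∑ (λ x → f U (flip z x)) + ∑ (g U)
    ≡⟨ cong (_+ ∑ (g U)) (∑-flip z (f U)) ⟩
  ∑ (f U) + ∑ (g U) ∎
  where
  open ≡-Reasoning
  f g : Family (suc m) → Subset m → ℕ
  f F x = χ (F (false ∷ x)) * w N k ∣ x ∣
  g F x = χ (F (true ∷ x)) * w N k (suc ∣ x ∣)
  χ-∨-∧ : ∀ a b → χ (a ∨ b) + χ (b ∧ a) ≡ χ a + χ b
  χ-∨-∧ true  true  = refl
  χ-∨-∧ true  false = refl
  χ-∨-∧ false true  = refl
  χ-∨-∧ false false = refl
  pair : ∀ x → f (compress z U) (flip z x) + g (compress z U) x ≡ f U (flip z x) + g U x
  pair x with lookup x z in eq
  ... | true rewrite trans (flip-lookup z x) (cong not eq)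
                   | ∨-identityʳ (U (false ∷ flip z x)) | ∧-identityʳ (U (true ∷ x)) = refl
  ... | false rewrite trans (flip-lookup z x) (cong not eq)
                   | flip-involutive z x | ∣flip∣-out z x eq
                   | sym (*-distribʳ-+ (w N k (suc ∣ x ∣)) (χ (U (false ∷ flip z x) ∨ U (true ∷ x)))
                                       (χ (U (true ∷ x) ∧ U (false ∷ flip z x))))
                   | χ-∨-∧ (U (false ∷ flip z x)) (U (true ∷ x))
                   = *-distribʳ-+ (w N k (suc ∣ x ∣)) (χ (U (false ∷ flip z x))) (χ (U (true ∷ x)))

-- The delicate case is a moved set against one that kept the head (`mixed`). The latter contains z,
-- which makes up for the lost head, or its own shift was present too, and that shift meets the
-- original of the moved set in equally many points.
compress-cross : ∀ {m} (z : Fin m) {U V : Family (suc m)} →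
  Cross U V → Cross (compress z U) (compress z V)
compress-cross {m} z {U} {V} cross = go
  where
  mixed : ∀ {F G : Family (suc m)} → Cross F G → ∀ x y →
    F (true ∷ x) ≡ true → lookup x z ∨ F (false ∷ flip z x) ≡ true →
    lookup y z ≡ true → G (true ∷ flip z y) ≡ true → 2 ≤ ∣ x ∩ y ∣
  mixed c x y f f′ yz g with lookup x z in eq
  ... | true  = subst (2 ≤_)
    (trans (cong (suc ∘ ∣_∣) (∩-comm x (flip z y)))
      (trans (flip-∩-in z y x yz eq) (cong ∣_∣ (∩-comm y x)))) (c _ _ f g)
  ... | false = subst (2 ≤_) (cong ∣_∣
    (trans (flip-∩-out z x (flip z y) (trans (flip-lookup z y) (cong not yz)))
      (trans (∩-comm x _) (trans (flip-∩-out z y x eq) (∩-comm y x))))) (c _ _ f′ g)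
  shrink : ∀ x y → lookup y z ≡ true → ∣ x ∩ flip z y ∣ ≤ ∣ x ∩ y ∣
  shrink x y yz with lookup x z in eq
  ... | true  = ≤-trans (n≤1+n _) (≤-reflexive (trans (cong (suc ∘ ∣_∣) (∩-comm x (flip z y)))
      (trans (flip-∩-in z y x yz eq) (cong ∣_∣ (∩-comm y x)))))
  ... | false = ≤-reflexive (cong ∣_∣ (trans (∩-comm x _) (trans (flip-∩-out z y x eq) (∩-comm y x))))
  go : Cross (compress z U) (compress z V)
  go (true ∷ x) (true ∷ y) u v = cross _ _ (proj₁ (∧-true u)) (proj₁ (∧-true v))
  go (true ∷ x) (false ∷ y) u v with ∧-true {U (true ∷ x)} u | ∨-true {V (false ∷ y)} v
  ... | u₁ , u₂ | inj₁ v₁ = cross _ _ u₁ v₁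
  ... | u₁ , u₂ | inj₂ v₂ with ∧-true v₂
  ...   | yz , v₁ = mixed cross x y u₁ u₂ yz v₁
  go (false ∷ x) (true ∷ y) u v with ∨-true {U (false ∷ x)} u | ∧-true {V (true ∷ y)} v
  ... | inj₁ u₁ | v₁ , v₂ = cross _ _ u₁ v₁
  ... | inj₂ u₂ | v₁ , v₂ with ∧-true u₂
  ...   | xz , u₁ = subst (λ s → 2 ≤ ∣ s ∣) (∩-comm y x) (mixed {V} {U} (Cross-sym {U = U} {V} cross) y x v₁ v₂ xz u₁)
  go (false ∷ x) (false ∷ y) u v with ∨-true {U (false ∷ x)} u | ∨-true {V (false ∷ y)} v
  ... | inj₁ u₁ | inj₁ v₁ = cross _ _ u₁ v₁
  ... | inj₁ u₁ | inj₂ v₂ with ∧-true v₂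
  ...   | yz , v₁ = ≤-trans (cross _ _ u₁ v₁) (shrink x y yz)
  go (false ∷ x) (false ∷ y) u v | inj₂ u₂ | inj₁ v₁ with ∧-true u₂
  ...   | xz , u₁ = subst (λ s → 2 ≤ ∣ s ∣) (∩-comm y x)
                      (≤-trans (subst (λ s → 2 ≤ ∣ s ∣) (∩-comm (flip z x) y) (cross _ _ u₁ v₁)) (shrink y x xz))
  go (false ∷ x) (false ∷ y) u v | inj₂ u₂ | inj₂ v₂ with ∧-true u₂ | ∧-true v₂
  ...   | xz , u₁ | yz , v₁ = subst (2 ≤_)
    (trans (cong suc (cong ∣_∣ (trans (∩-comm (flip z x) (flip z y))
       (trans (flip-∩-out z y (flip z x) (trans (flip-lookup z x) (cong not xz))) (∩-comm y (flip z x))))))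
       (flip-∩-in z x y xz yz)) (cross _ _ u₁ v₁)

compress-upset : ∀ {m} (z : Fin m) {U : Family (suc m)} → Upset U → Upset (compress z U)
compress-upset z {U} up {true ∷ x} {false ∷ y} s u with s here
... | ()
compress-upset z {U} up {false ∷ x} {false ∷ y} s u with ∨-true {U (false ∷ x)} u
... | inj₁ u₁ = ∨-introˡ (up s u₁)
... | inj₂ u₂ with ∧-true u₂
...   | xz , u₁ = ∨-introʳ {U (false ∷ y)} (∧-intro yz
                    (up (s⊆s (flip-mono z (trans xz (sym yz)) (drop-∷-⊆ s))) u₁))
  where yz = ⊆⇒lookup (drop-∷-⊆ s) z xz
compress-upset z {U} up {true ∷ x} {true ∷ y} s u with ∧-true {U (true ∷ x)} u
... | u₁ , u₂ = ∧-intro (up s u₁) tail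
  where
  tail : lookup y z ∨ U (false ∷ flip z y) ≡ true
  tail with lookup y z in eqy
  ... | true = refl
  ... | false with lookup x z in eqx
  ...   | true  = true≢false (⊆⇒lookup (drop-∷-⊆ s) z eqx) eqy
  ...   | false = up (s⊆s (flip-mono z (trans eqx (sym eqy)) (drop-∷-⊆ s))) u₂
compress-upset z {U} up {false ∷ x} {true ∷ y} s u = go (∨-true {U (false ∷ x)} u)
  where
  x⊆y = drop-∷-⊆ s
  go : U (false ∷ x) ≡ true ⊎ lookup x z ∧ U (true ∷ flip z x) ≡ true →
       compress z U (true ∷ y) ≡ true
  go (inj₁ u₁) = ∧-intro (up s u₁) tail
    where
    tail : lookup y z ∨ U (false ∷ flip z y) ≡ true
    tail with lookup y z in eqy
    ... | true  = refl
    ... | false = up (s⊆s (⊆-trans x⊆y (flip-⊇ z y eqy))) u₁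
  go (inj₂ u₂) with ∧-true u₂
  ... | xz , u₁ = ∧-intro (up (s⊆s (⊆-trans (flip-⊆ z x xz) x⊆y)) u₁)
                          (∨-introˡ (⊆⇒lookup x⊆y z xz))

compress-compressed : ∀ {m} (z : Fin m) (U : Family (suc m)) → Compressed z (compress z U)
compress-compressed z U x xz u with ∧-true {U (true ∷ x)} u
... | u₁ , u₂ rewrite xz = ∨-introˡ u₂

-- A shift creates no set with the head and loses none without it. Hence a single pass over all z
-- leaves the family stable under every shift.
compress-preserves-compressed : ∀ {m} (z z′ : Fin m) {U : Family (suc m)} →
  Compressed z′ U → Compressed z′ (compress z U)
compress-preserves-compressed z z′ {U} c x xz u = ∨-introˡ (c x xz (proj₁ (∧-true u)))

-- A trace of weight zero belongs to no set of the required size, so nothing can be deduced about it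
-- from a product of weights.
Contained : ∀ {m} → ℕ → ℕ → Subset m → Family m → Set
Contained k N T U = ∀ x → U x ≡ true → 0 < w N k ∣ x ∣ → T ⊆ x

-- Unions, complements and connectivity of Kneser graphs.

∣∪∣+∣∩∣ : ∀ {m} (x y : Subset m) → ∣ x ∪ y ∣ + ∣ x ∩ y ∣ ≡ ∣ x ∣ + ∣ y ∣
∣∪∣+∣∩∣ [] [] = refl
∣∪∣+∣∩∣ (true ∷ x) (true ∷ y) = cong suc (trans (+-suc _ _) (trans (cong suc (∣∪∣+∣∩∣ x y)) (sym (+-suc _ _))))
∣∪∣+∣∩∣ (true ∷ x) (false ∷ y) = cong suc (∣∪∣+∣∩∣ x y)
∣∪∣+∣∩∣ (false ∷ x) (true ∷ y) = trans (cong suc (∣∪∣+∣∩∣ x y)) (sym (+-suc _ _))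
∣∪∣+∣∩∣ (false ∷ x) (false ∷ y) = ∣∪∣+∣∩∣ x y

∣∪∣-disjoint : ∀ {m} (x y : Subset m) → ∣ x ∩ y ∣ ≡ 0 → ∣ x ∪ y ∣ ≡ ∣ x ∣ + ∣ y ∣
∣∪∣-disjoint x y d = trans (sym (trans (cong (∣ x ∪ y ∣ +_) d) (+-identityʳ _))) (∣∪∣+∣∩∣ x y)

∪-⊆ : ∀ {m} {x y z : Subset m} → x ⊆ z → y ⊆ z → x ∪ y ⊆ z
∪-⊆ {x = x} {y} s t i = [ s , t ]′ (x∈p∪q⁻ x y i)

disjoint⇒⊆∁ : ∀ {m} (t x : Subset m) → ∣ t ∩ x ∣ ≡ 0 → x ⊆ ∁ t
disjoint⇒⊆∁ [] [] _ = λ ()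
disjoint⇒⊆∁ (true ∷ t) (false ∷ x) d = s⊆s (disjoint⇒⊆∁ t x d)
disjoint⇒⊆∁ (false ∷ t) (b ∷ x) d = ∷-⊆ (disjoint⇒⊆∁ t x d)

⊆∁⇒disjoint : ∀ {m} (t x : Subset m) → x ⊆ ∁ t → ∣ t ∩ x ∣ ≡ 0
⊆∁⇒disjoint [] [] _ = refl
⊆∁⇒disjoint (true ∷ t) (false ∷ x) s = ⊆∁⇒disjoint t x (drop-∷-⊆ s)
⊆∁⇒disjoint (true ∷ t) (true ∷ x) s with s here
... | ()
⊆∁⇒disjoint (false ∷ t) (b ∷ x) s = ⊆∁⇒disjoint t x (drop-∷-⊆ s)

∣∁∣ : ∀ {m} (t : Subset m) → ∣ ∁ t ∣ + ∣ t ∣ ≡ m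
∣∁∣ [] = refl
∣∁∣ (true ∷ t) = trans (+-suc _ _) (cong suc (∣∁∣ t))
∣∁∣ (false ∷ t) = cong suc (∣∁∣ t)

avoiding : ∀ {m} (R x : Subset m) q → x ⊆ R → ∣ x ∣ + q ≤ ∣ R ∣ →
  ∃[ y ] (y ⊆ R × ∣ y ∣ ≡ q × ∣ x ∩ y ∣ ≡ 0)
avoiding [] [] zero s h = [] , id , refl , refl
avoiding (false ∷ R) (true ∷ x) q s h with s here
... | ()
avoiding (false ∷ R) (false ∷ x) q s h with avoiding R x q (drop-∷-⊆ s) h
... | y , y⊆R , ∣y∣ , d = false ∷ y , s⊆s y⊆R , ∣y∣ , d
avoiding (true ∷ R) (true ∷ x) q s (s≤s h) with avoiding R x q (drop-∷-⊆ s) h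
... | y , y⊆R , ∣y∣ , d = false ∷ y , out⊆ y⊆R , ∣y∣ , d
avoiding (true ∷ R) (false ∷ x) zero s h
  with avoiding R x zero (drop-∷-⊆ s) (subst (_≤ ∣ R ∣) (sym (+-identityʳ _)) (p⊆q⇒∣p∣≤∣q∣ (drop-∷-⊆ s)))
... | y , y⊆R , ∣y∣ , d = false ∷ y , out⊆ y⊆R , ∣y∣ , d
avoiding (true ∷ R) (false ∷ x) (suc q) s h
  with avoiding R x q (drop-∷-⊆ s) (≤-pred (subst (_≤ suc ∣ R ∣) (+-suc ∣ x ∣ q) h))
... | y , y⊆R , ∣y∣ , d = true ∷ y , ∷-⊆ y⊆R , cong suc ∣y∣ , d

subset-of-size : ∀ {m} (R : Subset m) q → q ≤ ∣ R ∣ → ∃[ y ] (y ⊆ R × ∣ y ∣ ≡ q)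
subset-of-size {m} R q h with avoiding R ⊥ q ⊥⊆ (subst (λ s → s + q ≤ ∣ R ∣) (sym (∣⊥∣≡0 m)) h)
... | y , y⊆R , ∣y∣ , _ = y , y⊆R , ∣y∣

-- Connectivity of the bipartite Kneser graph on p- and q-subsets of R.
kneser : ∀ {m} {A : Set} (R : Subset m) p q (f g : Subset m → A) → p ≡ 0 ⊎ p + q < ∣ R ∣ →
  (∀ x y → x ⊆ R → y ⊆ R → ∣ x ∣ ≡ p → ∣ y ∣ ≡ q → ∣ x ∩ y ∣ ≡ 0 → f x ≡ g y) →
  ∀ x y → x ⊆ R → y ⊆ R → ∣ x ∣ ≡ p → ∣ y ∣ ≡ q → f x ≡ g y
kneser R zero q f g room link x y x⊆R y⊆R ∣x∣ ∣y∣ =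
  link x y x⊆R y⊆R ∣x∣ ∣y∣ (n≤0⇒n≡0 (subst (∣ x ∩ y ∣ ≤_) ∣x∣ (∣p∩q∣≤∣p∣ x y)))
kneser R (suc p) zero f g room link x y x⊆R y⊆R ∣x∣ ∣y∣ =
  link x y x⊆R y⊆R ∣x∣ ∣y∣ (n≤0⇒n≡0 (subst (∣ x ∩ y ∣ ≤_) ∣y∣ (∣p∩q∣≤∣q∣ x y)))
kneser R (suc p) (suc q) f g (inj₁ ())
kneser [] (suc p) (suc q) f g (inj₂ ())
kneser (false ∷ R) (suc p) (suc q) f g (inj₂ room) link x y x⊆R y⊆R ∣x∣ ∣y∣ = go x y x⊆R y⊆R ∣x∣ ∣y∣
  where
  go : ∀ x y → x ⊆ false ∷ R → y ⊆ false ∷ R → ∣ x ∣ ≡ suc p → ∣ y ∣ ≡ suc q → f x ≡ g y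
  go (true ∷ x) y s t with s here
  ... | ()
  go (false ∷ x) (true ∷ y) s t with t here
  ... | ()
  go (false ∷ x) (false ∷ y) s t = kneser R (suc p) (suc q) (λ x → f (false ∷ x)) (λ y → g (false ∷ y)) (inj₂ room)
    (λ x y s t → link (false ∷ x) (false ∷ y) (s⊆s s) (s⊆s t)) x y (drop-∷-⊆ s) (drop-∷-⊆ t)
kneser (true ∷ R) (suc p) (suc q) f g (inj₂ room) link x y x⊆R y⊆R ∣x∣ ∣y∣ = go x y x⊆R y⊆R ∣x∣ ∣y∣
  where
  room′ : suc p + suc q ≤ ∣ R ∣
  room′ = ≤-pred room
  in-out : ∀ x y → x ⊆ R → y ⊆ R → ∣ x ∣ ≡ p → ∣ y ∣ ≡ suc q → f (true ∷ x) ≡ g (false ∷ y)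
  in-out = kneser R p (suc q) (λ x → f (true ∷ x)) (λ y → g (false ∷ y)) (inj₂ room′)
    (λ x y s t a b d → link (true ∷ x) (false ∷ y) (∷-⊆ s) (out⊆ t) (cong suc a) b d)
  out-in : ∀ x y → x ⊆ R → y ⊆ R → ∣ x ∣ ≡ suc p → ∣ y ∣ ≡ q → f (false ∷ x) ≡ g (true ∷ y)
  out-in = kneser R (suc p) q (λ x → f (false ∷ x)) (λ y → g (true ∷ y)) (inj₂ (subst (_≤ ∣ R ∣) (+-suc (suc p) q) room′))
    (λ x y s t a b d → link (false ∷ x) (true ∷ y) (out⊆ s) (∷-⊆ t) a (cong suc b) d)
  go : ∀ x y → x ⊆ true ∷ R → y ⊆ true ∷ R → ∣ x ∣ ≡ suc p → ∣ y ∣ ≡ suc q → f x ≡ g y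
  go (true ∷ x) (false ∷ y) s t a b = in-out x y (drop-∷-⊆ s) (drop-∷-⊆ t) (suc-injective a) b
  go (false ∷ x) (true ∷ y) s t a b = out-in x y (drop-∷-⊆ s) (drop-∷-⊆ t) a (suc-injective b)
  go (false ∷ x) (false ∷ y) s t a b
    with avoiding R x (suc q) (drop-∷-⊆ s) (subst (λ s → s + suc q ≤ ∣ R ∣) (sym a) room′)
       | subset-of-size R p (≤-trans (m≤m+n p (suc q)) (≤-trans (n≤1+n _) room′))
  ... | y₀ , y₀⊆R , ∣y₀∣ , d | x₀ , x₀⊆R , ∣x₀∣ =
    trans (link (false ∷ x) (false ∷ y₀) s (out⊆ y₀⊆R) a ∣y₀∣ d)
      (trans (sym (in-out x₀ y₀ x₀⊆R y₀⊆R ∣x₀∣ ∣y₀∣)) (in-out x₀ y x₀⊆R (drop-∷-⊆ t) ∣x₀∣ b))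
  go (true ∷ x) (true ∷ y) s t a b
    with subset-of-size R (suc p) (≤-trans (m≤m+n (suc p) (suc q)) room′)
  ... | x₀ , x₀⊆R , ∣x₀∣ with avoiding R x₀ (suc q) x₀⊆R (subst (λ s → s + suc q ≤ ∣ R ∣) (sym ∣x₀∣) room′)
  ...   | y₀ , y₀⊆R , ∣y₀∣ , d =
    trans (in-out x y₀ (drop-∷-⊆ s) y₀⊆R (suc-injective a) ∣y₀∣)
      (trans (sym (link (false ∷ x₀) (false ∷ y₀) (out⊆ x₀⊆R) (out⊆ y₀⊆R) ∣x₀∣ ∣y₀∣ d))
             (out-in x₀ y x₀⊆R (drop-∷-⊆ t) ∣x₀∣ (suc-injective b)))

-- The transposition behind a shift.

swap-head : ∀ {m} → Fin m → Subset (suc m) → Subset (suc m)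
swap-head z (b ∷ x) = lookup x z ∷ (x [ z ]≔ b)

≔-same : ∀ {m} (z : Fin m) (x : Subset m) {b} → lookup x z ≡ b → x [ z ]≔ b ≡ x
≔-same z x refl = []≔-lookup x z

≔-flip : ∀ {m} (z : Fin m) (x : Subset m) {b} → lookup x z ≡ not b → x [ z ]≔ b ≡ flip z x
≔-flip zero    (true ∷ x)  {false} _ = refl
≔-flip zero    (false ∷ x) {true}  _ = refl
≔-flip (suc z) (c ∷ x)     h = cong (c ∷_) (≔-flip z x h)

swap-head-involutive : ∀ {m} (z : Fin m) x → swap-head z (swap-head z x) ≡ x
swap-head-involutive z (b ∷ x) =
  cong₂ _∷_ (lookup∘update z x b) (trans ([]≔-idempotent x z) ([]≔-lookup x z))

∣swap-head∣ : ∀ {m} (z : Fin m) x → ∣ swap-head z x ∣ ≡ ∣ x ∣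
∣swap-head∣ z (true ∷ x) with lookup x z in eq
... | true  = cong (suc ∘ ∣_∣) (≔-same z x eq)
... | false = trans (cong ∣_∣ (≔-flip z x eq)) (∣flip∣-out z x eq)
∣swap-head∣ z (false ∷ x) with lookup x z in eq
... | true  = trans (cong (suc ∘ ∣_∣) (≔-flip z x eq)) (∣flip∣-in z x eq)
... | false = cong ∣_∣ (≔-same z x eq)

swap-head-mono : ∀ {m} (z : Fin m) {x y} → x ⊆ y → swap-head z x ⊆ swap-head z y
swap-head-mono z {b ∷ x} {c ∷ y} s = lookup⇒⊆ go
  where
  go : ∀ z′ → lookup (swap-head z (b ∷ x)) z′ ≡ true → lookup (swap-head z (c ∷ y)) z′ ≡ true
  go zero     h = ⊆⇒lookup s (suc z) h
  go (suc z′) h with z′ Fin.≟ z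
  ... | yes refl = trans (lookup∘update z y c) (⊆⇒lookup s zero (trans (sym (lookup∘update z x b)) h))
  ... | no ne    = trans (lookup∘update′ ne y c) (⊆⇒lookup s (suc z′) (trans (sym (lookup∘update′ ne x b)) h))

-- Of each pair exchanged by the transposition the shift sees only how many sets are present, so a
-- family and its swapped copy shift alike. This reduces the second possible star to the first.
compress-swap-head : ∀ {m} (z : Fin m) (U : Family (suc m)) x →
  compress z (U ∘ swap-head z) x ≡ true → compress z U x ≡ true
compress-swap-head z U (true ∷ x) u with lookup x z in eq
... | true rewrite ≔-same z x eq = u
... | false rewrite ≔-flip z x {true} eq | trans (flip-lookup z x) (cong not eq)
                  | ≔-flip z (flip z x) {false} (trans (flip-lookup z x) (cong not eq))
                  | flip-involutive z x with ∧-true {U (false ∷ flip z x)} u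
...   | u₁ , u₂ = ∧-intro u₂ u₁
compress-swap-head z U (false ∷ x) u with lookup x z in eq
... | true rewrite ≔-flip z x {false} eq | trans (flip-lookup z x) (cong not eq)
                  | ≔-flip z (flip z x) {true} (trans (flip-lookup z x) (cong not eq))
                  | flip-involutive z x with ∨-true {U (true ∷ flip z x)} u
...   | inj₁ u₁ = ∨-introʳ {U (false ∷ x)} u₁
...   | inj₂ u₂ = ∨-introˡ u₂
compress-swap-head z U (false ∷ x) u | false rewrite ≔-same z x eq = u

-- Take a set of `U` with the head but without z. Its shift contains `τ`, hence some `τ ∪ y` with y
-- of the minimal size `p`; these are in `U`, so the shift is too. The set therefore survives the
-- compression and must contain `τ`, hence z, a contradiction.
contained-uncompress : ∀ {m} k N (z : Fin m) {U : Family (suc m)} τ p → Upset U →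
  lookup τ z ≡ true → ∣ τ ∣ ≡ 2 → Contained k N (false ∷ τ) (compress z U) →
  (∀ e → 2 ≤ e → 0 < w N k e → 2 + p ≤ e) →
  (∀ x → x ⊆ ∁ τ → ∣ x ∣ ≡ p → U (false ∷ (τ ∪ x)) ≡ true) →
  Contained k N (false ∷ τ) U
contained-uncompress k N z {U} τ p up τz ∣τ∣ con minimal full (false ∷ x) u pos =
  con (false ∷ x) (∨-introˡ u) pos
contained-uncompress k N z {U} τ p up τz ∣τ∣ con minimal full (true ∷ x) u pos with lookup x z in eq
... | true  = con (true ∷ x) (∧-intro u (∨-introˡ eq)) pos
... | false = true≢false (⊆⇒lookup (drop-∷-⊆ (con (true ∷ x) (∧-intro u (∨-introʳ {lookup x z} inU)) pos)) z τz) eq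
  where
  x⁺ = flip z x
  size : ∣ x⁺ ∣ ≡ suc ∣ x ∣
  size = ∣flip∣-out z x eq
  τ⊆x⁺ : τ ⊆ x⁺
  τ⊆x⁺ = drop-∷-⊆ (con (false ∷ x⁺)
    (∨-introʳ {U (false ∷ x⁺)} (∧-intro (trans (flip-lookup z x) (cong not eq))
      (trans (cong (λ y → U (true ∷ y)) (flip-involutive z x)) u)))
    (subst (λ e → 0 < w N k e) (sym size) pos))
  inU : U (false ∷ x⁺) ≡ true
  inU with avoiding x⁺ τ p τ⊆x⁺ (subst (λ t → t + p ≤ ∣ x⁺ ∣) (sym ∣τ∣)
             (minimal ∣ x⁺ ∣ (subst (_≤ ∣ x⁺ ∣) ∣τ∣ (p⊆q⇒∣p∣≤∣q∣ τ⊆x⁺)) (subst (λ e → 0 < w N k e) (sym size) pos)))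
  ... | y , y⊆x⁺ , ∣y∣ , d = up (s⊆s (∪-⊆ τ⊆x⁺ y⊆x⁺)) (full y (disjoint⇒⊆∁ τ y d) ∣y∣)

-- The inductive statement, and equality carried back through one shift.

χ-*-≤ : ∀ {a b} c → (a ≡ true → 0 < c → b ≡ true) → χ a * c ≤ χ b * c
χ-*-≤ {false} c h = z≤n
χ-*-≤ {true} zero h = z≤n
χ-*-≤ {true} {b} (suc c) h rewrite h refl (s≤s z≤n) = ≤-refl

weight-mono : ∀ {m} N k {U V : Family m} → (∀ x → U x ≡ true → 0 < w N k ∣ x ∣ → V x ≡ true) →
  weight N k U ≤ weight N k V
weight-mono N k h = ∑-mono-≤ (λ x → χ-*-≤ (w N k ∣ x ∣) (h x))

weight-mono-< : ∀ {m} N k {U V : Family m} → (∀ x → U x ≡ true → 0 < w N k ∣ x ∣ → V x ≡ true) →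
  ∀ y → 0 < w N k ∣ y ∣ → U y ≡ false → V y ≡ true → weight N k U < weight N k V
weight-mono-< N k {U} {V} h y pos u v = ∑-mono-< (λ x → χ-*-≤ (w N k ∣ x ∣) (h x)) y strict
  where
  strict : χ (U y) * w N k ∣ y ∣ < χ (V y) * w N k ∣ y ∣
  strict rewrite u | v = subst (0 <_) (sym (+-identityʳ _)) pos

*-mono-<-≤ : ∀ {a b c d} → a < c → b ≤ d → 0 < d → a * b < c * d
*-mono-<-≤ {a} {b} {c} {suc d} a<c b≤d _ = ≤-<-trans (*-monoʳ-≤ a b≤d) (*-monoˡ-< (suc d) a<c)

factors-maximal : ∀ {a b c d} → a ≤ c → b ≤ d → 0 < c → 0 < d → a * b ≡ c * d → a ≡ c × b ≡ d
factors-maximal {a} {b} {c} {d} a≤c b≤d 0<c 0<d e with m≤n⇒m<n∨m≡n a≤c | m≤n⇒m<n∨m≡n b≤d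
... | inj₂ p   | inj₂ q   = p , q
... | inj₁ a<c | _        = contradiction e (<⇒≢ (*-mono-<-≤ a<c b≤d 0<d))
... | inj₂ _   | inj₁ b<d = contradiction (trans (*-comm b a) (trans e (*-comm c d))) (<⇒≢ (*-mono-<-≤ b<d a≤c 0<c))

-- The ground set is [n′ + 2].
module _ (n′ : ℕ) where

  record Admissible (k : ℕ) : Set where
    field
      2≤k   : 2 ≤ k
      range : 10 * k ≤ 3 * (2 + n′)

  star-size : ℕ → ℕ
  star-size k = w n′ k 2

  -- The equality clause asks only for containment in a common star; fullness follows from comparing
  -- weights when it is needed.
  record Good (k l N : ℕ) {m} (U V : Family m) : Set where
    field
      bound : weight N k U * weight N l V ≤ star-size k * star-size l
      extremal : weight N k U * weight N l V ≡ star-size k * star-size l →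
        ∃[ T ] (∣ T ∣ ≡ 2 × Contained k N T U × Contained l N T V)

  open Admissible
  open Good

  Good-sym : ∀ {k l N m} {U V : Family m} → Good k l N U V → Good l k N V U
  Good-sym {k} {l} {N} {m} {U} {V} g .bound = subst₂ _≤_ (*-comm (weight N k U) _) (*-comm (star-size k) _) (g .bound)
  Good-sym {k} {l} {N} {m} {U} {V} g .extremal e
    with g .extremal (trans (*-comm (weight N k U) _) (trans e (*-comm (star-size l) _)))
  ... | T , ∣T∣ , cu , cv = T , ∣T∣ , cv , cu

  Good-mono : ∀ {k l N m} {U V U′ V′ : Family m} →
    (∀ x → U x ≡ true → 0 < w N k ∣ x ∣ → U′ x ≡ true) →
    (∀ x → V x ≡ true → 0 < w N l ∣ x ∣ → V′ x ≡ true) →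
    Good k l N U′ V′ → Good k l N U V
  Good-mono {k} {l} {N} hU hV g .bound = ≤-trans (*-mono-≤ (weight-mono N k hU) (weight-mono N l hV)) (g .bound)
  Good-mono {k} {l} {N} {U = U} {V} {U′} {V′} hU hV g .extremal e
    with g .extremal (≤-antisym (g .bound)
           (subst (_≤ weight N k U′ * weight N l V′) e (*-mono-≤ (weight-mono N k hU) (weight-mono N l hV))))
  ... | T , ∣T∣ , cu , cv =
    T , ∣T∣ , (λ x u pos → cu x (hU x u pos) pos) , (λ x v pos → cv x (hV x v pos) pos)

  Good-strict : ∀ {k l N m} {U V : Family m} →
    weight N k U * weight N l V < star-size k * star-size l → Good k l N U V
  Good-strict h .bound = <⇒≤ h
  Good-strict h .extremal e = contradiction e (<⇒≢ h)

  star-size-pos : ∀ {k} → Admissible k → 0 < star-size k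
  star-size-pos {k} a = w-pos n′ k 2 (a .2≤k) (subst (k ≤_) (+-comm 2 n′)
    (*-cancelˡ-≤ 3 (≤-trans (*-monoˡ-≤ k (m≤n+m 3 7)) (a .range))))

  weight-star : ∀ {m} N k (T : Subset m) → N + m ≡ 2 + n′ → ∣ T ∣ ≡ 2 →
    weight N k (T ⊆ᵇ_) ≡ star-size k
  weight-star {m} N k T size ∣T∣ = trans (star-weight N k 0 T) (cong₂ (λ M e → w M k e)
    (+-cancelʳ-≡ 2 _ _ (trans (+-assoc N _ 2) (trans (cong (λ t → N + (∣ ∁ T ∣ + t)) (sym ∣T∣))
      (trans (cong (N +_) (∣∁∣ T)) (trans size (+-comm 2 n′)))))) ∣T∣)

  module _ {k N m} {T : Subset m} {U : Family m} (size : N + m ≡ 2 + n′) (∣T∣ : ∣ T ∣ ≡ 2)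
           (con : Contained k N T U) where

    contained-weight : weight N k U ≤ star-size k
    contained-weight = subst (weight N k U ≤_) (weight-star N k T size ∣T∣)
      (weight-mono N k (λ x u pos → ⊆⇒⊆ᵇ T x (con x u pos)))

    contained-full : weight N k U ≡ star-size k → ∀ x → 0 < w N k ∣ x ∣ → T ⊆ x → U x ≡ true
    contained-full e x pos s with U x in eq
    ... | true  = refl
    ... | false = contradiction (trans e (sym (weight-star N k T size ∣T∣)))
      (<⇒≢ (weight-mono-< N k (λ x u pos → ⊆⇒⊆ᵇ T x (con x u pos)) x pos eq (⊆⇒⊆ᵇ T x s)))

  -- `2 + level k N` is the maximum of 2 and k - N, the least size from 2 on at which N free
  -- elements can complete a trace to a k-set. `level` is the part of it beyond the two points of a
  -- star.
  level : ∀ k N → ℕ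
  level k N = (k ∸ N) ∸ 2

  level-minimal : ∀ k N e → 2 ≤ e → 0 < w N k e → 2 + level k N ≤ e
  level-minimal k N e 2≤e pos with k ∸ N in eq | m≤n+o⇒m∸n≤o k N (w-pos⇒≤ N k e pos)
  ... | zero        | _ = 2≤e
  ... | suc zero    | _ = 2≤e
  ... | suc (suc p) | h = h

  level-pos : ∀ {k} N → Admissible k → 0 < w N k (2 + level k N)
  level-pos {k} N a = w-pos N k (2 + level k N) (proj₁ bounds) (proj₂ bounds)
    where
    bounds : 2 + level k N ≤ k × k ≤ N + (2 + level k N)
    bounds with k ∸ N in eq | m∸n≤m k N | m≤n+m∸n k N
    ... | zero        | _ | h = a .2≤k , ≤-trans h (+-monoʳ-≤ N z≤n)
    ... | suc zero    | _ | h = a .2≤k , ≤-trans h (+-monoʳ-≤ N (s≤s z≤n))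
    ... | suc (suc p) | g | h = g , h

  k+l≤n : ∀ {k l} → Admissible k → Admissible l → k + l ≤ 2 + n′
  k+l≤n {k} {l} a b = *-cancelˡ-≤ 6 (begin
    6 * (k + l)                       ≤⟨ *-monoˡ-≤ (k + l) (m≤n+m 6 4) ⟩
    10 * (k + l)                      ≡⟨ *-distribˡ-+ 10 k l ⟩
    10 * k + 10 * l                   ≤⟨ +-mono-≤ (a .range) (b .range) ⟩
    3 * (2 + n′) + 3 * (2 + n′)       ≡⟨ *-distribʳ-+ (2 + n′) 3 3 ⟨
    6 * (2 + n′)                      ∎)
    where open ≤-Reasoning

  ∸-suc⇒≡ : ∀ k N {p} → k ∸ N ≡ suc p → k ≡ N + suc p
  ∸-suc⇒≡ k N {p} e = trans (sym (m+[n∸m]≡n (<⇒≤ (m∸n≢0⇒n<m {k} {N} (λ z → contradiction (trans (sym e) z) λ ()))))) (cong (N +_) e)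

  -- If `level k N` = p > 0, then k = N + 2 + p; with l at least 2 + `level l N`, the bound k + l ≤
  -- n leaves the room that `kneser` requires.
  level-room : ∀ {k l N r} → Admissible k → Admissible l → N + suc r ≡ n′ →
    level k N ≡ 0 ⊎ level k N + level l N < r
  level-room {k} {l} {N} {r} a b size with k ∸ N in eqk
  ... | zero = inj₁ refl
  ... | suc zero = inj₁ refl
  ... | suc (suc zero) = inj₁ refl
  ... | suc (suc (suc p)) = inj₂ (+-cancelˡ-≤ (3 + N) _ _ (begin
    3 + N + (2 + p + level l N)     ≤⟨ rearrange (level l N) ⟩
    N + (3 + p) + (2 + level l N)   ≡⟨ cong (_+ (2 + level l N)) (∸-suc⇒≡ k N eqk) ⟨
    k + (2 + level l N)             ≤⟨ +-monoʳ-≤ k 2+level≤l ⟩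
    k + l                           ≤⟨ k+l≤n a b ⟩
    2 + n′                          ≡⟨ cong (2 +_) size ⟨
    2 + (N + suc r)                 ≡⟨ cong (2 +_) (+-suc N r) ⟩
    3 + N + r                       ∎))
    where
    open ≤-Reasoning
    rearrange : ∀ q → 3 + N + (2 + p + q) ≤ N + (3 + p) + (2 + q)
    rearrange q = ≤-reflexive (lemma N p q)
      where
      lemma : ∀ N p q → 3 + N + (2 + p + q) ≡ N + (3 + p) + (2 + q)
      lemma = solve-∀
    2+level≤l : 2 + level l N ≤ l
    2+level≤l with l ∸ N | m∸n≤m l N
    ... | zero | _ = b .2≤k
    ... | suc zero | _ = b .2≤k
    ... | suc (suc q) | h = h

  private
    lookup-∪ : ∀ {m} (z : Fin m) (τ x : Subset m) → lookup τ z ≡ true → lookup (τ ∪ x) z ≡ true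
    lookup-∪ zero    (true ∷ τ) (b ∷ x) h = refl
    lookup-∪ (suc z) (c ∷ τ)    (b ∷ x) h = lookup-∪ z τ x h

    ∣∪∩∪∣ : ∀ {m} (τ x y : Subset m) → x ⊆ ∁ τ → ∣ x ∩ y ∣ ≡ 0 → ∣ (τ ∪ x) ∩ (τ ∪ y) ∣ ≡ ∣ τ ∣
    ∣∪∩∪∣ [] [] [] s d = refl
    ∣∪∩∪∣ (true ∷ τ) (true ∷ x) (c ∷ y) s d with s here
    ... | ()
    ∣∪∩∪∣ (true ∷ τ) (false ∷ x) (c ∷ y) s d = cong suc (∣∪∩∪∣ τ x y (drop-∷-⊆ s) d)
    ∣∪∩∪∣ (false ∷ τ) (true ∷ x) (false ∷ y) s d = ∣∪∩∪∣ τ x y (drop-∷-⊆ s) d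
    ∣∪∩∪∣ (false ∷ τ) (false ∷ x) (c ∷ y) s d = ∣∪∩∪∣ τ x y (drop-∷-⊆ s) d

    other-star : ∀ {m} (z : Fin m) (G : Family (suc m)) x → lookup x z ≡ true →
      compress z G (false ∷ x) ≡ true → G (false ∷ x) ≡ false → G (true ∷ flip z x) ≡ true
    other-star z G x xz c g with ∨-true {G (false ∷ x)} c
    ... | inj₁ g′ = true≢false g′ g
    ... | inj₂ h  = proj₂ (∧-true h)

    -- The missing set of `G` was moved, so `G` has its original, with the head in place of z.
    -- Against the headless set of `F` this keeps only the point of `τ` other than z.
    incompatible : ∀ {m} (z : Fin m) {F G : Family (suc m)} (τ x y : Subset m) → Cross F G →
      lookup τ z ≡ true → ∣ τ ∣ ≡ 2 → x ⊆ ∁ τ → ∣ x ∩ y ∣ ≡ 0 →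
      compress z G (false ∷ (τ ∪ y)) ≡ true → G (false ∷ (τ ∪ y)) ≡ false →
      ¬ F (false ∷ (τ ∪ x)) ≡ true
    incompatible z {F} {G} τ x y cross τz ∣τ∣ x⊆ d c g f = contradiction
      (cross _ _ f (other-star z G (τ ∪ y) τ∪y-z c g))
      (<⇒≱ (≤-reflexive (trans (cong (suc ∘ ∣_∣) (∩-comm (τ ∪ x) _))
        (trans (flip-∩-in z (τ ∪ y) (τ ∪ x) τ∪y-z (lookup-∪ z τ x τz))
          (trans (cong ∣_∣ (∩-comm (τ ∪ y) (τ ∪ x))) (trans (∣∪∩∪∣ τ x y x⊆ d) ∣τ∣))))))
      where τ∪y-z = lookup-∪ z τ y τz

    ∅-or-room : ∀ {p q r} → p ≡ 0 ⊎ p + q < r → p ≤ r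
    ∅-or-room (inj₁ refl) = z≤n
    ∅-or-room (inj₂ h)    = ≤-trans (m≤m+n _ _) (<⇒≤ h)

    -- A set of `U` with the head and without z has its shift in `compress z U`. The shift lacks the
    -- head, which is impossible if the star requires it; and if z is outside the star, adding z
    -- cannot have supplied a point of the star.
    contained-easy : ∀ {m} k N (z : Fin m) {U : Family (suc m)} t τ → t ≡ true ⊎ lookup τ z ≡ false →
      Contained k N (t ∷ τ) (compress z U) → Contained k N (t ∷ τ) U
    contained-easy k N z t τ c con (false ∷ x) u pos = con _ (∨-introˡ u) pos
    contained-easy k N z {U} t τ c con (true ∷ x) u pos with lookup x z in xz
    ... | true  = con _ (∧-intro u (∨-introˡ xz)) pos
    ... | false with t | c | con (false ∷ flip z x)
                    (∨-introʳ {U (false ∷ flip z x)} (∧-intro (trans (flip-lookup z x) (cong not xz))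
                      (trans (cong (λ y → U (true ∷ y)) (flip-involutive z x)) u)))
                    (subst (λ e → 0 < w N k e) (sym (∣flip∣-out z x xz)) pos)
    ...   | true  | _       | s with s here
    ...     | ()
    contained-easy k N z {U} t τ c con (true ∷ x) u pos | false | false | inj₂ τz | s = out⊆ (lookup⇒⊆ go)
      where
      go : ∀ z′ → lookup τ z′ ≡ true → lookup x z′ ≡ true
      go z′ h with z′ Fin.≟ z
      ... | yes refl = true≢false h τz
      ... | no ne    = trans (sym (flip-lookup-≢ z z′ x ne)) (⊆⇒lookup (drop-∷-⊆ s) z′ h)

  module _ {k l N m} (a : Admissible k) (b : Admissible l) (size : N + suc m ≡ 2 + n′)
           (z : Fin m) {U V : Family (suc m)} (upU : Upset U) (upV : Upset V) (cross : Cross U V)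
           where

    private
      p = level k N
      q = level l N

    module _ {τ : Subset m} (τz : lookup τ z ≡ true) (∣τ∣ : ∣ τ ∣ ≡ 2)
             (conU : Contained k N (false ∷ τ) (compress z U))
             (conV : Contained l N (false ∷ τ) (compress z V))
             (fullU : ∀ x → 0 < w N k ∣ x ∣ → false ∷ τ ⊆ x → compress z U x ≡ true)
             (fullV : ∀ x → 0 < w N l ∣ x ∣ → false ∷ τ ⊆ x → compress z V x ≡ true) where

      private
        room : N + suc ∣ ∁ τ ∣ ≡ n′
        room = +-cancelʳ-≡ 2 _ _ (trans (+-assoc N _ 2) (trans (cong (λ t → N + suc (∣ ∁ τ ∣ + t)) (sym ∣τ∣))
                 (trans (cong (λ t → N + suc t) (∣∁∣ τ)) (trans size (+-comm 2 n′)))))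

        ∪-size : ∀ {x r} → x ⊆ ∁ τ → ∣ x ∣ ≡ r → ∣ τ ∪ x ∣ ≡ 2 + r
        ∪-size {x} s e = trans (∣∪∣-disjoint τ x (⊆∁⇒disjoint τ x s)) (cong₂ _+_ ∣τ∣ e)

        inU : ∀ x → x ⊆ ∁ τ → ∣ x ∣ ≡ p → compress z U (false ∷ (τ ∪ x)) ≡ true
        inU x s e = fullU _ (subst (λ e → 0 < w N k e) (sym (∪-size s e)) (level-pos N a)) (s⊆s (p⊆p∪q x))

        inV : ∀ x → x ⊆ ∁ τ → ∣ x ∣ ≡ q → compress z V (false ∷ (τ ∪ x)) ≡ true
        inV x s e = fullV _ (subst (λ e → 0 < w N l e) (sym (∪-size s e)) (level-pos N b)) (s⊆s (p⊆p∪q x))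

        -- U and V each pick a set of the compressed star or its swap; opposite picks with disjoint
        -- remainders would meet in one point only.
        link : ∀ x y → x ⊆ ∁ τ → y ⊆ ∁ τ → ∣ x ∣ ≡ p → ∣ y ∣ ≡ q → ∣ x ∩ y ∣ ≡ 0 →
               U (false ∷ (τ ∪ x)) ≡ V (false ∷ (τ ∪ y))
        link x y x⊆ y⊆ ∣x∣ ∣y∣ d with U (false ∷ (τ ∪ x)) in u | V (false ∷ (τ ∪ y)) in v
        ... | true  | true  = refl
        ... | false | false = refl
        ... | true  | false = ⊥-elim (incompatible z τ x y cross τz ∣τ∣ x⊆ d (inV y y⊆ ∣y∣) v u)
        ... | false | true  = ⊥-elim (incompatible z {V} {U} τ y x (Cross-sym {U = U} {V} cross) τz ∣τ∣ y⊆
                                (trans (cong ∣_∣ (∩-comm y x)) d) (inU x x⊆ ∣x∣) u v)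

        same : ∀ x y → x ⊆ ∁ τ → y ⊆ ∁ τ → ∣ x ∣ ≡ p → ∣ y ∣ ≡ q →
               U (false ∷ (τ ∪ x)) ≡ V (false ∷ (τ ∪ y))
        same = kneser (∁ τ) p q _ _ (level-room a b room) link

        swapped : ∀ {j} {F : Family (suc m)} → Upset F → Contained j N (false ∷ τ) (compress z F) →
          ∀ r → (∀ e → 2 ≤ e → 0 < w N j e → 2 + r ≤ e) →
          (∀ x → x ⊆ ∁ τ → ∣ x ∣ ≡ r → compress z F (false ∷ (τ ∪ x)) ≡ true) →
          (∀ x → x ⊆ ∁ τ → ∣ x ∣ ≡ r → F (false ∷ (τ ∪ x)) ≡ false) →
          Contained j N (swap-head z (false ∷ τ)) F
        swapped {j} {F} up con r minimal full out x f pos = subst (swap-head z (false ∷ τ) ⊆_) (swap-head-involutive z x)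
          (swap-head-mono z {false ∷ τ} (contained-uncompress j N z {F ∘ swap-head z} τ r
            (λ s → up (swap-head-mono z s)) τz ∣τ∣
            (λ y fy → con y (compress-swap-head z F y fy)) minimal
            (λ y y⊆ ∣y∣ → subst₂ (λ b w → F (b ∷ w) ≡ true) (sym (lookup-∪ z τ y τz))
               (sym (≔-flip z (τ ∪ y) {false} (lookup-∪ z τ y τz)))
               (other-star z F (τ ∪ y) (lookup-∪ z τ y τz) (full y y⊆ ∣y∣) (out y y⊆ ∣y∣)))
            (swap-head z x) (trans (cong F (swap-head-involutive z x)) f)
            (subst (λ e → 0 < w N j e) (sym (∣swap-head∣ z x)) pos)))

      -- All choices between original and moved set agree, so the sample `x₀` decides: `τ` itself if
      -- its set was present, otherwise `τ` with z replaced by the head. The sample `y₀` relays the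
      -- choice between two sets on the same side.
      uncompress-star : ∃[ T ] (∣ T ∣ ≡ 2 × Contained k N T U × Contained l N T V)
      uncompress-star with subset-of-size (∁ τ) p (∅-or-room (level-room a b room))
                         | subset-of-size (∁ τ) q (∅-or-room (level-room b a room))
      ... | x₀ , x₀⊆ , ∣x₀∣ | y₀ , y₀⊆ , ∣y₀∣ with U (false ∷ (τ ∪ x₀)) in u₀
      ...   | true = false ∷ τ , ∣τ∣ ,
        contained-uncompress k N z τ p upU τz ∣τ∣ conU (level-minimal k N)
          (λ x x⊆ ∣x∣ → trans (same x y₀ x⊆ y₀⊆ ∣x∣ ∣y₀∣) (trans (sym (same x₀ y₀ x₀⊆ y₀⊆ ∣x₀∣ ∣y₀∣)) u₀)) ,
        contained-uncompress l N z τ q upV τz ∣τ∣ conV (level-minimal l N)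
          (λ y y⊆ ∣y∣ → trans (sym (same x₀ y x₀⊆ y⊆ ∣x₀∣ ∣y∣)) u₀)
      ...   | false = swap-head z (false ∷ τ) , trans (∣swap-head∣ z (false ∷ τ)) ∣τ∣ ,
        swapped upU conU p (level-minimal k N) inU
          (λ x x⊆ ∣x∣ → trans (same x y₀ x⊆ y₀⊆ ∣x∣ ∣y₀∣) (trans (sym (same x₀ y₀ x₀⊆ y₀⊆ ∣x₀∣ ∣y₀∣)) u₀)) ,
        swapped upV conV q (level-minimal l N) inV
          (λ y y⊆ ∣y∣ → trans (sym (same x₀ y x₀⊆ y⊆ ∣x₀∣ ∣y∣)) u₀)

    -- A star with z but without the head is the only ambiguous one. Equality of the products forces
    -- both shifted families to be full stars, and this supplies every minimal set to which the
    -- connectivity argument is applied.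
    Good-uncompress : Good k l N (compress z U) (compress z V) → Good k l N U V
    Good-uncompress g .bound =
      subst₂ (λ u v → u * v ≤ star-size k * star-size l) (compress-weight N k z U) (compress-weight N l z V) (g .bound)
    Good-uncompress g .extremal e = go (g .extremal e′)
      where
      e′ : weight N k (compress z U) * weight N l (compress z V) ≡ star-size k * star-size l
      e′ = trans (cong₂ _*_ (compress-weight N k z U) (compress-weight N l z V)) e
      go : ∃[ T ] (∣ T ∣ ≡ 2 × Contained k N T (compress z U) × Contained l N T (compress z V)) →
           ∃[ T ] (∣ T ∣ ≡ 2 × Contained k N T U × Contained l N T V)
      go (true ∷ τ , ∣T∣ , cu , cv) = true ∷ τ , ∣T∣ ,
        contained-easy k N z true τ (inj₁ refl) cu , contained-easy l N z true τ (inj₁ refl) cv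
      go (false ∷ τ , ∣T∣ , cu , cv) = split (lookup τ z) refl
        where
        tight : weight N k (compress z U) ≡ star-size k × weight N l (compress z V) ≡ star-size l
        tight = factors-maximal (contained-weight size ∣T∣ cu) (contained-weight size ∣T∣ cv)
                  (star-size-pos a) (star-size-pos b) e′
        split : ∀ c → lookup τ z ≡ c → ∃[ T ] (∣ T ∣ ≡ 2 × Contained k N T U × Contained l N T V)
        split false τz = false ∷ τ , ∣T∣ ,
          contained-easy k N z false τ (inj₂ τz) cu , contained-easy l N z false τ (inj₂ τz) cv
        split true τz = uncompress-star τz ∣T∣ cu cv
          (contained-full size ∣T∣ cu (proj₁ tight)) (contained-full size ∣T∣ cv (proj₂ tight))

-- Adding and cutting the boundary at one level.

≡ᵇ-true : ∀ {a b} → (a ≡ᵇ b) ≡ true → a ≡ b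
≡ᵇ-true {zero}  {zero}  _ = refl
≡ᵇ-true {suc a} {suc b} h = cong suc (≡ᵇ-true h)

≡ᵇ-refl : ∀ a → (a ≡ᵇ a) ≡ true
≡ᵇ-refl zero    = refl
≡ᵇ-refl (suc a) = ≡ᵇ-refl a

add-level cut-level : ∀ {m} → ℕ → Family (suc m) → Family (suc m)
add-level i U (b ∷ x) = U (b ∷ x) ∨ (U (true ∷ x) ∧ (∣ x ∣ ≡ᵇ i))
cut-level i U (b ∷ x) = U (b ∷ x) ∧ (U (false ∷ x) ∨ not (∣ x ∣ ≡ᵇ i))

boundary : ∀ {m} → ℕ → Family (suc m) → Family m
boundary i U x = U (true ∷ x) ∧ (not (U (false ∷ x)) ∧ (∣ x ∣ ≡ᵇ i))

module _ {m} (i : ℕ) (U : Family (suc m)) where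

  add-elim : ∀ b x → add-level i U (b ∷ x) ≡ true → U (b ∷ x) ≡ true ⊎ (U (true ∷ x) ≡ true × ∣ x ∣ ≡ i)
  add-elim b x h with ∨-true {U (b ∷ x)} h
  ... | inj₁ u = inj₁ u
  ... | inj₂ g with ∧-true {U (true ∷ x)} g
  ...   | u , e = inj₂ (u , ≡ᵇ-true e)

  add-intro : ∀ b x → U (true ∷ x) ≡ true → ∣ x ∣ ≡ i → add-level i U (b ∷ x) ≡ true
  add-intro b x u refl = ∨-introʳ {U (b ∷ x)} (∧-intro u (≡ᵇ-refl ∣ x ∣))

  add-⊇ : ∀ x → U x ≡ true → add-level i U x ≡ true
  add-⊇ (b ∷ x) u = ∨-introˡ u

  cut-elim : ∀ b x → cut-level i U (b ∷ x) ≡ true → U (b ∷ x) ≡ true × (∣ x ∣ ≡ i → U (false ∷ x) ≡ true)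
  cut-elim b x h with ∧-true {U (b ∷ x)} h
  ... | u , g = u , λ { refl → low g }
    where
    low : U (false ∷ x) ∨ not (∣ x ∣ ≡ᵇ ∣ x ∣) ≡ true → U (false ∷ x) ≡ true
    low g with ∨-true {U (false ∷ x)} g
    ... | inj₁ v = v
    ... | inj₂ v = true≢false (≡ᵇ-refl ∣ x ∣) (not-true v)
      where
      not-true : ∀ {b} → not b ≡ true → b ≡ false
      not-true {false} _ = refl

  cut-intro : ∀ b x → U (b ∷ x) ≡ true → (∣ x ∣ ≡ i → U (false ∷ x) ≡ true) → cut-level i U (b ∷ x) ≡ true
  cut-intro b x u h with ∣ x ∣ ≡ᵇ i in e
  ... | true  = ∧-intro u (∨-introˡ (h (≡ᵇ-true e)))
  ... | false = ∧-intro u (∨-introʳ {U (false ∷ x)} refl)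

  cut-⊆ : ∀ x → cut-level i U x ≡ true → U x ≡ true
  cut-⊆ (b ∷ x) c = proj₁ (cut-elim b x c)

  boundary-elim : ∀ x → boundary i U x ≡ true → U (true ∷ x) ≡ true × U (false ∷ x) ≡ false × ∣ x ∣ ≡ i
  boundary-elim x h with U (true ∷ x) | U (false ∷ x) | ∣ x ∣ ≡ᵇ i in e
  ... | true | false | true = refl , refl , ≡ᵇ-true e

  boundary-intro : ∀ x → U (true ∷ x) ≡ true → U (false ∷ x) ≡ false → ∣ x ∣ ≡ i → boundary i U x ≡ true
  boundary-intro x u v refl rewrite u | v = ≡ᵇ-refl ∣ x ∣

  module _ (up : Upset U) where

    private
      pad : ∀ a b → (a + 0) + (b + 0) ≡ a + b
      pad = solve-∀

      split-cut : ∀ N k x → let e = ∣ x ∣ in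
        χ (U (false ∷ x)) * w N k e + χ (U (true ∷ x)) * w N k (suc e) ≡
        (χ (cut-level i U (false ∷ x)) * w N k e + χ (cut-level i U (true ∷ x)) * w N k (suc e))
          + χ (boundary i U x) * w N k (suc i)
      split-cut N k x with U (false ∷ x) in u₀ | U (true ∷ x) in u₁ | ∣ x ∣ ≡ᵇ i in e
      ... | true  | false | _ = true≢false (up (out⊆ ⊆-refl) u₀) u₁
      ... | true  | true  | _ = sym (+-identityʳ _)
      ... | false | false | _ = refl
      ... | false | true  | false = sym (+-identityʳ _)
      ... | false | true  | true  rewrite ≡ᵇ-true {∣ x ∣} {i} e = refl

      split-add : ∀ N k x → let e = ∣ x ∣ in
        χ (add-level i U (false ∷ x)) * w N k e + χ (add-level i U (true ∷ x)) * w N k (suc e) ≡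
        (χ (cut-level i U (false ∷ x)) * w N k e + χ (cut-level i U (true ∷ x)) * w N k (suc e))
          + χ (boundary i U x) * w (suc N) k i
      split-add N k x with U (false ∷ x) in u₀ | U (true ∷ x) in u₁ | ∣ x ∣ ≡ᵇ i in e
      ... | true  | false | _ = true≢false (up (out⊆ ⊆-refl) u₀) u₁
      ... | true  | true  | _ = sym (+-identityʳ _)
      ... | false | false | _ = refl
      ... | false | true  | false = sym (+-identityʳ _)
      ... | false | true  | true  rewrite ≡ᵇ-true {∣ x ∣} {i} e =
        trans (pad (w N k i) (w N k (suc i))) (trans (sym (w-Pascal N k i)) (sym (+-identityʳ _)))

      total : ∀ N k (F : Family (suc m)) →
        weight N k F ≡ ∑ (λ x → χ (F (false ∷ x)) * w N k ∣ x ∣ + χ (F (true ∷ x)) * w N k (suc ∣ x ∣))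
      total N k F = sym (∑-+ (λ x → χ (F (false ∷ x)) * w N k ∣ x ∣) (λ x → χ (F (true ∷ x)) * w N k (suc ∣ x ∣)))

      assemble : ∀ N k (F : Family (suc m)) v →
        (∀ x → χ (F (false ∷ x)) * w N k ∣ x ∣ + χ (F (true ∷ x)) * w N k (suc ∣ x ∣) ≡
          (χ (cut-level i U (false ∷ x)) * w N k ∣ x ∣ + χ (cut-level i U (true ∷ x)) * w N k (suc ∣ x ∣))
          + χ (boundary i U x) * v) →
        weight N k F ≡ weight N k (cut-level i U) + ∑ (λ x → χ (boundary i U x)) * v
      assemble N k F v h = begin
        weight N k F
          ≡⟨ total N k F ⟩
        ∑ (λ x → χ (F (false ∷ x)) * w N k ∣ x ∣ + χ (F (true ∷ x)) * w N k (suc ∣ x ∣))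
          ≡⟨ ∑-cong h ⟩
        ∑ (λ x → (χ (cut-level i U (false ∷ x)) * w N k ∣ x ∣ + χ (cut-level i U (true ∷ x)) * w N k (suc ∣ x ∣))
          + χ (boundary i U x) * v)
          ≡⟨ ∑-+ (λ x → χ (cut-level i U (false ∷ x)) * w N k ∣ x ∣ + χ (cut-level i U (true ∷ x)) * w N k (suc ∣ x ∣))
                 (λ x → χ (boundary i U x) * v) ⟩
        ∑ (λ x → χ (cut-level i U (false ∷ x)) * w N k ∣ x ∣ + χ (cut-level i U (true ∷ x)) * w N k (suc ∣ x ∣))
          + ∑ (λ x → χ (boundary i U x) * v)
          ≡⟨ cong₂ _+_ (sym (total N k (cut-level i U))) (∑-*ʳ (λ x → χ (boundary i U x)) v) ⟩
        weight N k (cut-level i U) + ∑ (λ x → χ (boundary i U x)) * v ∎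
        where open ≡-Reasoning

    weight-split : ∀ N k → weight N k U ≡ weight N k (cut-level i U) + ∑ (λ x → χ (boundary i U x)) * w N k (suc i)
    weight-split N k = assemble N k U _ (split-cut N k)

    -- A boundary set now occurs with and without the head, so by Pascal's rule the head acts as one
    -- more free element.
    weight-add : ∀ N k → weight N k (add-level i U) ≡
      weight N k (cut-level i U) + ∑ (λ x → χ (boundary i U x)) * w (suc N) k i
    weight-add N k = assemble N k (add-level i U) _ (split-add N k)

    -- Cutting removes only sets whose headless partner is absent, so every headless set survives
    -- together with its partner. All lower bounds for the weight after cutting start from this.
    weight-cut-≥ : ∀ N k → weight (suc N) k (λ x → U (false ∷ x)) ≤ weight N k (cut-level i U)
    weight-cut-≥ N k = subst (weight (suc N) k (λ x → U (false ∷ x)) ≤_) (sym (total N k (cut-level i U))) (∑-mono-≤ low)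
      where
      low : ∀ x → χ (U (false ∷ x)) * w (suc N) k ∣ x ∣ ≤
        χ (cut-level i U (false ∷ x)) * w N k ∣ x ∣ + χ (cut-level i U (true ∷ x)) * w N k (suc ∣ x ∣)
      low x with U (false ∷ x) in u₀
      ... | false = z≤n
      ... | true rewrite up {false ∷ x} {true ∷ x} (out⊆ ⊆-refl) u₀ = ≤-reflexive
        (trans (+-identityʳ _) (trans (w-Pascal N k ∣ x ∣) (sym (pad (w N k ∣ x ∣) (w N k (suc ∣ x ∣))))))

extra-element : ∀ {m} {x y : Subset m} → x ⊆ y → ∣ x ∣ ≢ ∣ y ∣ →
  ∃[ z ] (lookup x z ≡ false × lookup y z ≡ true)
extra-element {x = []} {[]} s ne = contradiction refl ne
extra-element {x = false ∷ x} {true ∷ y} s ne = zero , refl , refl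
extra-element {x = true ∷ x} {false ∷ y} s ne with s here
... | ()
extra-element {x = true ∷ x} {true ∷ y} s ne with extra-element (drop-∷-⊆ s) (ne ∘ cong suc)
... | z , p , q = suc z , p , q
extra-element {x = false ∷ x} {false ∷ y} s ne with extra-element (drop-∷-⊆ s) ne
... | z , p , q = suc z , p , q

flip-lub : ∀ {m} (z : Fin m) {x y : Subset m} → x ⊆ y → lookup y z ≡ true → flip z x ⊆ y
flip-lub z {x} {y} s yz = lookup⇒⊆ go
  where
  go : ∀ z′ → lookup (flip z x) z′ ≡ true → lookup y z′ ≡ true
  go z′ h with z′ Fin.≟ z
  ... | yes refl = yz
  ... | no ne    = ⊆⇒lookup s z′ (trans (sym (flip-lookup-≢ z z′ x ne)) h)

uncovered : ∀ {m} (x y : Subset m) → (∃[ z ] (lookup x z ≡ false × lookup y z ≡ false)) ⊎ ∣ x ∪ y ∣ ≡ m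
uncovered [] [] = inj₂ refl
uncovered (false ∷ x) (false ∷ y) = inj₁ (zero , refl , refl)
uncovered (true ∷ x) (c ∷ y) with uncovered x y
... | inj₁ (z , p , q) = inj₁ (suc z , p , q)
... | inj₂ e = inj₂ (cong suc e)
uncovered (false ∷ x) (true ∷ y) with uncovered x y
... | inj₁ (z , p , q) = inj₁ (suc z , p , q)
... | inj₂ e = inj₂ (cong suc e)

AllCompressed : ∀ {m} → Family (suc m) → Set
AllCompressed U = ∀ z → Compressed z U

module _ {m} {U : Family (suc m)} (up : Upset U) (comp : AllCompressed U) where

  -- Shift the head to an element of y outside x, then enlarge. Thus proper supersets of a boundary
  -- set no longer depend on the head.
  promote : ∀ {x y} → U (true ∷ x) ≡ true → x ⊆ y → ∣ x ∣ ≢ ∣ y ∣ → U (false ∷ y) ≡ true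
  promote {x} u s ne with extra-element s ne
  ... | z , xz , yz = up (s⊆s (flip-lub z s yz)) (comp z x xz u)

  -- By `promote`, only a superset of the same size has to be supplied by the added level.
  add-upset : ∀ i → Upset (add-level i U)
  add-upset i {b ∷ x} {c ∷ y} s h with add-elim i U b x h
  ... | inj₁ u = add-⊇ i U (c ∷ y) (up s u)
  ... | inj₂ (u , ∣x∣) with ∣ x ∣ ≟ ∣ y ∣
  ...   | yes e = add-intro i U c y (up (∷-⊆ (drop-∷-⊆ s)) u) (trans (sym e) ∣x∣)
  ...   | no ne = add-⊇ i U (c ∷ y) (up {false ∷ y} (out⊆ ⊆-refl) (promote u (drop-∷-⊆ s) ne))

  cut-upset : ∀ i → Upset (cut-level i U)
  cut-upset i {b ∷ x} {c ∷ y} s h with cut-elim i U b x h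
  ... | u , low = cut-intro i U c y (up s u) low′
    where
    low′ : ∣ y ∣ ≡ i → U (false ∷ y) ≡ true
    low′ ∣y∣ with ∣ x ∣ ≟ ∣ y ∣
    ... | yes e = up (s⊆s (drop-∷-⊆ s)) (low (trans e ∣y∣))
    ... | no ne = promote (up (∷-⊆ ⊆-refl) u) (drop-∷-⊆ s) ne

  add-compressed : ∀ i → AllCompressed (add-level i U)
  add-compressed i z x xz h with add-elim i U true x h
  ... | inj₁ u       = add-⊇ i U _ (comp z x xz u)
  ... | inj₂ (u , _) = add-⊇ i U _ (comp z x xz u)

  cut-compressed : ∀ i → AllCompressed (cut-level i U)
  cut-compressed i z x xz h = cut-intro i U false (flip z x) v (λ _ → v)
    where v = comp z x xz (proj₁ (cut-elim i U true x h))

  -- A clash between the two modified levels forces the two prefixes to cover everything,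
  -- hence to have sizes i and j with i + j = m + 1.
  level-cross : ∀ {V} i j → i + j ≡ suc m → Cross U V → Cross (add-level i U) (cut-level j V)
  level-cross {V} i j i+j cross (b ∷ x) (c ∷ y) h g with add-elim i U b x h | cut-elim j V c y g
  ... | inj₁ u | v , _ = cross _ _ u v
  ... | inj₂ (u , ∣x∣) | v , low with b
  ...   | true = cross _ _ u v
  ...   | false with c
  ...     | false = cross _ _ u v
  ...     | true with V (false ∷ y) in v₀
  ...       | true  = cross _ _ u v₀
  ...       | false with uncovered x y | 2 ≤? ∣ x ∩ y ∣
  ...         | _ | yes p = p
  ...         | inj₁ (z , xz , yz) | no _ =
    subst (λ s → 2 ≤ ∣ s ∣) (flip-∩-out z x y yz) (cross _ _ (comp z x xz u) v)
  ...         | inj₂ e | no p = true≢false (low ∣y∣) refl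
    where
    one : ∣ x ∩ y ∣ ≡ 1
    one = ≤-antisym (≤-pred (≰⇒> p)) (≤-pred (cross _ _ u v))
    ∣y∣ : ∣ y ∣ ≡ j
    ∣y∣ = +-cancelˡ-≡ i _ _ (trans (cong (_+ ∣ y ∣) (sym ∣x∣)) (trans (sym (∣∪∣+∣∩∣ x y))
            (trans (cong₂ _+_ e one) (trans (+-comm m 1) (sym i+j)))))

-- The exchange inequality.

-- Let a, b be the weights after removing the boundary of one level, α, β the gains from saturating
-- that level and α′, β′ the actual contributions of the boundary.
module _ {a α α′ b β β′ K L N₁ M : ℕ} (eα : N₁ * α′ ≡ K * α) (eβ : N₁ * β′ ≡ L * β)
         (0<M : 0 < M) (0<N₁ : 0 < N₁)
         (up-down : (a + α) * b ≤ M) (down-up : a * (b + β) ≤ M) where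

  private
    P = (a + α′) * (b + β′)

    -- In the term α′ β′ only β′ is converted: α′ is kept because the smallness hypothesis compares
    -- it with a.
    scaled : N₁ * P ≡ N₁ * (a * b) + (K * (α * b) + L * (β * a) + L * (α′ * β))
    scaled = begin
      N₁ * ((a + α′) * (b + β′))
        ≡⟨ s₁ N₁ a α′ b β′ ⟩
      N₁ * (a * b) + ((N₁ * α′) * b + (N₁ * β′) * a + (N₁ * β′) * α′)
        ≡⟨ cong₂ (λ s t → N₁ * (a * b) + (s * b + t * a + t * α′)) eα eβ ⟩
      N₁ * (a * b) + ((K * α) * b + (L * β) * a + (L * β) * α′)
        ≡⟨ s₂ N₁ K L a α α′ b β ⟩
      N₁ * (a * b) + (K * (α * b) + L * (β * a) + L * (α′ * β)) ∎
      where
      open ≡-Reasoning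
      s₁ : ∀ N a α′ b β′ → N * ((a + α′) * (b + β′)) ≡ N * (a * b) + ((N * α′) * b + (N * β′) * a + (N * β′) * α′)
      s₁ = solve-∀
      s₂ : ∀ N K L a α α′ b β → N * (a * b) + ((K * α) * b + (L * β) * a + (L * β) * α′)
             ≡ N * (a * b) + (K * (α * b) + L * (β * a) + L * (α′ * β))
      s₂ = solve-∀

    zero-of-positive : ∀ {x y} → 0 < x → x * y ≡ 0 → y ≡ 0
    zero-of-positive {suc x} {zero} _ _ = refl

    <-cancel : ∀ {x y} c → c * x < c * y → x < y
    <-cancel {x} {y} c h = *-cancelˡ-< c x y h

    large-β : α * b ≤ β * a → L * α′ + (K + L) * a < N₁ * a → 0 < β → P < a * (b + β)
    large-β h sm 0<β = <-cancel N₁ (begin-strict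
      N₁ * P
        ≡⟨ scaled ⟩
      N₁ * (a * b) + (K * (α * b) + L * (β * a) + L * (α′ * β))
        ≤⟨ +-monoʳ-≤ (N₁ * (a * b)) (+-monoˡ-≤ (L * (α′ * β)) (+-monoˡ-≤ (L * (β * a)) (*-monoʳ-≤ K h))) ⟩
      N₁ * (a * b) + (K * (β * a) + L * (β * a) + L * (α′ * β))
        ≡⟨ cong (N₁ * (a * b) +_) (s K L a α′ β) ⟩
      N₁ * (a * b) + β * (L * α′ + (K + L) * a)
        <⟨ +-monoʳ-< (N₁ * (a * b)) (*-monoʳ-< β {{ >-nonZero 0<β }} sm) ⟩
      N₁ * (a * b) + β * (N₁ * a)
        ≡⟨ s′ N₁ a b β ⟩
      N₁ * (a * (b + β)) ∎)
      where
      open ≤-Reasoning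
      s : ∀ K L a α′ β → K * (β * a) + L * (β * a) + L * (α′ * β) ≡ β * (L * α′ + (K + L) * a)
      s = solve-∀
      s′ : ∀ N a b β → N * (a * b) + β * (N * a) ≡ N * (a * (b + β))
      s′ = solve-∀

    large-α : β * a < α * b → L * α′ + (K + L) * a < N₁ * a → P < (a + α) * b
    large-α h s = <-cancel (N₁ * a) (begin-strict
      N₁ * a * P
        ≡⟨ trans (cong (_* P) (*-comm N₁ a)) (trans (*-assoc a N₁ P) (cong (a *_) scaled)) ⟩
      a * (N₁ * (a * b) + (K * (α * b) + L * (β * a) + L * (α′ * β)))
        ≡⟨ s₁ N₁ K L a α α′ b β ⟩
      N₁ * a * (a * b) + (K * a * (α * b) + L * a * (β * a) + L * α′ * (β * a))
        ≤⟨ +-monoʳ-≤ (N₁ * a * (a * b)) (+-mono-≤ (+-monoʳ-≤ (K * a * (α * b))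
             (*-monoʳ-≤ (L * a) (<⇒≤ h))) (*-monoʳ-≤ (L * α′) (<⇒≤ h))) ⟩
      N₁ * a * (a * b) + (K * a * (α * b) + L * a * (α * b) + L * α′ * (α * b))
        ≡⟨ s₂ N₁ K L a α α′ b ⟩
      N₁ * a * (a * b) + α * b * (L * α′ + (K + L) * a)
        <⟨ +-monoʳ-< (N₁ * a * (a * b)) (*-monoʳ-< (α * b) {{ >-nonZero (≤-<-trans z≤n h) }} s) ⟩
      N₁ * a * (a * b) + α * b * (N₁ * a)
        ≡⟨ s₃ N₁ a α b ⟩
      N₁ * a * ((a + α) * b) ∎)
      where
      open ≤-Reasoning
      s₁ : ∀ N K L a α α′ b β → a * (N * (a * b) + (K * (α * b) + L * (β * a) + L * (α′ * β)))
        ≡ N * a * (a * b) + (K * a * (α * b) + L * a * (β * a) + L * α′ * (β * a))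
      s₁ = solve-∀
      s₂ : ∀ N K L a α α′ b → N * a * (a * b) + (K * a * (α * b) + L * a * (α * b) + L * α′ * (α * b))
        ≡ N * a * (a * b) + α * b * (L * α′ + (K + L) * a)
      s₂ = solve-∀
      s₃ : ∀ N a α b → N * a * (a * b) + α * b * (N * a) ≡ N * a * ((a + α) * b)
      s₃ = solve-∀

    no-gain : α * b ≤ β * a → β ≡ 0 → P ≡ (a + α′) * b × α′ * b ≡ 0
    no-gain h refl = cong ((a + α′) *_) (trans (cong (b +_) β′≡0) (+-identityʳ b)) ,
      zero-of-positive 0<N₁ (trans (sym (*-assoc N₁ α′ b)) (trans (cong (_* b) eα) (trans (*-assoc K α b)
        (trans (cong (K *_) (n≤0⇒n≡0 h)) (*-zeroʳ K)))))
      where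
      β′≡0 : β′ ≡ 0
      β′≡0 = zero-of-positive 0<N₁ (trans eβ (*-zeroʳ L))

  -- Compare α b with β a and replace the smaller by the larger in `scaled`. If β a is the larger,
  -- the excess over N₁ a b is at most β (L α′ + (K + L) a), below N₁ β a when β > 0; so P < a (b +
  -- β). If α b is the larger, the same after multiplying by a gives P < (a + α) b. Equality is left
  -- only for β = 0, where α′ b = 0 and b > 0.
  exchange : (a ≡ 0 × α′ ≡ 0) ⊎ L * α′ + (K + L) * a < N₁ * a →
    P ≤ M × (P ≡ M → α′ ≡ 0 × a * (b + β) ≡ M)
  exchange (inj₁ (refl , refl)) = z≤n , λ e → contradiction e (<⇒≢ 0<M)
  exchange (inj₂ s) with α * b ≤? β * a
  ... | no ≰′ = <⇒≤ lt , λ e → contradiction e (<⇒≢ lt)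
    where lt = <-≤-trans (large-α (≰⇒> ≰′) s) up-down
  ... | yes h with m≤n⇒m<n∨m≡n (z≤n {β})
  ...   | inj₁ 0<β = <⇒≤ lt , λ e → contradiction e (<⇒≢ lt)
    where lt = <-≤-trans (large-β h s 0<β) down-up
  ...   | inj₂ 0≡β = subst (_≤ M) (sym P≡ab) (≤-trans (*-monoʳ-≤ a (m≤m+n b β)) down-up) , tight
    where
    ng = no-gain h (sym 0≡β)
    P≡ab : P ≡ a * b
    P≡ab = trans (proj₁ ng) (trans (*-distribʳ-+ b a α′) (trans (cong (a * b +_) (proj₂ ng)) (+-identityʳ _)))
    tight : P ≡ M → α′ ≡ 0 × a * (b + β) ≡ M
    tight e = zero-of-positive 0<b (trans (*-comm b α′) (proj₂ ng)) ,
      trans (cong (a *_) (trans (cong (b +_) (sym 0≡β)) (+-identityʳ b))) (trans (sym P≡ab) e)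
      where
      0<b : 0 < b
      0<b = n≢0⇒n>0 λ { b≡0 → <⇒≢ 0<M (trans (sym (trans (cong (a *_) b≡0) (*-zeroʳ a))) (trans (sym P≡ab) e)) }

-- For a = 0 the strict inequality fails, but the ratio then forces α′ = 0; hence the two
-- alternatives.
small-from-ratio : ∀ {a α′ K L N₁} P Q → Q * α′ ≤ P * a → L * P + (K + L) * Q < N₁ * Q →
  (a ≡ 0 × α′ ≡ 0) ⊎ L * α′ + (K + L) * a < N₁ * a
small-from-ratio {a} {α′} {K} {L} {N₁} P zero r c =
  contradiction (subst (L * P + (K + L) * 0 <_) (*-zeroʳ N₁) c) λ ()
small-from-ratio {zero} {α′} {K} {L} {N₁} P (suc Q) r c =
  inj₁ (refl , n≤0⇒n≡0 (≤-trans (m≤m+n α′ (Q * α′)) (≤-trans r (≤-reflexive (*-zeroʳ P)))))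
small-from-ratio {suc a} {α′} {K} {L} {N₁} P (suc Q) r c = inj₂ (*-cancelˡ-< (suc Q) _ _ (begin-strict
  suc Q * (L * α′ + (K + L) * suc a)
    ≡⟨ s₁ (suc Q) K L α′ (suc a) ⟩
  L * (suc Q * α′) + (K + L) * suc Q * suc a
    ≤⟨ +-monoˡ-≤ ((K + L) * suc Q * suc a) (*-monoʳ-≤ L r) ⟩
  L * (P * suc a) + (K + L) * suc Q * suc a
    ≡⟨ s₂ (suc Q) K L P (suc a) ⟩
  (L * P + (K + L) * suc Q) * suc a
    <⟨ *-monoˡ-< (suc a) c ⟩
  N₁ * suc Q * suc a
    ≡⟨ s₃ N₁ (suc Q) (suc a) ⟩
  suc Q * (N₁ * suc a) ∎))
  where
  open ≤-Reasoning
  s₁ : ∀ q K L x a → q * (L * x + (K + L) * a) ≡ L * (q * x) + (K + L) * q * a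
  s₁ = solve-∀
  s₂ : ∀ q K L p a → L * (p * a) + (K + L) * q * a ≡ (L * p + (K + L) * q) * a
  s₂ = solve-∀
  s₃ : ∀ n q a → n * q * a ≡ q * (n * a)
  s₃ = solve-∀

-- Numerical inequalities for the level ratios.

-- K and L are the numbers of elements that a set of either family still has to receive outside the
-- prefix, and K + L + d + i + j is the size of the ground set.
module Numeric (K L d i j : ℕ)
               (range-k : 10 * (K + i) ≤ 3 * (K + L + d + (i + j)))
               (range-l : 10 * (L + j) ≤ 3 * (K + L + d + (i + j))) where

  open ≤-Reasoning

  sum≤ : 2 * (K + L) ≤ 3 * d
  sum≤ = *-cancelˡ-≤ 2 (+-cancelʳ-≤ (6 * (K + L) + 6 * (i + j)) _ _ (begin
    2 * (2 * (K + L)) + (6 * (K + L) + 6 * (i + j))         ≤⟨ m≤m+n _ (4 * (i + j)) ⟩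
    2 * (2 * (K + L)) + (6 * (K + L) + 6 * (i + j)) + 4 * (i + j) ≡⟨ e₁ K L i j ⟩
    10 * (K + i) + 10 * (L + j)                             ≤⟨ +-mono-≤ range-k range-l ⟩
    3 * (K + L + d + (i + j)) + 3 * (K + L + d + (i + j))   ≡⟨ e₂ K L d i j ⟩
    2 * (3 * d) + (6 * (K + L) + 6 * (i + j))               ∎))
    where
    e₁ : ∀ K L i j → 2 * (2 * (K + L)) + (6 * (K + L) + 6 * (i + j)) + 4 * (i + j) ≡ 10 * (K + i) + 10 * (L + j)
    e₁ = solve-∀
    e₂ : ∀ K L d i j → 3 * (K + L + d + (i + j)) + 3 * (K + L + d + (i + j)) ≡ 2 * (3 * d) + (6 * (K + L) + 6 * (i + j))
    e₂ = solve-∀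

  module _ (i≤j : i ≤ j) where

    -- From i ≤ j one gets 3 (i + j) ≤ 6 j, which the 10 j on the left absorbs. So the family with
    -- the larger level has at most 3/10 of the free elements still to receive.
    10L≤ : 10 * L ≤ 3 * (K + L + d)
    10L≤ = +-cancelʳ-≤ (6 * j) _ _ (begin
      10 * L + 6 * j               ≤⟨ +-monoʳ-≤ (10 * L) (*-monoˡ-≤ j (m≤n+m 6 4)) ⟩
      10 * L + 10 * j              ≡⟨ *-distribˡ-+ 10 L j ⟨
      10 * (L + j)                 ≤⟨ range-l ⟩
      3 * (K + L + d + (i + j))    ≤⟨ *-monoʳ-≤ 3 (+-monoʳ-≤ (K + L + d) (+-monoˡ-≤ j i≤j)) ⟩
      3 * (K + L + d + (j + j))    ≡⟨ e (K + L + d) j ⟩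
      3 * (K + L + d) + 6 * j      ∎)
      where
      e : ∀ s j → 3 * (s + (j + j)) ≡ 3 * s + 6 * j
      e = solve-∀

    L≤d : L ≤ d
    L≤d = *-cancelˡ-≤ 15 (begin
      15 * L                          ≤⟨ *-monoˡ-≤ L (m≤n+m 15 5) ⟩
      20 * L                          ≡⟨ *-assoc 2 10 L ⟩
      2 * (10 * L)                    ≤⟨ *-monoʳ-≤ 2 10L≤ ⟩
      2 * (3 * (K + L + d))           ≡⟨ e₁ K L d ⟩
      3 * (2 * (K + L)) + 6 * d       ≤⟨ +-monoˡ-≤ (6 * d) (*-monoʳ-≤ 3 sum≤) ⟩
      3 * (3 * d) + 6 * d             ≡⟨ e₂ d ⟩
      15 * d                          ∎)
      where
      e₁ : ∀ K L d → 2 * (3 * (K + L + d)) ≡ 3 * (2 * (K + L)) + 6 * d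
      e₁ = solve-∀
      e₂ : ∀ d → 3 * (3 * d) + 6 * d ≡ 15 * d
      e₂ = solve-∀

    -- (i + 1) / r bounds the ratio of a level to its shadow; here j = r + 1.
    generic : ∀ r → 3 * suc i ≤ 5 * r → 
      L * (suc i * (L + d + 2)) + (K + L) * (r * suc (K + L + d)) < suc (K + L + d) * (r * suc (K + L + d))
    generic r ratio = begin-strict
      L * (suc i * (L + d + 2)) + (K + L) * (r * N₁)   <⟨ +-monoˡ-< ((K + L) * (r * N₁)) (*-cancelˡ-< 6 _ _ core) ⟩
      suc d * (r * N₁) + (K + L) * (r * N₁)            ≡⟨ e₄ K L d (r * N₁) ⟩
      N₁ * (r * N₁)                                    ∎
      where
      N₁ : ℕ
      N₁ = suc (K + L + d)
      0<r : 0 < r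
      0<r = n≢0⇒n>0 λ { refl → contradiction ratio λ () }
      -- The three estimates are L ≤ (3/10) N, i + 1 ≤ (5/3) r and L + d + 2 ≤ 2 (d + 1), where N =
      -- K + L + d. Their constants multiply to exactly 1, and strictness comes from N < N₁.
      core : 6 * (L * (suc i * (L + d + 2))) < 6 * (suc d * (r * N₁))
      core = begin-strict
        6 * (L * (suc i * (L + d + 2)))      ≡⟨ e₁ L (suc i) (L + d + 2) ⟩
        3 * suc i * (2 * L * (L + d + 2))    ≤⟨ *-monoˡ-≤ (2 * L * (L + d + 2)) ratio ⟩
        5 * r * (2 * L * (L + d + 2))        ≡⟨ e₂ r L (L + d + 2) ⟩
        r * (10 * L * (L + d + 2))           ≤⟨ *-monoʳ-≤ r (*-mono-≤ 10L≤ (+-monoˡ-≤ 2 (+-monoˡ-≤ d L≤d))) ⟩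
        r * (3 * (K + L + d) * (d + d + 2))  <⟨ *-monoʳ-< r {{ >-nonZero 0<r }} (*-monoˡ-< (d + d + 2) {{ >-nonZero (m≤n⇒m≤o+n (d + d) (s≤s z≤n)) }} (*-monoʳ-< 3 (n<1+n (K + L + d)))) ⟩
        r * (3 * N₁ * (d + d + 2))           ≡⟨ e₃ r d N₁ ⟩
        6 * (suc d * (r * N₁))               ∎
        where
        e₁ : ∀ L i s → 6 * (L * (i * s)) ≡ 3 * i * (2 * L * s)
        e₁ = solve-∀
        e₂ : ∀ r L s → 5 * r * (2 * L * s) ≡ r * (10 * L * s)
        e₂ = solve-∀
        e₃ : ∀ r d N → r * (3 * N * (d + d + 2)) ≡ 6 * ((1 + d) * (r * N))
        e₃ = solve-∀
      e₄ : ∀ K L d x → (1 + d) * x + (K + L) * x ≡ (1 + (K + L + d)) * x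
      e₄ = solve-∀

    -- This compares (a + α′) β′ with a β: β′ contributes the factor L / N₁ and a + α′ at most the
    -- factor (N₁ + 2 (L + d + 2)) / N₁. Since K > 0 gives L + d + 2 ≤ N₁, it reduces to 3 L < N₁.
    levels-1-2 : 0 < K → L * (suc (K + L + d) + 2 * (L + d + 2)) < suc (K + L + d) * suc (K + L + d)
    levels-1-2 0<K = begin-strict
      L * (N₁ + 2 * (L + d + 2))   ≤⟨ *-monoʳ-≤ L (+-monoʳ-≤ N₁ (*-monoʳ-≤ 2 (begin
                                        L + d + 2            ≡⟨ e₁ L d ⟩
                                        1 + (1 + L + d)      ≤⟨ s≤s (+-monoˡ-≤ d (+-monoˡ-≤ L 0<K)) ⟩
                                        N₁                   ∎))) ⟩
      L * (N₁ + 2 * N₁)            ≡⟨ e₂ L N₁ ⟩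
      3 * L * N₁                   <⟨ *-monoˡ-< N₁ (*-cancelˡ-< 3 (3 * L) N₁ (begin-strict
                                        3 * (3 * L)       ≡⟨ *-assoc 3 3 L ⟨
                                        9 * L             ≤⟨ *-monoˡ-≤ L (m≤n+m 9 1) ⟩
                                        10 * L            ≤⟨ 10L≤ ⟩
                                        3 * (K + L + d)   <⟨ *-monoʳ-< 3 (n<1+n (K + L + d)) ⟩
                                        3 * N₁            ∎)) ⟩
      N₁ * N₁                      ∎
      where
      N₁ : ℕ
      N₁ = suc (K + L + d)
      e₁ : ∀ L d → L + d + 2 ≡ 1 + (1 + L + d)
      e₁ = solve-∀
      e₂ : ∀ L N → L * (N + 2 * N) ≡ 3 * L * N
      e₂ = solve-∀

module _ (K L d : ℕ) where

  open ≤-Reasoning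

  private
    N₁ : ℕ
    N₁ = suc (K + L + d)

    split-N₁ : ∀ x → suc d * x + (K + L) * x ≡ N₁ * x
    split-N₁ x = e K L d x
      where
      e : ∀ K L d x → (1 + d) * x + (K + L) * x ≡ (1 + (K + L + d)) * x
      e = solve-∀

  levels-2-2 : 10 * (K + 2) ≤ 3 * (K + L + d + 4) → 10 * (L + 2) ≤ 3 * (K + L + d + 4) →
    L * (3 * K) + (K + L) * N₁ < N₁ * N₁
  levels-2-2 range-k range-l = begin-strict
    L * (3 * K) + (K + L) * N₁    <⟨ +-monoˡ-< ((K + L) * N₁) (*-cancelˡ-< 10 _ _ core) ⟩
    suc d * N₁ + (K + L) * N₁     ≡⟨ split-N₁ N₁ ⟩
    N₁ * N₁                       ∎
    where
    K≤d : K ≤ d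
    -- The two levels are equal, so the bound on L applies to K with the roles exchanged.
    K≤d = Numeric.L≤d L K d 2 2 (subst (λ s → 10 * (L + 2) ≤ 3 * (s + d + 4)) (+-comm K L) range-l)
            (subst (λ s → 10 * (K + 2) ≤ 3 * (s + d + 4)) (+-comm K L) range-k) ≤-refl
    core : 10 * (L * (3 * K)) < 10 * (suc d * N₁)
    core = begin-strict
      10 * (L * (3 * K))        ≡⟨ e₁ K L ⟩
      3 * K * (10 * L)          ≤⟨ *-mono-≤ (*-monoʳ-≤ 3 K≤d) (Numeric.10L≤ K L d 2 2 range-k range-l ≤-refl) ⟩
      3 * d * (3 * (K + L + d)) ≤⟨ *-monoʳ-≤ (3 * d) (*-monoʳ-≤ 3 (n≤1+n _)) ⟩
      3 * d * (3 * N₁)          ≡⟨ e₂ d N₁ ⟩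
      9 * d * N₁                ≤⟨ *-monoˡ-≤ N₁ (*-monoˡ-≤ d (m≤n+m 9 1)) ⟩
      10 * d * N₁               <⟨ *-monoˡ-< N₁ (*-monoʳ-< 10 (n<1+n d)) ⟩
      10 * suc d * N₁           ≡⟨ *-assoc 10 (suc d) N₁ ⟩
      10 * (suc d * N₁)         ∎
      where
      e₁ : ∀ K L → 10 * (L * (3 * K)) ≡ 3 * K * (10 * L)
      e₁ = solve-∀
      e₂ : ∀ d N → 3 * d * (3 * N) ≡ 9 * d * N
      e₂ = solve-∀

  private
    lhs rhs : ℕ → ℕ → ℕ → ℕ
    lhs K L D = 30 * L * (3 * L + D + 6) * (3 * L + D + 9)
    rhs K L D = (D + 3) * (3 * K + 3 * L + D + 3) * (15 * L + 5 * D + 42 + 3 * K)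

    -- D stands for 3 d, because the range condition determines 3 d rather than d. With x the
    -- smaller of K and L, e their difference and u the slack in the range of the larger, 3 d = 7 e
    -- + 4 x + 12 + u, and `rhs` minus `lhs` expands with positive coefficients only.
    cubic : 10 * K + 12 ≤ 3 * (K + L + d) → 10 * L + 12 ≤ 3 * (K + L + d) → lhs K L (3 * d) < rhs K L (3 * d)
    cubic rk rl with ≤-total L K
    ... | inj₁ L≤K with m≤n⇒∃[o]m+o≡n L≤K | m≤n⇒∃[o]m+o≡n rk
    ...   | e , refl | u , eq = subst (λ D → lhs K L D < rhs K L D) (sym 3d≡)
      (≤-trans (s≤s (m≤m+n _ _)) (≤-reflexive (sym (certificate L e u))))
      where
      3d≡ : 3 * d ≡ 7 * e + 4 * L + 12 + u
      3d≡ = +-cancelˡ-≡ (3 * (L + e + L)) _ _ (trans (sym (*-distribˡ-+ 3 (L + e + L) d)) (trans (sym eq) (a L e u)))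
        where
        a : ∀ L e u → 10 * (L + e) + 12 + u ≡ 3 * (L + e + L) + (7 * e + 4 * L + 12 + u)
        a = solve-∀
      certificate : ∀ x e u → ((7 * e + 4 * x + 12 + u) + 3) * (3 * (x + e) + 3 * x + (7 * e + 4 * x + 12 + u) + 3) * (15 * x + 5 * (7 * e + 4 * x + 12 + u) + 42 + 3 * (x + e)) ≡ 1 + (30 * x * (3 * x + (7 * e + 4 * x + 12 + u) + 6) * (3 * x + (7 * e + 4 * x + 12 + u) + 9)
        + (50 * x * x * x + 2760 * x * x * e + 312 * x * x * u + 3870 * x * x + 5370 * x * e * e + 1308 * x * e * u + 20700 * x * e + 78 * x * u * u + 2448 * x * u + 18630 * x + 2660 * e * e * e + 996 * e * e * u + 16830 * e * e + 123 * e * u * u + 4149 * e * u + 34560 * e + 5 * u * u * u + 252 * u * u + 4185 * u + 22949))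
      certificate = solve-∀
    cubic rk rl | inj₂ K≤L with m≤n⇒∃[o]m+o≡n K≤L | m≤n⇒∃[o]m+o≡n rl
    ...   | e , refl | u , eq = subst (λ D → lhs K L D < rhs K L D) (sym 3d≡)
      (≤-trans (s≤s (m≤m+n _ _)) (≤-reflexive (sym (certificate K e u))))
      where
      3d≡ : 3 * d ≡ 7 * e + 4 * K + 12 + u
      3d≡ = +-cancelˡ-≡ (3 * (K + (K + e))) _ _ (trans (sym (*-distribˡ-+ 3 (K + (K + e)) d)) (trans (sym eq) (a K e u)))
        where
        a : ∀ K e u → 10 * (K + e) + 12 + u ≡ 3 * (K + (K + e)) + (7 * e + 4 * K + 12 + u)
        a = solve-∀
      certificate : ∀ x e u → ((7 * e + 4 * x + 12 + u) + 3) * (3 * x + 3 * (x + e) + (7 * e + 4 * x + 12 + u) + 3) * (15 * (x + e) + 5 * (7 * e + 4 * x + 12 + u) + 42 + 3 * x) ≡ 1 + (30 * (x + e) * (3 * (x + e) + (7 * e + 4 * x + 12 + u) + 6) * (3 * (x + e) + (7 * e + 4 * x + 12 + u) + 9)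
        + (50 * x * x * x + 510 * x * x * e + 312 * x * x * u + 3870 * x * x + 960 * x * e * e + 876 * x * e * u + 11520 * x * e + 78 * x * u * u + 2448 * x * u + 18630 * x + 500 * e * e * e + 600 * e * e * u + 8190 * e * e + 105 * e * u * u + 3339 * e * u + 25920 * e + 5 * u * u * u + 252 * u * u + 4185 * u + 22949))
      certificate = solve-∀

  -- The ratio arises from a ≥ (c / 10)(5 v₁ + v₂), with c boundary sets and v₁, v₂ the weights of
  -- headless sets of sizes 4 and 5. For K > 0 the factor 5 (L + d) + 14 + K is 5 (L + d + 3) + (K -
  -- 1), and (K - 1) v₁ = (L + d + 3) v₂. The multiplier 27 turns d into 3 d in all three factors.
  levels-3-3 : 10 * (K + 3) ≤ 3 * (K + L + d + 6) → 10 * (L + 3) ≤ 3 * (K + L + d + 6) →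
    L * (10 * ((L + d + 2) * (L + d + 3))) + (K + L) * (N₁ * (5 * (L + d) + 14 + K)) < N₁ * (N₁ * (5 * (L + d) + 14 + K))
  levels-3-3 range-k range-l = begin-strict
    L * (10 * ((L + d + 2) * (L + d + 3))) + (K + L) * Q   <⟨ +-monoˡ-< ((K + L) * Q) (*-cancelˡ-< 27 _ _ core) ⟩
    suc d * Q + (K + L) * Q                                ≡⟨ split-N₁ Q ⟩
    N₁ * Q                                                 ∎
    where
    Q : ℕ
    Q = N₁ * (5 * (L + d) + 14 + K)
    shift : ∀ x → 10 * (x + 3) ≤ 3 * (K + L + d + 6) → 10 * x + 12 ≤ 3 * (K + L + d)
    shift x h = +-cancelʳ-≤ 18 _ _ (begin
      10 * x + 12 + 18          ≡⟨ e₁ x ⟩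
      10 * (x + 3)              ≤⟨ h ⟩
      3 * (K + L + d + 6)       ≡⟨ *-distribˡ-+ 3 (K + L + d) 6 ⟩
      3 * (K + L + d) + 18      ∎)
      where
      e₁ : ∀ x → 10 * x + 12 + 18 ≡ 10 * (x + 3)
      e₁ = solve-∀
    core : 27 * (L * (10 * ((L + d + 2) * (L + d + 3)))) < 27 * (suc d * Q)
    core = begin-strict
      27 * (L * (10 * ((L + d + 2) * (L + d + 3))))   ≡⟨ e₁ L d ⟩
      30 * L * (3 * L + 3 * d + 6) * (3 * L + 3 * d + 9)   <⟨ cubic (shift K range-k) (shift L range-l) ⟩
      (3 * d + 3) * (3 * K + 3 * L + 3 * d + 3) * (15 * L + 5 * (3 * d) + 42 + 3 * K)    ≡⟨ e₂ K L d ⟩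
      27 * (suc d * Q)                                ∎
      where
      e₁ : ∀ L d → 27 * (L * (10 * ((L + d + 2) * (L + d + 3)))) ≡ 30 * L * (3 * L + 3 * d + 6) * (3 * L + 3 * d + 9)
      e₁ = solve-∀
      e₂ : ∀ K L d → (3 * d + 3) * (3 * K + 3 * L + 3 * d + 3) * (15 * L + 5 * (3 * d) + 42 + 3 * K)
        ≡ 27 * ((1 + d) * ((1 + (K + L + d)) * (5 * (L + d) + 14 + K)))
      e₂ = solve-∀

-- The conversion rate of the exchange: the absorption identity for N + 1 over K, where K elements
-- are missing without the head and K - 1 with it.
w-absorb : ∀ N K i → suc N * w N (i + K) (suc i) ≡ K * w (suc N) (i + K) i
w-absorb N zero    zero    = *-zeroʳ (suc N)
w-absorb N (suc K) zero    = sym (absorption N K)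
w-absorb N K       (suc i) = w-absorb N K i

w-absorb′ : ∀ N K i → K * w N (i + K) i + K * w N (i + K) (suc i) ≡ suc N * w N (i + K) (suc i)
w-absorb′ N zero    zero    = sym (*-zeroʳ (suc N))
w-absorb′ N (suc K) zero    = absorption′ N K
w-absorb′ N K       (suc i) = w-absorb′ N K i

w-ratio : ∀ K s i → K * w (K + s) (i + K) i ≡ suc s * w (K + s) (i + K) (suc i)
w-ratio K s i = +-cancelʳ-≡ (K * w (K + s) (i + K) (suc i)) _ _
  (trans (w-absorb′ (K + s) K i) (e K s (w (K + s) (i + K) (suc i))))
  where
  e : ∀ K s x → (1 + (K + s)) * x ≡ (1 + s) * x + K * x
  e = solve-∀

any-or-none : ∀ {m} (F : Family m) → (∃[ x ] F x ≡ true) ⊎ (∀ x → F x ≡ false)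
any-or-none {zero} F with F [] in e
... | true  = inj₁ ([] , e)
... | false = inj₂ λ { [] → e }
any-or-none {suc m} F with any-or-none (λ x → F (false ∷ x)) | any-or-none (λ x → F (true ∷ x))
... | inj₁ (x , h) | _ = inj₁ (false ∷ x , h)
... | inj₂ _ | inj₁ (x , h) = inj₁ (true ∷ x , h)
... | inj₂ f | inj₂ t = inj₂ λ { (false ∷ x) → f x ; (true ∷ x) → t x }

superset-of-size : ∀ {m} (x : Subset m) e → ∣ x ∣ ≤ e → e ≤ m → ∃[ y ] (x ⊆ y × ∣ y ∣ ≡ e)
superset-of-size {m} x e h e≤m
  with avoiding ⊤ x (e ∸ ∣ x ∣) ⊆⊤ (≤-trans (≤-reflexive (m+[n∸m]≡n h)) (≤-trans e≤m (≤-reflexive (sym (∣⊤∣≡n m)))))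
... | y , _ , ∣y∣ , d = x ∪ y , p⊆p∪q y , trans (∣∪∣-disjoint x y d) (trans (cong (∣ x ∣ +_) ∣y∣) (m+[n∸m]≡n h))

-- The exchange at one pair of levels, with the exceptional cases.

module LevelSteps (n′ : ℕ) where

  open Admissible
  open Good

  record Setting (k l N : ℕ) {m} (U V : Family (suc m)) : Set where
    field
      adm-k : Admissible n′ k
      adm-l : Admissible n′ l
      size  : N + suc m ≡ 2 + n′
      up-U  : Upset U
      up-V  : Upset V
      comp-U : AllCompressed U
      comp-V : AllCompressed V
      cross : Cross U V

  open Setting

  Setting-sym : ∀ {k l N m} {U V : Family (suc m)} → Setting k l N U V → Setting l k N V U
  Setting-sym {U = U} {V} s = record
    { adm-k = s .adm-l ; adm-l = s .adm-k ; size = s .size ; up-U = s .up-V ; up-V = s .up-U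
    ; comp-U = s .comp-V ; comp-V = s .comp-U ; cross = Cross-sym {U = U} {V} (s .cross) }

  ∂ : ∀ {m} → ℕ → Family (suc m) → ℕ
  ∂ i U = ∑ (λ x → χ (boundary i U x))

  -- The hypothesis of `exchange` on a and α′; it concerns one family alone.
  Small : ∀ {m} (k N K L N₁ i : ℕ) → Family (suc m) → Set
  Small k N K L N₁ i U =
    (weight N k (cut-level i U) ≡ 0 × ∂ i U * w N k (suc i) ≡ 0)
    ⊎ L * (∂ i U * w N k (suc i)) + (K + L) * weight N k (cut-level i U) < N₁ * weight N k (cut-level i U)

  cut-⊇ : ∀ {m} k N j (V : Family (suc m)) →
    (∀ y → boundary j V y ≡ true → 0 < w N k (suc j) → V (false ∷ y) ≡ true) →
    ∀ x → V x ≡ true → 0 < w N k ∣ x ∣ → cut-level j V x ≡ true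
  cut-⊇ k N j V h (false ∷ y) v pos = cut-intro j V false y v (λ _ → v)
  cut-⊇ k N j V h (true ∷ y) v pos = cut-intro j V true y v low
    where
    low : ∣ y ∣ ≡ j → V (false ∷ y) ≡ true
    low ∣y∣ with V (false ∷ y) in e
    ... | true  = refl
    ... | false = true≢false (h y (boundary-intro j V y v e ∣y∣) (subst (λ e → 0 < w N k (suc e)) ∣y∣ pos)) e

  -- Deleting a boundary without weight costs `V` nothing, while `U` only grows.
  free-step : ∀ {k l N m i j} {U V : Family (suc m)} →
    (∀ y → boundary j V y ≡ true → 0 < w N l (suc j) → V (false ∷ y) ≡ true) →
    Good n′ k l N (add-level i U) (cut-level j V) → Good n′ k l N U V
  free-step {k} {l} {N} {i = i} {j} {U} {V} h =
    Good-mono n′ (λ x u _ → add-⊇ i U x u) (cut-⊇ l N j V h)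

  private
    scale : ∀ N K i c → suc N * (c * w N (i + K) (suc i)) ≡ K * (c * w (suc N) (i + K) i)
    scale N K i c = trans (e (suc N) c (w N (i + K) (suc i)))
      (trans (cong (c *_) (w-absorb N K i)) (e′ c K (w (suc N) (i + K) i)))
      where
      e : ∀ n c x → n * (c * x) ≡ c * (n * x)
      e = solve-∀
      e′ : ∀ c K x → c * (K * x) ≡ K * (c * x)
      e′ = solve-∀

  module _ {i j K L N m} {U V : Family (suc m)} (s : Setting (i + K) (j + L) N U V)
           (small : Small (i + K) N K L (suc N) i U)
           (up-down : Good n′ (i + K) (j + L) N (add-level i U) (cut-level j V))
           (down-up : Good n′ (i + K) (j + L) N (cut-level i U) (add-level j V)) where

    private
      k = i + K
      l = j + L
      M = star-size n′ k * star-size n′ l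
      a = weight N k (cut-level i U)
      b = weight N l (cut-level j V)
      α = ∂ i U * w (suc N) k i
      β = ∂ j V * w (suc N) l j
      α′ = ∂ i U * w N k (suc i)
      β′ = ∂ j V * w N l (suc j)

      0<M : 0 < M
      0<M = *-mono-< (star-size-pos n′ (s .adm-k)) (star-size-pos n′ (s .adm-l))

      result : (a + α′) * (b + β′) ≤ M × ((a + α′) * (b + β′) ≡ M → α′ ≡ 0 × a * (b + β) ≡ M)
      result = exchange {a} {α} {α′} {b} {β} {β′} {K} {L} {suc N} {M}
        (scale N K i (∂ i U)) (scale N L j (∂ j V)) 0<M (s≤s z≤n)
        (subst (λ u → u * b ≤ M) (weight-add i U (s .up-U) N k) (up-down .bound))
        (subst (λ v → a * v ≤ M) (weight-add j V (s .up-V) N l) (down-up .bound))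
        small

      split : weight N k U * weight N l V ≡ (a + α′) * (b + β′)
      split = cong₂ _*_ (weight-split i U (s .up-U) N k) (weight-split j V (s .up-V) N l)

    exchange-step : Good n′ k l N U V
    exchange-step .bound = subst (_≤ M) (sym split) (proj₁ result)
    -- At equality the boundary of `U` has no weight, so cutting it removes no set of positive
    -- weight. The pair of `down-up` then contains both families as far as weight is concerned, and
    -- its star serves for them.
    exchange-step .extremal e = go (down-up .extremal (trans (cong (a *_) (weight-add j V (s .up-V) N l)) (proj₂ tight)))
      where
      tight : α′ ≡ 0 × a * (b + β) ≡ M
      tight = proj₂ result (trans (sym split) e)
      empty : ∀ x → boundary i U x ≡ true → 0 < w N k (suc i) → U (false ∷ x) ≡ true
      empty x h pos = contradiction (proj₁ tight) (<⇒≢ (*-mono-< ∂>0 pos) ∘ sym)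
        where
        ∂>0 : 0 < ∂ i U
        ∂>0 = ≤-trans (≤-reflexive (cong χ (sym h))) (term≤∑ (λ x → χ (boundary i U x)) x)
      go : ∃[ T ] (∣ T ∣ ≡ 2 × Contained k N T (cut-level i U) × Contained l N T (add-level j V)) →
           ∃[ T ] (∣ T ∣ ≡ 2 × Contained k N T U × Contained l N T V)
      go (T , ∣T∣ , cu , cv) = T , ∣T∣ ,
        (λ x u pos → cu x (cut-⊇ k N i U empty x u pos) pos) ,
        (λ x v pos → cv x (add-⊇ j V x v) pos)

  level-of : ∀ {m} → ℕ → Family (suc m) → Family m
  level-of e U x = U (false ∷ x) ∧ (∣ x ∣ ≡ᵇ e)

  level-≤ : ∀ {m} N k e (U : Family (suc m)) (up : Upset U) i →
    ∑ (λ x → χ (level-of e U x)) * w (suc N) k e ≤ weight N k (cut-level i U)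
  level-≤ N k e U up i = ≤-trans (≤-reflexive (sym (∑-*ʳ (λ x → χ (level-of e U x)) (w (suc N) k e))))
    (≤-trans (∑-mono-≤ pointwise) (weight-cut-≥ i U up N k))
    where
    pointwise : ∀ x → χ (level-of e U x) * w (suc N) k e ≤ χ (U (false ∷ x)) * w (suc N) k ∣ x ∣
    pointwise x with U (false ∷ x) | ∣ x ∣ ≡ᵇ e in q
    ... | false | _     = z≤n
    ... | true  | false = z≤n
    ... | true  | true  rewrite ≡ᵇ-true {∣ x ∣} {e} q = ≤-refl

  ∂-≤ : ∀ {m} i (U : Family (suc m)) → ∂ i U ≤ ∑ {m} (λ x → χ (∣ x ∣ ≡ᵇ i))
  ∂-≤ i U = ∑-mono-≤ pointwise
    where
    pointwise : ∀ x → χ (boundary i U x) ≤ χ (∣ x ∣ ≡ᵇ i)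
    pointwise x with U (true ∷ x) | U (false ∷ x) | ∣ x ∣ ≡ᵇ i
    ... | false | _     | _     = z≤n
    ... | true  | true  | _     = z≤n
    ... | true  | false | false = z≤n
    ... | true  | false | true  = ≤-refl

  -- Stability under shifts puts every upward neighbour of a boundary set into the headless part of
  -- `U`, so the shadow is part of what survives cutting.
  ∂-shadow : ∀ {m} i r (U : Family (suc m)) → AllCompressed U → i + r ≡ m →
    ∂ i U * r ≤ ∑ (λ x → χ (level-of (suc i) U x)) * suc i
  ∂-shadow i r U comp i+r = shadow i r (boundary i U) (level-of (suc i) U) i+r
    (λ x h → proj₂ (proj₂ (boundary-elim i U x h)))
    (λ x h → ≡ᵇ-true (proj₂ (∧-true {U (false ∷ x)} h)))
    (λ x z h xz → ∧-intro (comp z x xz (proj₁ (boundary-elim i U x h)))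
      (subst (λ e → (e ≡ᵇ suc i) ≡ true)
        (sym (trans (∣flip∣-out z x xz) (cong suc (proj₂ (proj₂ (boundary-elim i U x h))))))
        (≡ᵇ-refl (suc i))))

  w-ratio′ : ∀ K L d i → K * w (suc (K + L + d)) (i + K) i ≡ (L + d + 2) * w (suc (K + L + d)) (i + K) (suc i)
  w-ratio′ K L d i = subst₂ (λ n t → K * w n (i + K) i ≡ t * w n (i + K) (suc i)) (e K L d) (e′ L d) (w-ratio K (L + d + 1) i)
    where
    e : ∀ K L d → K + (L + d + 1) ≡ 1 + (K + L + d)
    e = solve-∀
    e′ : ∀ L d → 1 + (L + d + 1) ≡ L + d + 2
    e′ = solve-∀

  module _ {m} (i r K L d : ℕ) {U : Family (suc m)} (up : Upset U) (comp : AllCompressed U) (i+r : i + r ≡ m) where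

    private
      N = K + L + d
      k = i + K
      a = weight N k (cut-level i U)
      c = ∂ i U
      g = ∑ (λ x → χ (level-of (suc i) U x))
      v = w N k (suc i)
      v₀ = w (suc N) k i
      v₁ = w (suc N) k (suc i)

    -- Three ratios compose: from the actual to the saturated boundary (`scale`), from v₀ to v₁
    -- (`w-ratio′`), and from the boundary to its shadow (`∂-shadow`).
    generic-ratio : r * suc N * (c * v) ≤ suc i * (L + d + 2) * a
    generic-ratio = begin
      r * suc N * (c * v)                 ≡⟨ *-assoc r (suc N) (c * v) ⟩
      r * (suc N * (c * v))               ≡⟨ cong (r *_) (scale N K i c) ⟩
      r * (K * (c * v₀))                  ≡⟨ e₁ r K c v₀ ⟩
      c * r * (K * v₀)                    ≡⟨ cong (c * r *_) (w-ratio′ K L d i) ⟩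
      c * r * ((L + d + 2) * v₁)          ≤⟨ *-monoˡ-≤ ((L + d + 2) * v₁) (∂-shadow i r U comp i+r) ⟩
      g * suc i * ((L + d + 2) * v₁)      ≡⟨ e₂ g (suc i) (L + d + 2) v₁ ⟩
      suc i * (L + d + 2) * (g * v₁)      ≤⟨ *-monoʳ-≤ (suc i * (L + d + 2)) (level-≤ N k (suc i) U up i) ⟩
      suc i * (L + d + 2) * a             ∎
      where
      open ≤-Reasoning
      e₁ : ∀ r K c v → r * (K * (c * v)) ≡ c * r * (K * v)
      e₁ = solve-∀
      e₂ : ∀ g i s v → g * i * (s * v) ≡ i * s * (g * v)
      e₂ = solve-∀

    -- Plain counting replaces the shadow: there are at most 3 boundary sets, each of saturated
    -- weight v₀, and one headless 2-set already contributes v₀ to a.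
    two-set-ratio : i ≡ 2 → r ≡ 1 → ∀ x → U (false ∷ x) ≡ true → ∣ x ∣ ≡ 2 → suc N * (c * v) ≤ 3 * K * a
    two-set-ratio refl refl x u ∣x∣ = begin
      suc N * (c * v)     ≡⟨ scale N K i c ⟩
      K * (c * v₀)        ≤⟨ *-monoʳ-≤ K (*-mono-≤ c≤3 v₀≤a) ⟩
      K * (3 * a)         ≡⟨ e K a ⟩
      3 * K * a           ∎
      where
      open ≤-Reasoning
      e : ∀ K a → K * (3 * a) ≡ 3 * K * a
      e = solve-∀
      c≤3 : c ≤ 3
      c≤3 = subst (λ m → ∀ (U : Family (suc m)) → ∂ 2 U ≤ 3) i+r (λ U → ∂-≤ 2 U) U
      v₀≤a : v₀ ≤ a
      v₀≤a = ≤-trans (≤-reflexive (trans (sym (*-identityˡ v₀)) (sym (cong₂ (λ b e → χ b * w (suc N) k e) u ∣x∣))))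
        (≤-trans (term≤∑ (λ x → χ (U (false ∷ x)) * w (suc N) k ∣ x ∣) x) (weight-cut-≥ i U up N k))

    -- The shadow at size 4 alone is too small here, so the set of size 5 is counted as well.
    three-three-ratio : ∀ {K′} → K ≡ suc K′ → i ≡ 3 → r ≡ 2 → U (false ∷ ⊤) ≡ true →
      suc N * (5 * (L + d) + 14 + K) * (c * v) ≤ 10 * ((L + d + 2) * (L + d + 3)) * a
    three-three-ratio {K′} refl refl refl top = begin
      suc N * S * (c * v)                               ≡⟨ e₁ (suc N) S c v ⟩
      S * (suc N * (c * v))                             ≡⟨ cong (S *_) (scale N K i c) ⟩
      S * (K * (c * v₀))                                ≡⟨ e₂ S K c v₀ ⟩
      S * c * (K * v₀)                                  ≡⟨ cong (S * c *_) (w-ratio′ K L d i) ⟩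
      S * c * ((L + d + 2) * v₁)                        ≡⟨ e₃ K′ L d c v₁ ⟩
      (L + d + 2) * c * (5 * (L + d + 3) * v₁ + K′ * v₁)  ≡⟨ cong (λ t → (L + d + 2) * c * (5 * (L + d + 3) * v₁ + t)) next ⟩
      (L + d + 2) * c * (5 * (L + d + 3) * v₁ + (L + d + 3) * v₂)  ≡⟨ e₄ L d c v₁ v₂ ⟩
      (L + d + 2) * (L + d + 3) * (5 * c * v₁ + c * v₂)            ≤⟨ *-monoʳ-≤ ((L + d + 2) * (L + d + 3)) (+-mono-≤ 5cv₁≤ cv₂≤) ⟩
      (L + d + 2) * (L + d + 3) * (10 * (g * v₁) + 10 * v₂)        ≡⟨ cong ((L + d + 2) * (L + d + 3) *_) (sym (*-distribˡ-+ 10 (g * v₁) v₂)) ⟩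
      (L + d + 2) * (L + d + 3) * (10 * (g * v₁ + v₂))             ≤⟨ *-monoʳ-≤ ((L + d + 2) * (L + d + 3)) (*-monoʳ-≤ 10 below) ⟩
      (L + d + 2) * (L + d + 3) * (10 * a)                         ≡⟨ e₅ ((L + d + 2) * (L + d + 3)) a ⟩
      10 * ((L + d + 2) * (L + d + 3)) * a              ∎
      where
      open ≤-Reasoning
      S v₂ : ℕ
      S = 5 * (L + d) + 14 + K
      v₂ = w (suc N) k 5
      e₁ : ∀ n s c v → n * s * (c * v) ≡ s * (n * (c * v))
      e₁ = solve-∀
      e₂ : ∀ s K c v → s * (K * (c * v)) ≡ s * c * (K * v)
      e₂ = solve-∀
      e₃ : ∀ K′ L d c v → (5 * (L + d) + 14 + (1 + K′)) * c * ((L + d + 2) * v) ≡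
           (L + d + 2) * c * (5 * (L + d + 3) * v + K′ * v)
      e₃ = solve-∀
      e₄ : ∀ L d c v₁ v₂ → (L + d + 2) * c * (5 * (L + d + 3) * v₁ + (L + d + 3) * v₂) ≡
           (L + d + 2) * (L + d + 3) * (5 * c * v₁ + c * v₂)
      e₄ = solve-∀
      e₅ : ∀ t a → t * (10 * a) ≡ 10 * t * a
      e₅ = solve-∀
      next : K′ * v₁ ≡ (L + d + 3) * v₂
      next = subst₂ (λ n t → K′ * w n (4 + K′) 4 ≡ t * w n (4 + K′) 5) (f₁ K′ L d) (f₂ L d) (w-ratio K′ (L + d + 2) 4)
        where
        f₁ : ∀ K′ L d → K′ + (L + d + 2) ≡ 1 + (1 + K′ + L + d)
        f₁ = solve-∀
        f₂ : ∀ L d → 1 + (L + d + 2) ≡ L + d + 3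
        f₂ = solve-∀
      c≤10 : c ≤ 10
      c≤10 = subst (λ m → ∀ (U : Family (suc m)) → ∂ 3 U ≤ 10) i+r (λ U → ∂-≤ 3 U) U
      cv₂≤ : c * v₂ ≤ 10 * v₂
      cv₂≤ = *-monoˡ-≤ v₂ c≤10
      5cv₁≤ : 5 * c * v₁ ≤ 10 * (g * v₁)
      5cv₁≤ = ≤-trans (*-monoˡ-≤ v₁ 5c≤10g) (≤-reflexive (*-assoc 10 g v₁))
        where
        5c≤10g : 5 * c ≤ 10 * g
        5c≤10g = *-cancelˡ-≤ {5 * c} {10 * g} 2 (begin
          2 * (5 * c)    ≡⟨ h₁ c ⟩
          5 * (c * 2)    ≤⟨ *-monoʳ-≤ 5 (∂-shadow 3 2 U comp i+r) ⟩
          5 * (g * 4)    ≡⟨ h₂ g ⟩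
          2 * (10 * g)   ∎)
          where
          h₁ : ∀ c → 2 * (5 * c) ≡ 5 * (c * 2)
          h₁ = solve-∀
          h₂ : ∀ g → 5 * (g * 4) ≡ 2 * (10 * g)
          h₂ = solve-∀
      below : g * v₁ + v₂ ≤ a
      below = ≤-trans (≤-reflexive (cong₂ _+_ (sym (∑-*ʳ (λ x → χ (level-of 4 U x)) v₁)) (sym top-weight)))
        (≤-trans (≤-reflexive (sym (∑-+ (λ x → χ (level-of 4 U x) * v₁) (λ x → χ (∣ x ∣ ≡ᵇ 5) * v₂))))
          (≤-trans (∑-mono-≤ pointwise) (weight-cut-≥ 3 U up N k)))
        where
        top-weight : ∑ {m} (λ x → χ (∣ x ∣ ≡ᵇ 5) * v₂) ≡ v₂
        top-weight = trans (∑-*ʳ {m} (λ x → χ (∣ x ∣ ≡ᵇ 5)) v₂)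
          (trans (cong (_* v₂) (subst (λ m → ∑ {m} (λ x → χ (∣ x ∣ ≡ᵇ 5)) ≡ 1) i+r refl)) (*-identityˡ v₂))
        full : ∀ x → ∣ x ∣ ≡ 5 → U (false ∷ x) ≡ true
        full x h = subst (λ y → U (false ∷ y) ≡ true) (sym (∣p∣≡n⇒p≡⊤ (trans h i+r))) top
        pointwise : ∀ x → χ (level-of 4 U x) * v₁ + χ (∣ x ∣ ≡ᵇ 5) * v₂ ≤ χ (U (false ∷ x)) * w (suc N) k ∣ x ∣
        pointwise x with U (false ∷ x) in u | ∣ x ∣ ≡ᵇ 4 in q | ∣ x ∣ ≡ᵇ 5 in q′
        ... | false | _     | true  = true≢false (full x (≡ᵇ-true {∣ x ∣} q′)) u
        ... | false | _     | false = z≤n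
        ... | true  | false | false = z≤n
        ... | true  | true  | true  = contradiction (trans (sym (≡ᵇ-true {∣ x ∣} {4} q)) (≡ᵇ-true {∣ x ∣} {5} q′)) λ ()
        ... | true  | true  | false rewrite ≡ᵇ-true {∣ x ∣} {4} q = ≤-reflexive (+-identityʳ _)
        ... | true  | false | true  rewrite ≡ᵇ-true {∣ x ∣} {5} q′ = ≤-refl

  data Shape : ℕ → ℕ → Set where
    generic : ∀ {i r} → 3 * suc i ≤ 5 * r → Shape i r
    one-two     : Shape 1 1
    two-two     : Shape 2 1
    three-three : Shape 3 2

  -- The inequality 3 (i + 1) ≤ 5 r always holds for i < r, from r = 2 on for i = r, and from r = 3
  -- on for i = r + 1; the remaining pairs are the three named shapes.
  classify : ∀ i r → 1 ≤ i → i ≤ suc r → 2 ≤ i + r → Shape i r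
  classify i r 1≤i i≤j 2≤ with m≤n⇒m<n∨m≡n i≤j
  classify i zero 1≤i i≤j 2≤ | inj₂ refl = contradiction 2≤ λ { (s≤s ()) }
  classify i (suc zero) 1≤i i≤j 2≤ | inj₂ refl = two-two
  classify i (suc (suc zero)) 1≤i i≤j 2≤ | inj₂ refl = three-three
  classify i (suc (suc (suc r))) 1≤i i≤j 2≤ | inj₂ refl =
    generic (≤-trans (m≤m+n _ (2 * r)) (≤-reflexive (e r)))
    where
    e : ∀ r → 3 * (5 + r) + 2 * r ≡ 5 * (3 + r)
    e = solve-∀
  ... | inj₁ (s≤s i≤r) with m≤n⇒m<n∨m≡n i≤r
  classify i (suc zero) 1≤i i≤j 2≤ | inj₁ (s≤s i≤r) | inj₂ refl = one-two
  classify i (suc (suc r)) 1≤i i≤j 2≤ | inj₁ (s≤s i≤r) | inj₂ refl =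
    generic (≤-trans (m≤m+n _ (1 + 2 * r)) (≤-reflexive (e r)))
    where
    e : ∀ r → 3 * (3 + r) + (1 + 2 * r) ≡ 5 * (2 + r)
    e = solve-∀
  classify i zero () i≤j 2≤ | inj₁ (s≤s i≤r) | inj₂ refl
  ... | inj₁ i<r = generic (≤-trans (*-monoʳ-≤ 3 i<r) (*-monoˡ-≤ r (m≤n+m 3 2)))

  ranges : ∀ {i r K L d m} → 2 + n′ ≡ K + L + d + suc m → i + r ≡ m →
    Admissible n′ (i + K) → Admissible n′ (suc r + L) →
    10 * (K + i) ≤ 3 * (K + L + d + (i + suc r)) × 10 * (L + suc r) ≤ 3 * (K + L + d + (i + suc r))
  ranges {i} {r} {K} {L} {d} e refl ak al =
    subst₂ (λ x y → 10 * x ≤ 3 * y) (+-comm i K) total (ak .range) ,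
    subst₂ (λ x y → 10 * x ≤ 3 * y) (+-comm (suc r) L) total (al .range)
    where
    total = trans e (cong (K + L + d +_) (sym (+-suc i r)))

  small-generic : ∀ {i r K L d N m} {U V : Family (suc m)} → Setting (i + K) (suc r + L) N U V →
    N ≡ K + L + d → i + r ≡ m → i ≤ suc r → 3 * suc i ≤ 5 * r → Small (i + K) N K L (suc N) i U
  small-generic {i} {r} {K} {L} {d} {U = U} s refl i+r i≤j ratio =
    small-from-ratio {K = K} {L} {suc (K + L + d)} (suc i * (L + d + 2)) (r * suc (K + L + d))
      (generic-ratio i r K L d (s .up-U) (s .comp-U) i+r)
      (Numeric.generic K L d i (suc r) (proj₁ rg) (proj₂ rg) i≤j r ratio)
    where rg = ranges {i} {r} {K} {L} {d} (sym (s .size)) i+r (s .adm-k) (s .adm-l)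

  small-two-two : ∀ {K L d N} {U V : Family 4} → Setting (2 + K) (2 + L) N U V → N ≡ K + L + d →
    ∀ x → U (false ∷ x) ≡ true → ∣ x ∣ ≡ 2 → Small (2 + K) N K L (suc N) 2 U
  small-two-two {K} {L} {d} s refl x u ∣x∣ =
    small-from-ratio {K = K} {L} {suc (K + L + d)} (3 * K) (suc (K + L + d))
      (two-set-ratio 2 1 K L d (s .up-U) (s .comp-U) refl refl refl x u ∣x∣)
      (levels-2-2 K L d (proj₁ rg) (proj₂ rg))
    where rg = ranges {2} {1} {K} {L} {d} (sym (s .size)) refl (s .adm-k) (s .adm-l)

  small-three-three : ∀ {K L d N} {U V : Family 6} → Setting (3 + K) (3 + L) N U V → N ≡ K + L + d →
    U (false ∷ ⊤) ≡ true → Small (3 + K) N K L (suc N) 3 U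
  -- For K = 0 a boundary set together with the head exceeds size k and has weight 0, so the ratio 0
  -- / 1 applies.
  small-three-three {zero} {L} {d} {U = U} s refl top = small-from-ratio {K = zero} {L} {suc (L + d)} 0 1
    (≤-reflexive (trans (+-identityʳ _) (*-zeroʳ (∂ 3 U))))
    (subst₂ _<_ (e₁ L) (e₂ L d) (s≤s (m≤m+n L d)))
    where
    e₁ : ∀ L → L ≡ L * 0 + (0 + L) * 1
    e₁ = solve-∀
    e₂ : ∀ L d → 1 + (L + d) ≡ (1 + (0 + L + d)) * 1
    e₂ = solve-∀
  small-three-three {suc K} {L} {d} s refl top =
    small-from-ratio {K = suc K} {L} {suc (suc K + L + d)} (10 * ((L + d + 2) * (L + d + 3))) (suc (suc K + L + d) * (5 * (L + d) + 14 + suc K))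
      (three-three-ratio 3 2 (suc K) L d (s .up-U) (s .comp-U) refl refl refl refl top)
      (levels-3-3 (suc K) L d (proj₁ rg) (proj₂ rg))
    where rg = ranges {3} {2} {suc K} {L} {d} (sym (s .size)) refl (s .adm-k) (s .adm-l)

  -- Here nothing of V survives the removal of its boundary.
  step-one-two : ∀ {K L d N} {U V : Family 3} → Setting (1 + K) (2 + L) N U V → N ≡ K + L + d →
    ∀ y → boundary 2 V y ≡ true →
    Good n′ (1 + K) (2 + L) N (cut-level 1 U) (add-level 2 V) → Good n′ (1 + K) (2 + L) N U V
  step-one-two {K} {L} {d} {U = U} {V} s refl y₀ hy down-up = Good-strict n′ (subst (_< M) (sym split) P<M)
    where
    N M a β β′ α′ N₁ : ℕ
    N = K + L + d
    N₁ = suc N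
    M = star-size n′ (1 + K) * star-size n′ (2 + L)
    a = weight N (1 + K) (cut-level 1 U)
    β = ∂ 2 V * w (suc N) (2 + L) 2
    β′ = ∂ 2 V * w N (2 + L) 3
    α′ = ∂ 1 U * w N (1 + K) 2
    y₀-elim = boundary-elim 2 V y₀ hy
    y₀≡⊤ : y₀ ≡ ⊤
    y₀≡⊤ = ∣p∣≡n⇒p≡⊤ (proj₂ (proj₂ y₀-elim))
    ⊆y₀ : ∀ {y} → y ⊆ y₀
    ⊆y₀ {y} = subst (y ⊆_) (sym y₀≡⊤) ⊆⊤
    low-empty : ∀ y → ¬ V (false ∷ y) ≡ true
    low-empty y v = true≢false (s .up-V (s⊆s ⊆y₀) v) (proj₁ (proj₂ y₀-elim))
    cut-empty : ∀ x → ¬ cut-level 2 V x ≡ true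
    cut-empty (false ∷ y) h = low-empty y (cut-⊆ 2 V (false ∷ y) h)
    cut-empty (true ∷ y) h with cut-elim 2 V true y h | ∣ y ∣ ≟ 2
    ... | v , low | yes e = low-empty y (low e)
    ... | v , low | no ne = low-empty y₀ (promote {U = V} (s .up-V) (s .comp-V) v ⊆y₀
                              (λ e → ne (trans e (proj₂ (proj₂ y₀-elim)))))
    b≡0 : weight N (2 + L) (cut-level 2 V) ≡ 0
    b≡0 = trans (∑-cong zero-term) (∑-zero {3})
      where
      zero-term : ∀ x → χ (cut-level 2 V x) * w N (2 + L) ∣ x ∣ ≡ 0
      zero-term x with cut-level 2 V x in e
      ... | false = refl
      ... | true  = contradiction e (cut-empty x)
    split : weight N (1 + K) U * weight N (2 + L) V ≡ (a + α′) * β′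
    split = cong₂ _*_ (weight-split 1 U (s .up-U) N (1 + K))
      (trans (weight-split 2 V (s .up-V) N (2 + L)) (cong (_+ β′) b≡0))
    aβ≤M : a * β ≤ M
    aβ≤M = subst (λ v → a * v ≤ M) (trans (weight-add 2 V (s .up-V) N (2 + L)) (cong (_+ β) b≡0)) (down-up .bound)
    0<M : 0 < M
    0<M = *-mono-< (star-size-pos n′ (s .adm-k)) (star-size-pos n′ (s .adm-l))
    0<K : 0 < K
    0<K = ≤-pred (s .adm-k .2≤k)
    rg = ranges {1} {1} {K} {L} {d} (sym (s .size)) refl (s .adm-k) (s .adm-l)
    X : ℕ
    X = L * (N₁ + 2 * (L + d + 2))
    X< : X < N₁ * N₁
    X< = Numeric.levels-1-2 K L d 1 2 (proj₁ rg) (proj₂ rg) (s≤s z≤n) 0<K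
    ratio : N₁ * α′ ≤ 2 * (L + d + 2) * a
    ratio = subst (λ t → t * α′ ≤ 2 * (L + d + 2) * a) (*-identityˡ N₁) (generic-ratio 1 1 K L d (s .up-U) (s .comp-U) refl)
    chain : N₁ * N₁ * ((a + α′) * β′) ≤ X * (a * β)
    chain = begin
      N₁ * N₁ * ((a + α′) * β′)               ≡⟨ e₁ N₁ a α′ β′ ⟩
      (N₁ * a + N₁ * α′) * (N₁ * β′)          ≡⟨ cong ((N₁ * a + N₁ * α′) *_) (scale N L 2 (∂ 2 V)) ⟩
      (N₁ * a + N₁ * α′) * (L * β)            ≤⟨ *-monoˡ-≤ (L * β) (+-monoʳ-≤ (N₁ * a) ratio) ⟩
      (N₁ * a + 2 * (L + d + 2) * a) * (L * β)    ≡⟨ e₂ N₁ a L (2 * (L + d + 2)) β ⟩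
      X * (a * β)                             ∎
      where
      open ≤-Reasoning
      e₁ : ∀ n a x y → n * n * ((a + x) * y) ≡ (n * a + n * x) * (n * y)
      e₁ = solve-∀
      e₂ : ∀ n a L t β → (n * a + t * a) * (L * β) ≡ L * (n + t) * (a * β)
      e₂ = solve-∀
    P<M : (a + α′) * β′ < M
    P<M = *-cancelˡ-< (N₁ * N₁) _ _ (≤-<-trans chain (≤-<-trans (*-monoʳ-≤ X aβ≤M)
            (*-monoˡ-< M {{ >-nonZero 0<M }} X<)))

  -- Here U lies in { x : ∣ x ∣ ≥ 3 }, the competitor that overtakes the star just below n = 3 (k - 1).
  few-small-sets : ∀ {k N} {U : Family 4} → Admissible n′ k → N + 4 ≡ 2 + n′ → Upset U → AllCompressed U →
    (∀ x → U (false ∷ x) ≡ true → ∣ x ∣ ≢ 2) → weight N k U < star-size n′ k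
  few-small-sets {k} {N} {U} ak size up comp none = ≤-<-trans (∑-mono-≤ {g = λ x → χ (large x) * w N k ∣ x ∣} pointwise)
    (subst₂ _<_ (sym count) (sym expand) (+-monoˡ-< (2 * w₃ + w₄) (doubling (m≤n⇒∃[o]m+o≡n (ak .2≤k)))))
    where
    large : Family 4
    large x = 3 ≤ᵇ ∣ x ∣
    w₂ w₃ w₄ : ℕ
    w₂ = w N k 2
    w₃ = w N k 3
    w₄ = w N k 4
    no-low : ∀ x → ∣ x ∣ ≤ 2 → ¬ U (false ∷ x) ≡ true
    no-low x h u with superset-of-size x 2 h (s≤s (s≤s z≤n))
    ... | y , x⊆y , ∣y∣ = none y (up (s⊆s x⊆y) u) ∣y∣
    no-high : ∀ x → ∣ x ∣ ≤ 1 → ¬ U (true ∷ x) ≡ true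
    no-high x h u with superset-of-size x 2 (m≤n⇒m≤1+n h) (s≤s (s≤s z≤n))
    ... | y , x⊆y , ∣y∣ = none y (promote {U = U} up comp u x⊆y λ e → <⇒≢ (s≤s h) (trans e ∣y∣)) ∣y∣
    is-large : ∀ x → U x ≡ true → 3 ≤ ∣ x ∣
    is-large (false ∷ x) u = ≰⇒> λ h → no-low x h u
    is-large (true ∷ x) u  = ≰⇒> λ { (s≤s h) → no-high x h u }
    ≤⇒≤ᵇ-true : ∀ {a b} → a ≤ b → (a ≤ᵇ b) ≡ true
    ≤⇒≤ᵇ-true {a} {b} h with a ≤ᵇ b | ≤⇒≤ᵇ h
    ... | true | _ = refl
    pointwise : ∀ x → χ (U x) * w N k ∣ x ∣ ≤ χ (large x) * w N k ∣ x ∣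
    pointwise x = χ-*-≤ (w N k ∣ x ∣) (λ u _ → ≤⇒≤ᵇ-true (is-large x u))
    count : ∑ (λ x → χ (large x) * w N k ∣ x ∣) ≡ (2 * w₃) + (2 * w₃ + w₄)
    count = e w₃ w₄
      where
      e : ∀ a b → (0 + 0 + (0 + 0) + (0 + 0 + (0 + (a + 0))) + (0 + 0 + (0 + (a + 0)) + (0 + (a + 0) + ((a + 0) + (b + 0)))))
            ≡ 2 * a + (2 * a + b)
      e = solve-∀
    expand : star-size n′ k ≡ w₂ + (2 * w₃ + w₄)
    expand = trans (cong (λ n → w n k 2) (+-cancelˡ-≡ 2 _ _ (trans (sym size) (+-comm N 4))))
      (trans (w-Pascal (suc N) k 2) (trans (cong₂ _+_ (w-Pascal N k 2) (w-Pascal N k 3)) (e w₂ w₃ w₄)))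
      where
      e : ∀ a b c → (a + b) + (b + c) ≡ a + (2 * b + c)
      e = solve-∀
    3K≤N : ∀ K → 2 + K ≡ k → 3 * K ≤ N
    3K≤N K refl = *-cancelˡ-≤ 3 (+-cancelʳ-≤ 12 _ _ (begin
      3 * (3 * K) + 12     ≤⟨ m≤m+n _ (K + 8) ⟩
      3 * (3 * K) + 12 + (K + 8)    ≡⟨ e K ⟩
      10 * (2 + K)         ≤⟨ ak .range ⟩
      3 * (2 + n′)         ≡⟨ cong (3 *_) (sym size) ⟩
      3 * (N + 4)          ≡⟨ *-distribˡ-+ 3 N 4 ⟩
      3 * N + 12           ∎))
      where
      open ≤-Reasoning
      e : ∀ K → 3 * (3 * K) + 12 + (K + 8) ≡ 10 * (2 + K)
      e = solve-∀
    -- Absorption gives (N + 1) w₃ = K (w₂ + w₃), so 3 K ≤ N puts w₃ below a third of w₂ + w₃. If w₃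
    -- = 0, which includes K = 0, positivity of w₂ suffices.
    doubling : ∃[ K ] 2 + K ≡ k → 2 * w₃ < w₂
    doubling (K , refl) with m≤n⇒m<n∨m≡n (z≤n {w₃})
    ... | inj₂ e = subst (λ t → 2 * t < w₂) e (w-pos N (2 + K) 2 (s≤s (s≤s z≤n))
                     (≤-trans (+-monoʳ-≤ 2 K≤N) (≤-reflexive (+-comm 2 N))))
      where
      K≤N : K ≤ N
      K≤N = ≤-trans (m≤m+n K _) (3K≤N K refl)
    ... | inj₁ pos = *-cancelˡ-< K _ _ (+-cancelʳ-< (K * w₃) _ _ (begin-strict
      K * (2 * w₃) + K * w₃    ≡⟨ e K w₃ ⟩
      3 * K * w₃               <⟨ *-monoˡ-< w₃ {{ >-nonZero pos }} (s≤s (3K≤N K refl)) ⟩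
      suc N * w₃               ≡⟨ w-absorb′ N K 2 ⟨
      K * w₂ + K * w₃          ∎))
      where
      open ≤-Reasoning
      e : ∀ K w → K * (2 * w) + K * w ≡ 3 * K * w
      e = solve-∀

-- Induction over the levels and over the length of the prefix.

module Induct (n′ : ℕ) where

  open LevelSteps n′
  open Admissible
  open Good
  open Setting

  -- A headless 2-set in either family gives the ratio for that family, and the equal levels allow
  -- the roles to be exchanged. If neither has one, each weight separately is below that of the
  -- star.
  step-two-two : ∀ {K L d N} {U V : Family 4} → Setting (2 + K) (2 + L) N U V → N ≡ K + L + d →
    Good n′ (2 + K) (2 + L) N (add-level 2 U) (cut-level 2 V) →
    Good n′ (2 + K) (2 + L) N (cut-level 2 U) (add-level 2 V) → Good n′ (2 + K) (2 + L) N U V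
  step-two-two {K} {L} {d} {N} {U} {V} s N≡ up-down down-up
    with any-or-none (level-of 2 U) | any-or-none (level-of 2 V)
  ... | inj₁ (x , h) | _ = exchange-step s
    (small-two-two s N≡ x (proj₁ (∧-true {U (false ∷ x)} h)) (≡ᵇ-true (proj₂ (∧-true {U (false ∷ x)} h)))) up-down down-up
  ... | inj₂ _ | inj₁ (y , h) = Good-sym n′ (exchange-step (Setting-sym s)
    (small-two-two (Setting-sym s) (trans N≡ (cong (_+ d) (+-comm K L))) y
      (proj₁ (∧-true {V (false ∷ y)} h)) (≡ᵇ-true (proj₂ (∧-true {V (false ∷ y)} h))))
    (Good-sym n′ down-up) (Good-sym n′ up-down))
  ... | inj₂ f | inj₂ g = Good-strict n′ (*-mono-<
    (few-small-sets (s .adm-k) (s .size) (s .up-U) (s .comp-U) (none {U} f))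
    (few-small-sets (s .adm-l) (s .size) (s .up-V) (s .comp-V) (none {V} g)))
    where
    none : ∀ {F : Family 4} → (∀ x → level-of 2 F x ≡ false) → ∀ x → F (false ∷ x) ≡ true → ∣ x ∣ ≢ 2
    none {F} f x u ∣x∣ = true≢false (∧-intro u (trans (cong (_≡ᵇ 2) ∣x∣) refl)) (f x)

  step-by-shape : ∀ {i r K L d N m} {U V : Family (suc m)} → Shape i r → i + r ≡ m → i ≤ suc r →
    Setting (i + K) (suc r + L) N U V → N ≡ K + L + d →
    ∀ x → boundary i U x ≡ true → ∀ y → boundary (suc r) V y ≡ true →
    Good n′ (i + K) (suc r + L) N (add-level i U) (cut-level (suc r) V) →
    Good n′ (i + K) (suc r + L) N (cut-level i U) (add-level (suc r) V) →
    Good n′ (i + K) (suc r + L) N U V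
  step-by-shape (generic ratio) i+r i≤j s N≡ x hx y hy up-down down-up =
    exchange-step s (small-generic s N≡ i+r i≤j ratio) up-down down-up
  step-by-shape one-two refl i≤j s N≡ x hx y hy up-down down-up = step-one-two s N≡ y hy down-up
  step-by-shape two-two refl i≤j s N≡ x hx y hy up-down down-up = step-two-two s N≡ up-down down-up
  step-by-shape {U = U} three-three refl i≤j s N≡ x hx y hy up-down down-up =
    exchange-step s (small-three-three s N≡ top) up-down down-up
    where
    top : U (false ∷ ⊤) ≡ true
    top = promote {U = U} (s .up-U) (s .comp-U) (proj₁ (boundary-elim 3 U x hx)) ⊆⊤
      (λ e → contradiction (trans (sym (proj₂ (proj₂ (boundary-elim 3 U x hx)))) e) λ ())

  step-ordered : ∀ {i r k l N m} {U V : Family (suc m)} → 2 ≤ m → i + r ≡ m → i ≤ suc r →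
    Setting k l N U V →
    Good n′ k l N (add-level i U) (cut-level (suc r) V) →
    Good n′ k l N (cut-level i U) (add-level (suc r) V) →
    Good n′ k l N U V
  step-ordered {i} {r} {k} {l} {N} {m} {U} {V} 2≤m i+r i≤j s up-down down-up
    with any-or-none (boundary i U) | any-or-none (boundary (suc r) V) | i ≤? k | suc r ≤? l
  ... | inj₂ f | _ | _ | _ = Good-sym n′ (free-step (λ x h _ → true≢false h (f x)) (Good-sym n′ down-up))
  ... | inj₁ _ | inj₂ f | _ | _ = free-step (λ y h _ → true≢false h (f y)) up-down
  -- A k-set has no trace with more than k points, so this boundary carries no weight and may be
  -- deleted freely.
  ... | inj₁ _ | inj₁ _ | no k<i | _ = Good-sym n′ (free-step
    (λ _ _ pos → contradiction (sym (w-zero N k (suc i) (m≤n⇒m≤1+n (≰⇒> k<i)))) (<⇒≢ pos)) (Good-sym n′ down-up))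
  ... | inj₁ _ | inj₁ _ | yes _ | no l<j = free-step
    (λ _ _ pos → contradiction (sym (w-zero N l (suc (suc r)) (m≤n⇒m≤1+n (≰⇒> l<j)))) (<⇒≢ pos)) up-down
  ... | inj₁ (x , hx) | inj₁ (y , hy) | yes i≤k | yes j≤l
    with m≤n⇒∃[o]m+o≡n i≤k | m≤n⇒∃[o]m+o≡n j≤l
  ...   | K , refl | L , refl = step-by-shape (classify i r 1≤i i≤j (subst (2 ≤_) (sym i+r) 2≤m)) i+r i≤j s
    (sym (proj₂ room)) x hx y hy up-down down-up
    where
    -- The two boundary sets share the head, and crossing demands a second common point, which lies
    -- in both prefixes.
    1≤i : 1 ≤ i
    1≤i = ≤-trans (≤-pred (s .cross (true ∷ x) (true ∷ y) (proj₁ (boundary-elim i U x hx)) (proj₁ (boundary-elim (suc r) V y hy))))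
      (≤-trans (∣p∩q∣≤∣p∣ x y) (≤-reflexive (proj₂ (proj₂ (boundary-elim i U x hx)))))
    K+L≤N : K + L ≤ N
    K+L≤N = +-cancelʳ-≤ (suc (i + r)) _ _ (begin
      K + L + suc (i + r)      ≡⟨ e i r K L ⟩
      i + K + (suc r + L)      ≤⟨ k+l≤n n′ (s .adm-k) (s .adm-l) ⟩
      2 + n′                   ≡⟨ s .size ⟨
      N + suc m                ≡⟨ cong (λ m → N + suc m) i+r ⟨
      N + suc (i + r)          ∎)
      where
      open ≤-Reasoning
      e : ∀ i r K L → K + L + (1 + (i + r)) ≡ i + K + ((1 + r) + L)
      e = solve-∀
    room : ∃[ d ] K + L + d ≡ N
    room = m≤n⇒∃[o]m+o≡n K+L≤N

  step : ∀ {i j k l N m} {U V : Family (suc m)} → 2 ≤ m → i + j ≡ suc m → Setting k l N U V →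
    Good n′ k l N (add-level i U) (cut-level j V) →
    Good n′ k l N (cut-level i U) (add-level j V) →
    Good n′ k l N U V
  step {zero} {zero} 2≤m () s up-down down-up
  step {zero} {suc r} 2≤m e s up-down down-up = step-ordered 2≤m (suc-injective e) z≤n s up-down down-up
  step {suc i} {zero} 2≤m e s up-down down-up = Good-sym n′ (step-ordered {zero} {i} 2≤m
    (suc-injective (trans (sym (+-identityʳ (suc i))) e)) z≤n (Setting-sym s) (Good-sym n′ down-up) (Good-sym n′ up-down))
  step {suc i} {suc r} 2≤m e s up-down down-up with ≤-total (suc i) (suc r)
  ... | inj₁ h = step-ordered 2≤m (trans (sym (+-suc i r)) (suc-injective e)) h s up-down down-up
  ... | inj₂ h = Good-sym n′ (step-ordered {suc r} {i} 2≤m (trans (cong suc (+-comm r i)) (trans (sym (+-suc i r)) (suc-injective e))) h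
                   (Setting-sym s) (Good-sym n′ down-up) (Good-sym n′ up-down))

  add-cut : ∀ {k l N m i j} {U V : Family (suc m)} → i + j ≡ suc m → Setting k l N U V →
    Setting k l N (add-level i U) (cut-level j V)
  add-cut {i = i} {j} {U} {V} e s = record
    { adm-k = s .adm-k ; adm-l = s .adm-l ; size = s .size
    ; up-U = add-upset (s .up-U) (s .comp-U) i ; up-V = cut-upset (s .up-V) (s .comp-V) j
    ; comp-U = add-compressed (s .up-U) (s .comp-U) i ; comp-V = cut-compressed (s .up-V) (s .comp-V) j
    ; cross = level-cross (s .up-U) (s .comp-U) {V} i j e (s .cross) }

  NoBoundary : ∀ {m} → (ℕ → Set) → Family (suc m) → Set
  NoBoundary P U = ∀ x → P ∣ x ∣ → U (true ∷ x) ≡ true → U (false ∷ x) ≡ true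

  add-no-boundary : ∀ {m P} i (U : Family (suc m)) → NoBoundary P U →
    NoBoundary (λ e → e ≡ i ⊎ P e) (add-level i U)
  add-no-boundary i U clean x p h with add-elim i U true x h | p
  ... | inj₂ (u , e) | _      = add-intro i U false x u e
  ... | inj₁ u       | inj₁ e = add-intro i U false x u e
  ... | inj₁ u       | inj₂ q = add-⊇ i U (false ∷ x) (clean x q u)

  cut-no-boundary : ∀ {m P} i (U : Family (suc m)) → NoBoundary P U →
    NoBoundary (λ e → e ≡ i ⊎ P e) (cut-level i U)
  cut-no-boundary i U clean x p h with cut-elim i U true x h | p
  ... | u , low | inj₁ e = cut-intro i U false x (low e) λ _ → low e
  ... | u , low | inj₂ q = cut-intro i U false x (clean x q u) λ _ → clean x q u

  weaken : ∀ {m} {P Q : ℕ → Set} {U : Family (suc m)} → (∀ e → Q e → P e) → NoBoundary P U → NoBoundary Q U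
  weaken f clean x q = clean x (f ∣ x ∣ q)

  weight-tail : ∀ {m} N k {U : Family (suc m)} → (∀ x → U (true ∷ x) ≡ true → U (false ∷ x) ≡ true) →
    weight N k U ≤ weight (suc N) k (λ x → U (false ∷ x))
  weight-tail N k {U} clean = ≤-trans
    (≤-reflexive (sym (∑-+ (λ x → χ (U (false ∷ x)) * w N k ∣ x ∣) (λ x → χ (U (true ∷ x)) * w N k (suc ∣ x ∣)))))
    (∑-mono-≤ pointwise)
    where
    pointwise : ∀ x → χ (U (false ∷ x)) * w N k ∣ x ∣ + χ (U (true ∷ x)) * w N k (suc ∣ x ∣)
      ≤ χ (U (false ∷ x)) * w (suc N) k ∣ x ∣
    pointwise x = ≤-trans
      (+-monoʳ-≤ (χ (U (false ∷ x)) * w N k ∣ x ∣) (χ-*-≤ (w N k (suc ∣ x ∣)) (λ u _ → clean x u)))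
      (≤-reflexive (trans (sym (*-distribˡ-+ (χ (U (false ∷ x))) (w N k ∣ x ∣) (w N k (suc ∣ x ∣))))
        (cong (χ (U (false ∷ x)) *_) (sym (w-Pascal N k ∣ x ∣)))))

  contained-tail : ∀ {m} N k {U : Family (suc m)} {T} → (∀ x → U (true ∷ x) ≡ true → U (false ∷ x) ≡ true) →
    Contained k (suc N) T (λ x → U (false ∷ x)) → Contained k N (false ∷ T) U
  contained-tail N k clean con (false ∷ x) u pos = s⊆s (con x u
    (<-≤-trans pos (≤-trans (m≤m+n _ _) (≤-reflexive (sym (w-Pascal N k ∣ x ∣))))))
  contained-tail N k clean con (true ∷ x) u pos = out⊆ (con x (clean x u)
    (<-≤-trans pos (≤-trans (m≤n+m _ _) (≤-reflexive (sym (w-Pascal N k ∣ x ∣))))))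

  Good-tail : ∀ {k l N m} {U V : Family (suc m)} →
    (∀ x → U (true ∷ x) ≡ true → U (false ∷ x) ≡ true) →
    (∀ x → V (true ∷ x) ≡ true → V (false ∷ x) ≡ true) →
    Good n′ k l (suc N) (λ x → U (false ∷ x)) (λ x → V (false ∷ x)) → Good n′ k l N U V
  Good-tail {k} {l} {N} {U = U} {V} cu cv g .bound =
    ≤-trans (*-mono-≤ (weight-tail N k {U} cu) (weight-tail N l {V} cv)) (g .bound)
  Good-tail {k} {l} {N} {U = U} {V} cu cv g .extremal e = go (g .extremal (≤-antisym (g .bound)
    (≤-trans (≤-reflexive (sym e)) (*-mono-≤ (weight-tail N k {U} cu) (weight-tail N l {V} cv)))))
    where
    go : ∃[ T ] (∣ T ∣ ≡ 2 × Contained k (suc N) T (λ x → U (false ∷ x)) × Contained l (suc N) T (λ x → V (false ∷ x))) →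
         ∃[ T ] (∣ T ∣ ≡ 2 × Contained k N T U × Contained l N T V)
    go (T , ∣T∣ , tu , tv) = false ∷ T , ∣T∣ , contained-tail N k cu tu , contained-tail N l cv tv

  module _ {k l : ℕ} (ak : Admissible n′ k) (al : Admissible n′ l) where

    AllGood : ℕ → Set
    AllGood m = ∀ {N} {U V : Family m} → N + m ≡ 2 + n′ → Upset U → Upset V → Cross U V → Good n′ k l N U V

    -- The next pair of levels is i = t and j = r - 1. Either alternative empties the boundaries of
    -- `U` at i and of `V` at j without refilling those treated before, so both branches reach the
    -- same state. At r = 0 neither family depends on the head, which can join the free elements.
    levels : ∀ {m N} → 2 ≤ m → AllGood m → ∀ r t → t + r ≡ suc (suc m) → {U V : Family (suc m)} → Setting k l N U V →
      NoBoundary (_< t) U → NoBoundary (r ≤_) V → Good n′ k l N U V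
    levels {m} {N} 2≤m ih zero t e {U} {V} s cu cv = Good-tail (λ x → cu x (small x)) (λ x → cv x z≤n)
      (ih (trans (sym (+-suc N m)) (s .size)) (λ h → s .up-U (s⊆s h)) (λ h → s .up-V (s⊆s h))
          (λ x y u v → s .cross (false ∷ x) (false ∷ y) u v))
      where
      small : ∀ (x : Subset m) → ∣ x ∣ < t
      small x = ≤-trans (s≤s (≤-trans (∣p∣≤n x) (n≤1+n m))) (≤-reflexive (trans (sym e) (+-identityʳ t)))
    levels {m} {N} 2≤m ih (suc j) i e {U} {V} s cu cv = step {i} {j} 2≤m i+j s
      (levels 2≤m ih j (suc i) next (add-cut i+j s)
        (weaken {U = add-level i U} below (add-no-boundary {P = _< i} i U cu)) (weaken {U = cut-level j V} above (cut-no-boundary {P = suc j ≤_} j V cv)))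
      (levels 2≤m ih j (suc i) next (Setting-sym (add-cut (trans (+-comm j i) i+j) (Setting-sym s)))
        (weaken {U = cut-level i U} below (cut-no-boundary {P = _< i} i U cu)) (weaken {U = add-level j V} above (add-no-boundary {P = suc j ≤_} j V cv)))
      where
      next : suc i + j ≡ suc (suc m)
      next = trans (sym (+-suc i j)) e
      i+j : i + j ≡ suc m
      i+j = suc-injective next
      below : ∀ e → e < suc i → e ≡ i ⊎ e < i
      below e (s≤s h) with m≤n⇒m<n∨m≡n h
      ... | inj₁ lt = inj₂ lt
      ... | inj₂ eq = inj₁ eq
      above : ∀ e → j ≤ e → e ≡ j ⊎ suc j ≤ e
      above e h with m≤n⇒m<n∨m≡n h
      ... | inj₁ lt = inj₂ lt
      ... | inj₂ eq = inj₁ (sym eq)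

    compressing : ∀ {m} → 2 ≤ m → AllGood m → (zs : List (Fin m)) → ∀ {N} {U V : Family (suc m)} →
      (∀ z → z ∈ₗ zs ⊎ (Compressed z U × Compressed z V)) →
      N + suc m ≡ 2 + n′ → Upset U → Upset V → Cross U V → Good n′ k l N U V
    compressing {m} 2≤m ih [] {N} {U} {V} c size upU upV cross = levels 2≤m ih (suc (suc m)) 0 refl
      (record { adm-k = ak ; adm-l = al ; size = size ; up-U = upU ; up-V = upV
              ; comp-U = λ z → proj₁ (done z) ; comp-V = λ z → proj₂ (done z) ; cross = cross })
      (λ x ()) (λ y h → contradiction (≤-trans h (∣p∣≤n y)) (<⇒≱ (s≤s (n≤1+n m))))
      where
      done : ∀ z → Compressed z U × Compressed z V
      done z with c z
      ... | inj₂ d = d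
    compressing 2≤m ih (z ∷ zs) {N} {U} {V} c size upU upV cross =
      Good-uncompress n′ ak al size z upU upV cross
        (compressing 2≤m ih zs c′ size (compress-upset z upU) (compress-upset z upV) (compress-cross z {U} {V} cross))
      where
      c′ : ∀ z′ → z′ ∈ₗ zs ⊎ (Compressed z′ (compress z U) × Compressed z′ (compress z V))
      c′ z′ with c z′
      ... | inj₁ (Any.here refl) = inj₂ (compress-compressed z U , compress-compressed z V)
      ... | inj₁ (Any.there i)   = inj₁ i
      ... | inj₂ (cu , cv) = inj₂ (compress-preserves-compressed z z′ {U} cu , compress-preserves-compressed z z′ {V} cv)

    weight-none : ∀ {m} N j {F : Family m} → Upset F → F ⊤ ≡ false → weight N j F ≡ 0
    weight-none {m} N j {F} up f = trans (∑-cong zero-term) (∑-zero {m})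
      where
      zero-term : ∀ x → χ (F x) * w N j ∣ x ∣ ≡ 0
      zero-term x with F x in e
      ... | false = refl
      ... | true  = true≢false (up ⊆⊤ e) f

    positive-bound : 0 < star-size n′ k * star-size n′ l
    positive-bound = *-mono-< (star-size-pos n′ ak) (star-size-pos n′ al)

    -- If both upsets contain the full prefix, crossing with it forces every member to be that pair.
    -- Otherwise one of them is empty and the product is 0.
    two-points : AllGood 2
    two-points {N} {U} {V} size upU upV cross with U ⊤ in u | V ⊤ in v
    ... | true | true = record
      { bound = *-mono-≤ (contained-weight n′ {k} size refl (con {U} ⊆U)) (contained-weight n′ {l} size refl (con {V} ⊆V))
      ; extremal = λ _ → ⊤ , refl , con {U} ⊆U , con {V} ⊆V }
      where
      ⊆U : ∀ x → U x ≡ true → 2 ≤ ∣ x ∣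
      ⊆U x ux = ≤-trans (cross x ⊤ ux v) (∣p∩q∣≤∣p∣ x ⊤)
      ⊆V : ∀ x → V x ≡ true → 2 ≤ ∣ x ∣
      ⊆V x vx = ≤-trans (cross ⊤ x u vx) (∣p∩q∣≤∣q∣ ⊤ x)
      con : ∀ {F : Family 2} {j} → (∀ x → F x ≡ true → 2 ≤ ∣ x ∣) → Contained j N ⊤ F
      con big x fx _ = subst (⊤ ⊆_) (sym (∣p∣≡n⇒p≡⊤ (≤-antisym (∣p∣≤n x) (big x fx)))) ⊆-refl
    ... | false | _ = Good-strict n′ (subst (_< star-size n′ k * star-size n′ l)
      (sym (cong (_* weight N l V) (weight-none N k upU u))) positive-bound)
    ... | true | false = Good-strict n′ (subst (_< star-size n′ k * star-size n′ l)
      (sym (trans (cong (weight N k U *_) (weight-none N l upV v)) (*-zeroʳ (weight N k U)))) positive-bound)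

    all-good : ∀ m → AllGood (2 + m)
    all-good zero    = two-points
    all-good (suc m) size upU upV cross =
      compressing (s≤s (s≤s z≤n)) (all-good m) (allFin (2 + m)) (λ z → inj₁ (∈-allFin z)) size upU upV cross

-- Passage from lists of sets to weighted upsets and back.

upclosure : ∀ {m} → List (Subset m) → Family m
upclosure []      x = false
upclosure (A ∷ 𝒜) x = (A ⊆ᵇ x) ∨ upclosure 𝒜 x

upclosure-elim : ∀ {m} (𝒜 : List (Subset m)) x → upclosure 𝒜 x ≡ true → ∃[ A ] (A ∈ₗ 𝒜 × A ⊆ x)
upclosure-elim (A ∷ 𝒜) x h with ∨-true {A ⊆ᵇ x} h
... | inj₁ s = A , Any.here refl , ⊆ᵇ⇒⊆ A x s
... | inj₂ t with upclosure-elim 𝒜 x t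
...   | B , i , s = B , Any.there i , s

upclosure-intro : ∀ {m} {𝒜 : List (Subset m)} {A x} → A ∈ₗ 𝒜 → A ⊆ x → upclosure 𝒜 x ≡ true
upclosure-intro {A = A} {x} (Any.here refl) s = ∨-introˡ (⊆⇒⊆ᵇ A x s)
upclosure-intro {𝒜 = B ∷ 𝒜} {A} {x} (Any.there i) s = ∨-introʳ {B ⊆ᵇ x} (upclosure-intro i s)

upclosure-upset : ∀ {m} (𝒜 : List (Subset m)) → Upset (upclosure 𝒜)
upclosure-upset 𝒜 {x} {y} s h with upclosure-elim 𝒜 x h
... | A , i , t = upclosure-intro i (⊆-trans t s)

upclosure-cross : ∀ {m} {𝒜 ℬ : List (Subset m)} → CrossIntersecting 2 𝒜 ℬ → Cross (upclosure 𝒜) (upclosure ℬ)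
upclosure-cross {𝒜 = 𝒜} {ℬ} c x y u v with upclosure-elim 𝒜 x u | upclosure-elim ℬ y v
... | A , i , s | B , j , t = ≤-trans (c i j) (p⊆q⇒∣p∣≤∣q∣ λ h →
  x∈p∩q⁺ (s (proj₁ (x∈p∩q⁻ A B h)) , t (proj₂ (x∈p∩q⁻ A B h))))

-- With no free element left, `w 0 k` is the indicator of size k. Hence `weight 0 k` of an upward
-- closure counts its k-sets, and closing upwards adds none to a family of k-sets.
w-full : ∀ k → w 0 k k ≡ 1
w-full zero    = refl
w-full (suc k) = w-full k

w-full⁻¹ : ∀ k e → 0 < w 0 k e → e ≡ k
w-full⁻¹ zero    zero    h = refl
w-full⁻¹ (suc k) zero    ()
w-full⁻¹ (suc k) (suc e) h = cong suc (w-full⁻¹ k e h)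

w-full-≤1 : ∀ k e → w 0 k e ≤ 1
w-full-≤1 zero    zero    = ≤-refl
w-full-≤1 (suc k) zero    = z≤n
w-full-≤1 zero    (suc e) = z≤n
w-full-≤1 (suc k) (suc e) = w-full-≤1 k e

_==_ : ∀ {m} → Subset m → Subset m → Bool
[]          == []          = true
(false ∷ a) == (false ∷ x) = a == x
(true ∷ a)  == (true ∷ x)  = a == x
(false ∷ a) == (true ∷ x)  = false
(true ∷ a)  == (false ∷ x) = false

==⇒≡ : ∀ {m} (a x : Subset m) → (a == x) ≡ true → a ≡ x
==⇒≡ []          []          _ = refl
==⇒≡ (false ∷ a) (false ∷ x) h = cong (false ∷_) (==⇒≡ a x h)
==⇒≡ (true ∷ a)  (true ∷ x)  h = cong (true ∷_) (==⇒≡ a x h)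

==-refl : ∀ {m} (a : Subset m) → (a == a) ≡ true
==-refl []          = refl
==-refl (false ∷ a) = ==-refl a
==-refl (true ∷ a)  = ==-refl a

∑-== : ∀ {m} (a : Subset m) → ∑ (λ x → χ (a == x)) ≡ 1
∑-==         []          = refl
∑-== {suc m} (false ∷ a) = cong₂ _+_ (∑-== a) (∑-zero {m})
∑-== {suc m} (true ∷ a)  = cong₂ _+_ (∑-zero {m}) (∑-== a)

_∖_ : ∀ {m} → Family m → Subset m → Family m
(F ∖ a) x = F x ∧ not (a == x)

≢⇒∖ : ∀ {m} (F : Family m) a x → F x ≡ true → a ≢ x → (F ∖ a) x ≡ true
≢⇒∖ F a x f ne with a == x in e
... | true  = contradiction (==⇒≡ a x e) ne
... | false = ∧-intro f refl

∖⇒ : ∀ {m} (F : Family m) a x → (F ∖ a) x ≡ true → F x ≡ true × a ≢ x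
∖⇒ F a x h with ∧-true {F x} h
... | f , g = f , λ { refl → true≢false g (cong not (==-refl a)) }

length≤weight : ∀ {m} k {F : Family m} (𝒜 : List (Subset m)) → Unique 𝒜 →
  (∀ {A} → A ∈ₗ 𝒜 → F A ≡ true × ∣ A ∣ ≡ k) → length 𝒜 ≤ weight 0 k F
length≤weight k [] u h = z≤n
length≤weight k {F} (A ∷ 𝒜) (A∉ ∷ u) h = ≤-trans
  (s≤s (length≤weight k {F ∖ A} 𝒜 u λ i →
    ≢⇒∖ F A _ (proj₁ (h (Any.there i))) (All.lookup A∉ i) , proj₂ (h (Any.there i))))
  (weight-mono-< 0 k (λ x d _ → proj₁ (∖⇒ F A x d)) A pos gone (proj₁ (h (Any.here refl))))
  where
  pos : 0 < w 0 k ∣ A ∣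
  pos = subst (0 <_) (sym (trans (cong (w 0 k) (proj₂ (h (Any.here refl)))) (w-full k))) (s≤s z≤n)
  gone : (F ∖ A) A ≡ false
  gone with (F ∖ A) A in e
  ... | false = refl
  ... | true  = contradiction refl (proj₂ (∖⇒ F A A e))

weight≤length : ∀ {m} k {F : Family m} (𝒜 : List (Subset m)) →
  (∀ x → F x ≡ true → ∣ x ∣ ≡ k → x ∈ₗ 𝒜) → weight 0 k F ≤ length 𝒜
weight≤length {m} k {F} [] h = ≤-trans (∑-mono-≤ {g = λ _ → 0} zero-term) (≤-reflexive (∑-zero {m}))
  where
  zero-term : ∀ x → χ (F x) * w 0 k ∣ x ∣ ≤ 0
  zero-term x = χ-*-≤ {F x} {false} (w 0 k ∣ x ∣) λ f pos → contradiction (h x f (w-full⁻¹ k ∣ x ∣ pos)) λ ()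
weight≤length {m} k {F} (A ∷ 𝒜) h = begin
  weight 0 k F
    ≤⟨ ∑-mono-≤ pointwise ⟩
  ∑ (λ x → χ (A == x) + χ ((F ∖ A) x) * w 0 k ∣ x ∣)
    ≡⟨ ∑-+ (λ x → χ (A == x)) (λ x → χ ((F ∖ A) x) * w 0 k ∣ x ∣) ⟩
  ∑ (λ x → χ (A == x)) + weight 0 k (F ∖ A)
    ≤⟨ +-mono-≤ (≤-reflexive (∑-== A)) (weight≤length k {F ∖ A} 𝒜 rest) ⟩
  suc (length 𝒜) ∎
  where
  open ≤-Reasoning
  rest : ∀ x → (F ∖ A) x ≡ true → ∣ x ∣ ≡ k → x ∈ₗ 𝒜
  rest x d e with ∖⇒ F A x d
  ... | f , ne with h x f e
  ...   | Any.here p  = contradiction (sym p) ne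
  ...   | Any.there i = i
  pointwise : ∀ x → χ (F x) * w 0 k ∣ x ∣ ≤ χ (A == x) + χ ((F ∖ A) x) * w 0 k ∣ x ∣
  pointwise x with F x | A == x
  ... | false | _     = z≤n
  ... | true  | true  = ≤-trans (≤-reflexive (+-identityʳ _)) (≤-trans (w-full-≤1 k ∣ x ∣) (m≤m+n 1 _))
  ... | true  | false = ≤-refl

-- Full stars as lists, and the theorem.

module _ (n′ : ℕ) where

  private
    n = 2 + n′

  star-length-≤ : ∀ k (T : Subset n) → ∣ T ∣ ≡ 2 → (𝒜 : List (Subset n)) → Unique 𝒜 →
    (∀ {A} → A ∈ₗ 𝒜 → T ⊆ A × ∣ A ∣ ≡ k) → length 𝒜 ≤ star-size n′ k
  star-length-≤ k T ∣T∣ 𝒜 u h = subst (length 𝒜 ≤_) (weight-star n′ 0 k T refl ∣T∣)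
    (length≤weight k 𝒜 u λ {A} i → ⊆⇒⊆ᵇ T A (proj₁ (h i)) , proj₂ (h i))

  full-star-length : ∀ k (T : Subset n) → ∣ T ∣ ≡ 2 → (𝒜 : List (Subset n)) → Unique 𝒜 →
    IsFullStar k T 𝒜 → length 𝒜 ≡ star-size n′ k
  full-star-length k T ∣T∣ 𝒜 u full = ≤-antisym
    (star-length-≤ k T ∣T∣ 𝒜 u λ {A} i → let e , s = Equivalence.to (full A) i in s , e)
    (subst (_≤ length 𝒜) (weight-star n′ 0 k T refl ∣T∣)
      (weight≤length k 𝒜 λ x t e → Equivalence.from (full x) (e , ⊆ᵇ⇒⊆ T x t)))

  -- If a k-set containing `T` were missing, prepending it would give a duplicate-free list inside
  -- the star longer than the star.
  maximal-star : ∀ k (T : Subset n) → ∣ T ∣ ≡ 2 → (𝒜 : List (Subset n)) → IsKFamily k 𝒜 →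
    (∀ {A} → A ∈ₗ 𝒜 → T ⊆ A) → length 𝒜 ≡ star-size n′ k → IsFullStar k T 𝒜
  maximal-star k T ∣T∣ 𝒜 (u , sizes) sub len X = mk⇔
    (λ i → All.lookup sizes i , λ {z} → sub i {z}) from
    where
    from : ∣ X ∣ ≡ k × T ⊆ X → X ∈ₗ 𝒜
    from (e , s) with DecMembership._∈?_ (≡-dec _≟ᵇ_) X 𝒜
    ... | yes i = i
    ... | no ∉ = contradiction (star-length-≤ k T ∣T∣ (X ∷ 𝒜) (¬Any⇒All¬ 𝒜 ∉ ∷ u) members)
                   (<⇒≱ (s≤s (≤-reflexive (sym len))))
      where
      members : ∀ {A} → A ∈ₗ (X ∷ 𝒜) → T ⊆ A × ∣ A ∣ ≡ k
      members (Any.here refl) = s , e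
      members (Any.there i)   = sub i , All.lookup sizes i

  module _ {k ℓ} (ak : Admissible n′ k) (aℓ : Admissible n′ ℓ) (𝒜 ℬ : List (Subset n))
           (fa : IsKFamily k 𝒜) (fb : IsKFamily ℓ ℬ) (cross : CrossIntersecting 2 𝒜 ℬ) where

    private
      good : Good n′ k ℓ 0 (upclosure 𝒜) (upclosure ℬ)
      good = Induct.all-good n′ ak aℓ n′ refl (upclosure-upset 𝒜) (upclosure-upset ℬ) (upclosure-cross cross)

      a≤ : length 𝒜 ≤ weight 0 k (upclosure 𝒜)
      a≤ = length≤weight k 𝒜 (proj₁ fa) λ i → upclosure-intro i ⊆-refl , All.lookup (proj₂ fa) i

      b≤ : length ℬ ≤ weight 0 ℓ (upclosure ℬ)
      b≤ = length≤weight ℓ ℬ (proj₁ fb) λ i → upclosure-intro i ⊆-refl , All.lookup (proj₂ fb) i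

      contained : ∀ {j T} {𝒞 : List (Subset n)} → IsKFamily j 𝒞 → Contained j 0 T (upclosure 𝒞) →
        ∀ {A} → A ∈ₗ 𝒞 → T ⊆ A
      contained {j} (_ , sizes) con {A} i = con A (upclosure-intro i ⊆-refl)
        (subst (0 <_) (sym (trans (cong (w 0 j) (All.lookup sizes i)) (w-full j))) (s≤s z≤n))

    product-bound : length 𝒜 * length ℬ ≤ star-size n′ k * star-size n′ ℓ
    product-bound = ≤-trans (*-mono-≤ a≤ b≤) (Good.bound good)

    equality⇒star : length 𝒜 * length ℬ ≡ star-size n′ k * star-size n′ ℓ →
      ∃[ T ] (∣ T ∣ ≡ 2 × IsFullStar k T 𝒜 × IsFullStar ℓ T ℬ)
    equality⇒star e = go (Good.extremal good (≤-antisym (Good.bound good) (subst (_≤ weight 0 k (upclosure 𝒜) * weight 0 ℓ (upclosure ℬ)) e (*-mono-≤ a≤ b≤))))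
      where
      go : ∃[ T ] (∣ T ∣ ≡ 2 × Contained k 0 T (upclosure 𝒜) × Contained ℓ 0 T (upclosure ℬ)) →
        ∃[ T ] (∣ T ∣ ≡ 2 × IsFullStar k T 𝒜 × IsFullStar ℓ T ℬ)
      go (T , ∣T∣ , ca , cb) = T , ∣T∣ ,
        maximal-star k T ∣T∣ 𝒜 fa (contained fa ca) (proj₁ tight) ,
        maximal-star ℓ T ∣T∣ ℬ fb (contained fb cb) (proj₂ tight)
        where
        tight : length 𝒜 ≡ star-size n′ k × length ℬ ≡ star-size n′ ℓ
        tight = factors-maximal (≤-trans a≤ (contained-weight n′ {k} refl ∣T∣ ca))
          (≤-trans b≤ (contained-weight n′ {ℓ} refl ∣T∣ cb)) (star-size-pos n′ ak) (star-size-pos n′ aℓ) e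

    star⇒equality : ∃[ T ] (∣ T ∣ ≡ 2 × IsFullStar k T 𝒜 × IsFullStar ℓ T ℬ) →
      length 𝒜 * length ℬ ≡ star-size n′ k * star-size n′ ℓ
    star⇒equality (T , ∣T∣ , sa , sb) = cong₂ _*_
      (full-star-length k T ∣T∣ 𝒜 (proj₁ fa) sa) (full-star-length ℓ T ∣T∣ ℬ (proj₁ fb) sb)

  admissible : ∀ {k s} → 2 ≤ k → k ≤ s → 338 * s ≤ 100 * n → Admissible n′ k
  admissible {k} {s} 2≤k k≤s h = record { 2≤k = 2≤k ; range = *-cancelˡ-≤ 100 (begin
    100 * (10 * k)      ≡⟨ *-assoc 100 10 k ⟨
    -- 3 * 338 = 1014 = 14 + 1000, that is, 3.38 exceeds 10/3.
    1000 * k            ≤⟨ *-monoˡ-≤ k (m≤n+m 1000 14) ⟩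
    3 * 338 * k         ≡⟨ *-assoc 3 338 k ⟩
    3 * (338 * k)       ≤⟨ *-monoʳ-≤ 3 (≤-trans (*-monoʳ-≤ 338 k≤s) h) ⟩
    3 * (100 * n)       ≡⟨ *-assoc 3 100 n ⟨
    300 * n             ≡⟨ *-assoc 100 3 n ⟩
    100 * (3 * n)       ∎) }
    where open ≤-Reasoning

small-ground-set : ∀ {n k ℓ} → 2 ≤ k → n ≤ 1 → ¬ 338 * (k ⊔ ℓ) ≤ 100 * n
small-ground-set {n} {k} {ℓ} 2≤k n≤1 h = contradiction
  (≤-trans (*-monoʳ-≤ 338 (≤-trans 2≤k (m≤m⊔n k ℓ))) (≤-trans h (*-monoʳ-≤ 100 n≤1)))
  -- 338 * 2 = 676 = 575 + 101, which is more than 100 * 1.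
  (<⇒≱ (m≤n+m 101 575))

theorem1p4 : (n k ℓ : ℕ) → 2 ≤ k → 2 ≤ ℓ → 338 * (k ⊔ ℓ) ≤ 100 * n →
    (𝒜 ℬ : List (Subset n)) → IsKFamily k 𝒜 → IsKFamily ℓ ℬ →
    CrossIntersecting 2 𝒜 ℬ →
    (length 𝒜 * length ℬ ≤ ((n ∸ 2) C (k ∸ 2)) * ((n ∸ 2) C (ℓ ∸ 2)))
    × ((length 𝒜 * length ℬ ≡ ((n ∸ 2) C (k ∸ 2)) * ((n ∸ 2) C (ℓ ∸ 2)))
    ⇔ (∃[ T ] (∣ T ∣ ≡ 2 × IsFullStar k T 𝒜 × IsFullStar ℓ T ℬ)))
theorem1p4 zero k ℓ 2≤k _ h = contradiction h (small-ground-set 2≤k z≤n)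
theorem1p4 (suc zero) k ℓ 2≤k _ h = contradiction h (small-ground-set 2≤k (s≤s z≤n))
theorem1p4 (suc (suc n′)) (suc (suc k)) (suc (suc ℓ)) (s≤s (s≤s _)) (s≤s (s≤s _)) h 𝒜 ℬ fa fb cross =
  product-bound n′ ak aℓ 𝒜 ℬ fa fb cross ,
  mk⇔ (equality⇒star n′ ak aℓ 𝒜 ℬ fa fb cross) (star⇒equality n′ ak aℓ 𝒜 ℬ fa fb cross)
  where
  ak : Admissible n′ (2 + k)
  ak = admissible n′ (s≤s (s≤s z≤n)) (m≤m⊔n (2 + k) (2 + ℓ)) h
  aℓ : Admissible n′ (2 + ℓ)
  aℓ = admissible n′ (s≤s (s≤s z≤n)) (m≤n⊔m (2 + k) (2 + ℓ)) h
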